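{- The decision problem Strong Geodetic Recognition (given a graph $G=(V,E)$ and a vertex set $S\subseteq V(G)$, decide whether $S$ is a strong geodetic set of $G$) is NP-complete even when restricted to inputs in which $G$ is a bipartite graph of diameter at most $6$.
   Context: All graphs are finite, simple, undirected and connected. A shortest path assignment $I(S)$ of a vertex set $S\subseteq V(G)$ consists of exactly one chosen shortest path of $G$ between $u$ and $v$ for each unordered pair of distinct vertices $u,v\in S$. The set $S$ is a strong geodetic set of $G$ if there is a shortest path assignment $I(S)$ such that every vertex of $V(G)\setminus S$ lies on some path of $I(S)$ (for $|S|\ge 2$ this is the same as $\bigcup_{P\in I(S)}V(P)=V(G)$). The diameter of $G$ is the greatest distance (number of edges of a shortest path) between two of its vertices. -}

module Defs where

open import Data.Bool using (Bool; true; false; T)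
open import Data.Fin using (Fin; _<_)
open import Data.Fin.Subset using (Subset; _∈_; _∉_)
open import Data.List using (List; []; _∷_; _++_; [_]; length; map; concatMap; replicate; allFin)
import Data.List.Membership.Propositional as List
open import Data.List.Relation.Unary.Unique.Propositional using (Unique)
open import Data.Maybe using (Maybe; just; nothing)
import Data.Maybe as Maybe
open import Data.Nat using (ℕ; suc; _+_; _*_; _≤_; NonZero)
open import Data.Product using (Σ; Σ-syntax; ∃-syntax; _×_; _,_; proj₁)
open import Data.Sum using (_⊎_; inj₁; inj₂)
open import Data.Vec using (Vec; _∷_; head; toList; zipWith)
import Data.Vec as Vec
open import Function.Bundles using (_⇔_; _↔_)
open import Relation.Binary.PropositionalEquality using (_≡_; _≢_)

Finite : Set → Set
Finite A = ∃[ n ] (A ↔ Fin n)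

data Move : Set where
  left stay right : Move

-- A tape infinite in both directions, all but finitely many cells blank
-- (`nothing`).  `lefts` and `rights` list the cells on either side of
-- the head, nearest first; everything beyond them is blank.
record Tape (A : Set) : Set where
  constructor tape
  field
    lefts   : List (Maybe A)
    scanned : Maybe A
    rights  : List (Maybe A)

open Tape public

private variable
  A : Set

fromCells : List (Maybe A) → Tape A
fromCells []       = tape [] nothing []
fromCells (a ∷ as) = tape [] a as

move : Move → Tape A → Tape A
move stay  t                   = t
move left  (tape []       a r) = tape [] nothing (a ∷ r)
move left  (tape (b ∷ l) a r)  = tape l b (a ∷ r)
move right (tape l a [])       = tape (a ∷ l) nothing []
move right (tape l a (b ∷ r))  = tape (a ∷ l) b r

act : Tape A → Maybe A × Move → Tape A
act (tape l _ r) (a , m) = move m (tape l a r)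

untilBlank : List (Maybe A) → List A
untilBlank []            = []
untilBlank (nothing ∷ _) = []
untilBlank (just a ∷ as) = a ∷ untilBlank as

record TuringMachine : Set₁ where
  field
    State         : Set
    Marker        : Set
    state-finite  : Finite State
    marker-finite : Finite Marker
    extraTapes    : ℕ
    start         : State

  -- Non-blank symbols: the two bits and the machine's auxiliary markers.
  Letter : Set
  Letter = Bool ⊎ Marker

  tapes : ℕ
  tapes = suc extraTapes

  -- The machine halts when the transition function is undefined.
  field
    δ : State → Vec (Maybe Letter) tapes →
        Maybe (State × Vec (Maybe Letter × Move) tapes)

module Run (M : TuringMachine) where
  open TuringMachine M

  record Configuration : Set where
    constructor config
    field
      state    : State
      contents : Vec (Tape Letter) tapes

  open Configuration public

  step : Configuration → Maybe Configuration
  step (config q ts) =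
    Maybe.map (λ (q′ , as) → config q′ (zipWith act ts as))
              (δ q (Vec.map scanned ts))

  data _⇓[_]_ : Configuration → ℕ → Configuration → Set where
    halt : ∀ {c} → step c ≡ nothing → c ⇓[ 0 ] c
    next : ∀ {c c′ d t} → step c ≡ just c′ → c′ ⇓[ t ] d → c ⇓[ suc t ] d

  -- The input is on the first tape, with the head on its first bit.
  initial : List Bool → Configuration
  initial x =
    config start
           (fromCells (map (λ b → just (inj₁ b)) x) ∷
            Vec.replicate extraTapes (fromCells []))

  -- The output is read on the first tape, from the head up to the first
  -- blank.
  Outputs : Configuration → List Bool → Set
  Outputs c y = untilBlank (scanned t ∷ rights t) ≡ map inj₁ y
    where t = head (contents c)

-- Coefficients in ℕ, lowest degree first.
Polynomial : Set
Polynomial = List ℕ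

eval : Polynomial → ℕ → ℕ
eval []       n = 0
eval (a ∷ as) n = a + n * eval as n

PolyTime : (List Bool → List Bool) → Set₁
PolyTime f =
  Σ[ M ∈ TuringMachine ] Σ[ p ∈ Polynomial ]
    let open Run M in
    ∀ x → ∃[ t ] ∃[ c ]
      initial x ⇓[ t ] c × t ≤ eval p (length x) × Outputs c (f x)

PolyTimeDecidable : (List Bool → Bool) → Set₁
PolyTimeDecidable r = PolyTime (λ x → [ r x ])

Language : Set₁
Language = List Bool → Set

-- Each bit of x is preceded by `true`; `false` marks the end of x.
⟨_,_⟩ : List Bool → List Bool → List Bool
⟨ x , c ⟩ = concatMap (λ b → true ∷ b ∷ []) x ++ false ∷ c

NP : Language → Set₁
NP L =
  Σ[ verify ∈ (List Bool → Bool) ] Σ[ q ∈ Polynomial ]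
    PolyTimeDecidable verify ×
    (∀ x → L x ⇔
      (∃[ c ] length c ≤ eval q (length x) × verify ⟨ x , c ⟩ ≡ true))

record DecisionProblem : Set₁ where
  field
    Instance : Set
    encode   : Instance → List Bool
    Yes      : Instance → Set

restrict : (Π : DecisionProblem) → (DecisionProblem.Instance Π → Set) →
           DecisionProblem
restrict Π R = record
  { Instance = Σ Instance R
  ; encode   = λ i → encode (proj₁ i)
  ; Yes      = λ i → Yes (proj₁ i)
  }
  where open DecisionProblem Π

module _ (Π : DecisionProblem) where
  open DecisionProblem Π

  -- Strings that encode no instance are rejected.
  language : Language
  language x = ∃[ i ] encode i ≡ x × Yes i

  -- Every value of the reduction has to encode an instance of Π; for a
  -- restricted problem, the instance has to satisfy the restriction.
  ReducesTo : Language → Set₁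
  ReducesTo L =
    Σ[ f ∈ (List Bool → List Bool) ]
      PolyTime f × (∀ x → ∃[ i ] f x ≡ encode i × (L x ⇔ Yes i))

  NPHard : Set₁
  NPHard = ∀ L → NP L → ReducesTo L

  NPComplete : Set₁
  NPComplete = NP language × NPHard

record Graph : Set where
  field
    order         : ℕ
    {{nonEmpty}}  : NonZero order
    adjacent      : Fin order → Fin order → Bool
    symmetric     : ∀ u v → adjacent u v ≡ adjacent v u
    irreflexive   : ∀ u → adjacent u u ≡ false

  Vertex : Set
  Vertex = Fin order

module _ (G : Graph) where
  open Graph G

  data Walk : Vertex → Vertex → Set where
    stop : ∀ {u} → Walk u u
    step : ∀ {u v w} → T (adjacent u v) → Walk v w → Walk u w

module _ {G : Graph} where
  open Graph G

  vertices : ∀ {u v} → Walk G u v → List Vertex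
  vertices {u} stop       = u ∷ []
  vertices {u} (step _ w) = u ∷ vertices w

  edgeCount : ∀ {u v} → Walk G u v → ℕ
  edgeCount stop       = 0
  edgeCount (step _ w) = suc (edgeCount w)

module _ (G : Graph) where
  open Graph G

  record Path (u v : Vertex) : Set where
    field
      walk   : Walk G u v
      simple : Unique (vertices walk)

  open Path public

  record ShortestPath (u v : Vertex) : Set where
    field
      path     : Path u v
      shortest : (p : Path u v) → edgeCount (walk path) ≤ edgeCount (walk p)

  open ShortestPath public

  Connected : Set
  Connected = ∀ u v → Path u v

  Distance : Vertex → Vertex → ℕ → Set
  Distance u v d = Σ[ p ∈ ShortestPath u v ] edgeCount (walk (path p)) ≡ d

  Diameter : ℕ → Set
  Diameter D = (∃[ u ] ∃[ v ] Distance u v D) ×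
               (∀ u v d → Distance u v d → d ≤ D)

  Bipartite : Set
  Bipartite = Σ[ side ∈ (Vertex → Bool) ]
                (∀ u v → T (adjacent u v) → side u ≢ side v)

  -- An unordered pair of distinct vertices is represented by the ordered
  -- pair (u , v) with u < v.
  ShortestPathAssignment : Subset order → Set
  ShortestPathAssignment S =
    ∀ {u v} → u ∈ S → v ∈ S → u < v → ShortestPath u v

  StrongGeodetic : Subset order → Set
  StrongGeodetic S =
    Σ[ I ∈ ShortestPathAssignment S ]
      (∀ x → x ∉ S →
        ∃[ u ] ∃[ v ] Σ[ u∈S ∈ u ∈ S ] Σ[ v∈S ∈ v ∈ S ] Σ[ u<v ∈ u < v ]
          x List.∈ vertices (walk (path (I u∈S v∈S u<v))))

record Input : Set where
  field
    graph     : Graph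
    connected : Connected graph
    set       : Subset (Graph.order graph)

open Input public

-- The order n in unary (n times `true`, then `false`), the adjacency
-- matrix row by row, and the characteristic vector of the set.
encodeInput : Input → List Bool
encodeInput i =
  replicate order true ++ false ∷
  concatMap (λ u → map (adjacent u) (allFin order)) (allFin order) ++
  toList (set i)
  where open Graph (graph i)

StrongGeodeticRecognition : DecisionProblem
StrongGeodeticRecognition = record
  { Instance = Input
  ; encode   = encodeInput
  ; Yes      = λ i → StrongGeodetic (graph i) (set i)
  }

BipartiteOfDiameter≤_ : ℕ → Input → Set
(BipartiteOfDiameter≤ k) i =
  Bipartite (graph i) × (∃[ D ] Diameter (graph i) D × D ≤ k)

{-# OPTIONS --safe #-}

-- A function whose value has polynomial length and whose bits are given by an arithmetic expression (sums,
-- truncated differences, bounded sums, bits of the input) is computed in polynomial time: each value is the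
-- position of the head on a tape of its own.  Verifier and reduction are both of this form.
--
-- Membership.  The certificate consists of a table D, the vertex sets of the chosen paths and a bipartition.
-- If D changes by at most one along edges and every positive entry has a neighbour with the next smaller one,
-- then D is the distance table, so that all conditions are first order with bounded quantifiers.
--
-- Hardness.  Seen from the heads, the cell contents at time t + 1 depend on three neighbouring cells and the
-- scanned symbols at time t; the run of a verifier thus becomes a set of clauses.  The geodesics between two
-- vertices of the set have length at most 3, and private vertices that lie on a single geodesic force all of
-- them except those of the pairs U c, V c.  Such a pair covers one vertex D d of a ring and one clause vertex
-- Z j; since a ring has as many pairs as vertices D d, all its pairs turn the same way, which is the truth
-- value of a variable.

module Submission where

open import Data.Bool using (Bool; true; false; T; if_then_else_; not)
open import Data.Empty using (⊥; ⊥-elim)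
open import Data.Fin using (Fin; zero; suc; toℕ; fromℕ<)
import Data.Fin as Fin
import Data.Fin.Properties as Fin
open import Data.List using (List; []; _∷_; _++_; [_]; length; map; concatMap; replicate; applyUpTo)
open import Data.List.Properties using (length-++; length-replicate; length-tabulate; length-applyUpTo; applyUpTo-∷ʳ; ++-assoc; ++-identityʳ; ∷-injectiveˡ; length-map)
open import Data.Maybe using (Maybe; just; nothing; maybe)
import Data.Maybe as Maybe
open import Data.Nat
open import Data.Nat.Properties
open import Data.Nat.DivMod using (_/_; _%_; m≡m%n+[m/n]*n; m%n<n; m<n*o⇒m/o<n; [m+kn]%n≡m%n; m<n⇒m%n≡m; m<n⇒m/n≡0; m*n/n≡m; +-distrib-/-∣ʳ)
open import Data.Nat.Divisibility using (n∣m*n)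
open import Data.Nat.Tactic.RingSolver using (solve-∀)
open import Data.Product using (Σ; Σ-syntax; ∃-syntax; _×_; _,_; proj₁; proj₂; map₁)
open import Data.Sum using (_⊎_; inj₁; inj₂)
open import Data.Sum.Properties using (inj₁-injective)
open import Data.Unit using (⊤; tt)
open import Data.Vec using (Vec; []; _∷_)
import Data.Vec as Vec
import Data.Vec.Properties as Vec
open import Data.Vec.Properties.WithK using ([]=-irrelevant)
open import Function using (_∘_; id)
open import Function.Bundles using (_⇔_; mk⇔; mk↔ₛ′; Equivalence; Inverse)
open import Function.Construct.Composition using (_⇔-∘_)
open import Relation.Binary.PropositionalEquality hiding ([_])
open import Relation.Nullary using (¬_; Dec; yes; no; does; contradiction)
open import Data.List.Membership.Propositional using () renaming (_∈_ to _∈ˡ_)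
open import Data.List.Relation.Unary.All.Properties using (¬Any⇒All¬)
open import Data.List.Relation.Unary.Any using (here; there)
open import Data.List.Relation.Unary.AllPairs using ([]; _∷_)
open import Data.List.Relation.Unary.Unique.Propositional using (Unique)
open import Relation.Nullary.Decidable using (map′; _×-dec_)
open import Data.Bool.Properties using (T?; T-≡; not-involutive)
import Data.List.Relation.Unary.All as All
open import Data.List.Membership.Propositional.Properties using (∈-lookup)
open import Relation.Binary.Definitions using (tri<; tri≈; tri>)
open import Data.Fin.Subset using (Subset; _∈_; _∉_)
import Data.List.Relation.Unary.Any as Any
open import Data.Fin.Subset.Properties using (_∈?_)
open import Defs

-- `NPHard` ranges over all verifying machines, so hardness starts from an arbitrary machine, and
-- the reduction must itself be run by a machine that prints the exact code word. Hence clauses,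
-- variables and vertices are mixed radix numbers, for which "bit i of the output is set" is an
-- arithmetic formula. No number below the order may be left over either, since a stray vertex would
-- disconnect the graph.
--
-- A ring has one slot per clause. For j > 0, the vertex D of slot j is the only one of its ring
-- that can be adjacent to `Z j`, and the edges at `V c` tell whether `U c` came through its own D
-- or through the one before. On a ring with a single slot both would coincide, whence `2 ≤ m`.
-- Clause 0 is a dummy: a geodesic that serves no clause ends through `Z 0`. Variable 0 is a dummy
-- too: as it occurs in no clause, `V 0` can safely be joined to every `Z j`. So every vertex is in
-- the set or next to it, and as vertices of the set are at distance at most 3, distances are at
-- most 1 + 3 + 1 = 5.

private variable
  A B : Set
  n m : ℕ

-- Polynomials

_⊕_ : Polynomial → Polynomial → Polynomial
[]      ⊕ q       = q
(a ∷ p) ⊕ []      = a ∷ p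
(a ∷ p) ⊕ (b ∷ q) = a + b ∷ p ⊕ q

_⊗_ : Polynomial → Polynomial → Polynomial
[]      ⊗ q = []
(a ∷ p) ⊗ q = map (a *_) q ⊕ (0 ∷ p ⊗ q)

compose : Polynomial → Polynomial → Polynomial
compose []      q = []
compose (a ∷ p) q = (a ∷ []) ⊕ (q ⊗ compose p q)

eval-⊕ : ∀ p q x → eval (p ⊕ q) x ≡ eval p x + eval q x
eval-⊕ []      q       x = refl
eval-⊕ (a ∷ p) []      x = sym (+-identityʳ _)
eval-⊕ (a ∷ p) (b ∷ q) x rewrite eval-⊕ p q x = lemma a b x (eval p x) (eval q x)
  where
  lemma : ∀ a b x p q → a + b + x * (p + q) ≡ a + x * p + (b + x * q)
  lemma = solve-∀

eval-scale : ∀ a q x → eval (map (a *_) q) x ≡ a * eval q x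
eval-scale a []      x = sym (*-zeroʳ a)
eval-scale a (b ∷ q) x rewrite eval-scale a q x = lemma a b x (eval q x)
  where
  lemma : ∀ a b x q → a * b + x * (a * q) ≡ a * (b + x * q)
  lemma = solve-∀

eval-⊗ : ∀ p q x → eval (p ⊗ q) x ≡ eval p x * eval q x
eval-⊗ []      q x = refl
eval-⊗ (a ∷ p) q x
  rewrite eval-⊕ (map (a *_) q) (0 ∷ p ⊗ q) x | eval-scale a q x | eval-⊗ p q x
  = lemma a x (eval p x) (eval q x)
  where
  lemma : ∀ a x p q → a * q + x * (p * q) ≡ (a + x * p) * q
  lemma = solve-∀

eval-compose : ∀ p q x → eval (compose p q) x ≡ eval p (eval q x)
eval-compose []      q x = refl
eval-compose (a ∷ p) q x
  rewrite eval-⊕ (a ∷ []) (q ⊗ compose p q) x | eval-⊗ q (compose p q) x | eval-compose p q x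
  = cong (_+ eval q x * eval p (eval q x)) (trans (cong (a +_) (*-zeroʳ x)) (+-identityʳ a))

eval-mono : ∀ p {x y} → x ≤ y → eval p x ≤ eval p y
eval-mono []      _   = z≤n
eval-mono (a ∷ p) x≤y = +-monoʳ-≤ a (*-mono-≤ x≤y (eval-mono p x≤y))

record IsPolynomial (f : ℕ → ℕ) : Set where
  constructor polynomial
  field
    coefficients : Polynomial
    evaluates    : ∀ x → eval coefficients x ≡ f x

open IsPolynomial public

poly-id : IsPolynomial id
poly-id = polynomial (0 ∷ 1 ∷ []) λ x → trans (cong (x *_) (cong suc (*-zeroʳ x))) (*-identityʳ x)

poly-const : ∀ c → IsPolynomial (λ _ → c)
poly-const c = polynomial (c ∷ []) λ x → trans (cong (c +_) (*-zeroʳ x)) (+-identityʳ c)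

poly-+ : ∀ {f g} → IsPolynomial f → IsPolynomial g → IsPolynomial (λ x → f x + g x)
poly-+ (polynomial p p≗) (polynomial q q≗) =
  polynomial (p ⊕ q) λ x → trans (eval-⊕ p q x) (cong₂ _+_ (p≗ x) (q≗ x))

poly-* : ∀ {f g} → IsPolynomial f → IsPolynomial g → IsPolynomial (λ x → f x * g x)
poly-* (polynomial p p≗) (polynomial q q≗) =
  polynomial (p ⊗ q) λ x → trans (eval-⊗ p q x) (cong₂ _*_ (p≗ x) (q≗ x))

poly-∘ : ∀ {f g} → IsPolynomial f → IsPolynomial g → IsPolynomial (λ x → f (g x))
poly-∘ {f} (polynomial p p≗) (polynomial q q≗) =
  polynomial (compose p q) λ x → trans (eval-compose p q x) (trans (cong (eval p) (q≗ x)) (p≗ _))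

-- Tapes

nth : List (Maybe A) → ℕ → Maybe A
nth []       _       = nothing
nth (a ∷ as) zero    = a
nth (a ∷ as) (suc i) = nth as i

-- The contents of the cell p − h positions to the right of the head.
cell : ℕ → Tape A → ℕ → Maybe A
cell zero    t p       = nth (scanned t ∷ rights t) p
cell (suc h) t zero    = nth (lefts t) h
cell (suc h) t (suc p) = cell h t p

cell-scanned : ∀ h (t : Tape A) → cell h t h ≡ scanned t
cell-scanned zero    t = refl
cell-scanned (suc h) t = cell-scanned h t

cell-right : ∀ h (t : Tape A) p → cell (suc h) (move right t) p ≡ cell h t p
cell-right zero    (tape l a [])      zero    = refl
cell-right zero    (tape l a (b ∷ r)) zero    = refl
cell-right (suc h) (tape l a [])      zero    = refl
cell-right (suc h) (tape l a (b ∷ r)) zero    = refl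
cell-right zero    (tape l a [])      (suc zero)    = refl
cell-right zero    (tape l a [])      (suc (suc p)) = refl
cell-right zero    (tape l a (b ∷ r)) (suc p) = refl
cell-right (suc h) t                  (suc p) = cell-right h t p

cell-left : ∀ h (t : Tape A) p → cell h (move left t) p ≡ cell (suc h) t p
cell-left zero    (tape []      a r) zero    = refl
cell-left zero    (tape (b ∷ l) a r) zero    = refl
cell-left zero    (tape []      a r) (suc p) = refl
cell-left zero    (tape (b ∷ l) a r) (suc p) = refl
cell-left (suc h) (tape []      a r) zero    = refl
cell-left (suc h) (tape (b ∷ l) a r) zero    = refl
cell-left (suc h) t                  (suc p) = cell-left h t p

write : Maybe A → Tape A → Tape A
write a (tape l _ r) = tape l a r

cell-write-here : ∀ h a (t : Tape A) → cell h (write a t) h ≡ a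
cell-write-here h a t = cell-scanned h (write a t)

cell-write-away : ∀ h a (t : Tape A) p → p ≢ h → cell h (write a t) p ≡ cell h t p
cell-write-away zero    a t zero    p≢h = contradiction refl p≢h
cell-write-away zero    a t (suc p) p≢h = refl
cell-write-away (suc h) a t zero    p≢h = refl
cell-write-away (suc h) a t (suc p) p≢h = cell-write-away h a t p (p≢h ∘ cong suc)

-- In register programs the contents `F` stay fixed and the head position `h` is the stored value.
-- Only the cells from position 0 on are constrained.
At : (ℕ → Maybe A) → ℕ → Tape A → Set
At F h t = ∀ p → cell h t p ≡ F p

-- Positions are natural numbers, so `left` has no instance from 0: an empty register cannot be
-- decremented.
data Shift : Move → ℕ → ℕ → Set where
  left  : ∀ {h} → Shift left (suc h) h
  stay  : ∀ {h} → Shift stay h h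
  right : ∀ {h} → Shift right h (suc h)

at-move : ∀ {F : ℕ → Maybe A} {d h h′ t} → Shift d h h′ → At F h t → At F h′ (move d t)
at-move {t = t} (left {h})  at p = trans (cell-left h t p) (at p)
at-move         stay        at p = at p
at-move {t = t} (right {h}) at p = trans (cell-right h t p) (at p)

at-scanned : ∀ {F : ℕ → Maybe A} {h t} → At F h t → scanned t ≡ F h
at-scanned {h = h} {t} at = trans (sym (cell-scanned h t)) (at h)

nth-blank : ∀ (as : List (Maybe A)) i → length as ≤ i → nth as i ≡ nothing
nth-blank []       i       _         = refl
nth-blank (a ∷ as) (suc i) (s≤s as≤) = nth-blank as i as≤

finite-⊤ : Finite ⊤
finite-⊤ = 1 , mk↔ₛ′ (λ _ → zero) (λ _ → tt) (λ { zero → refl }) (λ _ → refl)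

finite-⊎ : Finite A → Finite B → Finite (A ⊎ B)
finite-⊎ {A} {B} (m , f) (n , g) = m + n , mk↔ₛ′ to from to-from from-to
  where
  module f = Inverse f
  module g = Inverse g
  to : A ⊎ B → Fin (m + n)
  to (inj₁ a) = f.to a Fin.↑ˡ n
  to (inj₂ b) = m Fin.↑ʳ g.to b
  from′ : Fin m ⊎ Fin n → A ⊎ B
  from′ (inj₁ i) = inj₁ (f.from i)
  from′ (inj₂ j) = inj₂ (g.from j)
  from : Fin (m + n) → A ⊎ B
  from i = from′ (Fin.splitAt m i)
  to-from : ∀ i → to (from i) ≡ i
  to-from i with Fin.splitAt m i in eq
  ... | inj₁ j = trans (cong (Fin._↑ˡ n) (f.strictlyInverseˡ j)) (Fin.splitAt⁻¹-↑ˡ eq)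
  ... | inj₂ j = trans (cong (m Fin.↑ʳ_) (g.strictlyInverseˡ j)) (Fin.splitAt⁻¹-↑ʳ eq)
  from-to : ∀ a → from (to a) ≡ a
  from-to (inj₁ a) rewrite Fin.splitAt-↑ˡ m (f.to a) n = cong inj₁ (f.strictlyInverseʳ a)
  from-to (inj₂ b) rewrite Fin.splitAt-↑ʳ m n (g.to b) = cong inj₂ (g.strictlyInverseʳ b)

-- Machines built from blocks

Symbol : Set
Symbol = Maybe (Bool ⊎ ⊤)

pattern mark  = just (inj₂ tt)
pattern blank = nothing

get : A → Vec A n → ℕ → A
get d []       _       = d
get d (a ∷ as) zero    = a
get d (a ∷ as) (suc r) = get d as r

emptyTape : Tape (Bool ⊎ ⊤)
emptyTape = fromCells []

get-scanned : ∀ (ts : Vec (Tape (Bool ⊎ ⊤)) n) r →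
              get blank (Vec.map scanned ts) r ≡ scanned (get emptyTape ts r)
get-scanned []       r       = refl
get-scanned (t ∷ ts) zero    = refl
get-scanned (t ∷ ts) (suc r) = get-scanned ts r

get-act : ∀ (ts : Vec (Tape (Bool ⊎ ⊤)) n) w r → r < n →
          get emptyTape (Vec.zipWith act ts (Vec.tabulate (w ∘ toℕ))) r ≡ act (get emptyTape ts r) (w r)
get-act (t ∷ ts) w zero    _         = refl
get-act (t ∷ ts) w (suc r) (s≤s r<n) = get-act ts (w ∘ suc) r r<n

module Blocks (k : ℕ) where

  Memory : Set
  Memory = Vec (Tape (Bool ⊎ ⊤)) (suc k)

  Scan : Set
  Scan = Vec Symbol (suc k)

  Actions : Set
  Actions = Vec (Symbol × Move) (suc k)

  infixr 5 _⨾_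

  -- While programs, read as transition graphs with one node per atom and per loop test, so that
  -- states, runs and running times are all obtained by recursion on the syntax.
  data Block : Set where
    atom : (Scan → Actions) → Block
    _⨾_  : Block → Block → Block
    loop : (Scan → Bool) → Block → Block

  Node : Block → Set
  Node (atom w)      = ⊤
  Node (b ⨾ c)       = Node b ⊎ Node c
  Node (loop test b) = ⊤ ⊎ Node b

  node-finite : ∀ b → Finite (Node b)
  node-finite (atom w)      = finite-⊤
  node-finite (b ⨾ c)       = finite-⊎ (node-finite b) (node-finite c)
  node-finite (loop test b) = finite-⊎ finite-⊤ (node-finite b)

  entry : ∀ b → Node b
  entry (atom w)      = tt
  entry (b ⨾ c)       = inj₁ (entry b)
  entry (loop test b) = inj₁ tt

  idle : ∀ {m} → Vec Symbol m → Vec (Symbol × Move) m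
  idle = Vec.map (_, stay)

  -- `nothing` as the next node leaves the block.
  next : ∀ b → Node b → Scan → Maybe (Node b) × Actions
  next (atom w)      tt        s = nothing , w s
  next (b ⨾ c)       (inj₁ i)  s = map₁ (λ j → just (maybe inj₁ (inj₂ (entry c)) j)) (next b i s)
  next (b ⨾ c)       (inj₂ i)  s = map₁ (Maybe.map inj₂) (next c i s)
  next (loop test b) (inj₁ tt) s = (if test s then just (inj₂ (entry b)) else nothing) , idle s
  next (loop test b) (inj₂ i)  s = map₁ (λ j → just (maybe inj₂ (inj₁ tt) j)) (next b i s)

  after : Memory → Actions → Memory
  after = Vec.zipWith act

  data Exec (b : Block) : Node b → Memory → ℕ → Memory → Set where
    leave : ∀ {i ts as} → next b i (Vec.map scanned ts) ≡ (nothing , as) →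
            Exec b i ts 1 (after ts as)
    go    : ∀ {i j ts as t us} → next b i (Vec.map scanned ts) ≡ (just j , as) →
            Exec b j (after ts as) t us → Exec b i ts (suc t) us

  after-idle : ∀ {m} (ts : Vec (Tape (Bool ⊎ ⊤)) m) → Vec.zipWith act ts (idle (Vec.map scanned ts)) ≡ ts
  after-idle []       = refl
  after-idle (t ∷ ts) = cong (t ∷_) (after-idle ts)

  module _ {b c : Block} where

    exec-second : ∀ {i ts t us} → Exec c i ts t us → Exec (b ⨾ c) (inj₂ i) ts t us
    exec-second (leave e) = leave (cong (map₁ (Maybe.map inj₂)) e)
    exec-second (go e x)  = go (cong (map₁ (Maybe.map inj₂)) e) (exec-second x)

    exec-⨾ : ∀ {i ts t us t′ vs} → Exec b i ts t us → Exec c (entry c) us t′ vs →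
             Exec (b ⨾ c) (inj₁ i) ts (t + t′) vs
    exec-⨾ (leave e) y = go (cong (map₁ (just ∘ maybe inj₁ (inj₂ (entry c)))) e) (exec-second y)
    exec-⨾ (go e x)  y = go (cong (map₁ (just ∘ maybe inj₁ (inj₂ (entry c)))) e) (exec-⨾ x y)

  module _ {test : Scan → Bool} {b : Block} where

    -- The test has a node of its own, which rewrites the scanned symbols and does not move: the
    -- memory is unchanged, but one step is charged.
    exec-done : ∀ ts → test (Vec.map scanned ts) ≡ false → Exec (loop test b) (inj₁ tt) ts 1 ts
    exec-done ts e = subst (Exec (loop test b) (inj₁ tt) ts 1) (after-idle ts)
      (leave (cong (λ c → (if c then _ else _) , _) e))

    exec-back : ∀ {i ts t us t′ vs} → Exec b i ts t us → Exec (loop test b) (inj₁ tt) us t′ vs →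
                Exec (loop test b) (inj₂ i) ts (t + t′) vs
    exec-back (leave e) y = go (cong (map₁ (just ∘ maybe inj₂ (inj₁ tt))) e) y
    exec-back (go e x)  y = go (cong (map₁ (just ∘ maybe inj₂ (inj₁ tt))) e) (exec-back x y)

    exec-again : ∀ {ts t us t′ vs} → test (Vec.map scanned ts) ≡ true →
                 Exec b (entry b) ts t us → Exec (loop test b) (inj₁ tt) us t′ vs →
                 Exec (loop test b) (inj₁ tt) ts (suc (t + t′)) vs
    exec-again {ts} e x y = go (cong (λ c → (if c then _ else _) , _) e)
      (subst (λ us → Exec (loop test b) _ us _ _) (sym (after-idle ts)) (exec-back x y))

  Runs : Block → Memory → ℕ → Memory → Set
  Runs b ts m us = ∃[ t ] t ≤ m × Exec b (entry b) ts t us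

  runs-≤ : ∀ {b ts m m′ us} → m ≤ m′ → Runs b ts m us → Runs b ts m′ us
  runs-≤ m≤ (t , t≤ , x) = t , ≤-trans t≤ m≤ , x

  runs-atom : ∀ {w} ts → Runs (atom w) ts 1 (after ts (w (Vec.map scanned ts)))
  runs-atom ts = 1 , ≤-refl , leave refl

  runs-⨾ : ∀ {b c ts m us m′ vs} → Runs b ts m us → Runs c us m′ vs → Runs (b ⨾ c) ts (m + m′) vs
  runs-⨾ (t , t≤ , x) (t′ , t′≤ , y) = t + t′ , +-mono-≤ t≤ t′≤ , exec-⨾ x y

  runs-done : ∀ {test b ts} → test (Vec.map scanned ts) ≡ false → Runs (loop test b) ts 1 ts
  runs-done e = 1 , ≤-refl , exec-done _ e

  runs-again : ∀ {test b ts m us m′ vs} → test (Vec.map scanned ts) ≡ true →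
               Runs b ts m us → Runs (loop test b) us m′ vs → Runs (loop test b) ts (suc (m + m′)) vs
  runs-again e (t , t≤ , x) (t′ , t′≤ , y) = suc (t + t′) , s≤s (+-mono-≤ t≤ t′≤) , exec-again e x y

  toMachine : Block → TuringMachine
  toMachine b = record
    { State         = ⊤ ⊎ Node b
    ; Marker        = ⊤
    ; state-finite  = finite-⊎ finite-⊤ (node-finite b)
    ; marker-finite = finite-⊤
    ; extraTapes    = k
    ; start         = inj₂ (entry b)
    ; δ             = λ
        { (inj₁ tt) _ → nothing
        ; (inj₂ i)  s → just (map₁ (maybe inj₂ (inj₁ tt)) (next b i s))
        }
    }

  module _ (b : Block) where
    open Run (toMachine b) renaming (next to advance)

    exec-machine : ∀ {i ts t us} → Exec b i ts t us → config (inj₂ i) ts ⇓[ t ] config (inj₁ tt) us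
    exec-machine (leave e) =
      advance (cong (λ r → just (config (maybe inj₂ (inj₁ tt) (proj₁ r)) (after _ (proj₂ r)))) e) (halt refl)
    exec-machine (go e x)  =
      advance (cong (λ r → just (config (maybe inj₂ (inj₁ tt) (proj₁ r)) (after _ (proj₂ r)))) e) (exec-machine x)

-- Arithmetic with access to the bits of a word

-- The last index is added first, because a loop that decrements its counter before each round meets
-- the indices in this order.
Σ< : ℕ → (ℕ → ℕ) → ℕ
Σ< zero    f = 0
Σ< (suc n) f = f n + Σ< n f

Env : ℕ → Set
Env zero    = ⊤
Env (suc n) = ℕ × Env n

valueAt : Env n → Fin n → ℕ
valueAt (a , ρ) zero    = a
valueAt (a , ρ) (suc i) = valueAt ρ i

mapEnv : (ℕ → ℕ) → Env n → Env n
mapEnv {zero}  f tt      = tt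
mapEnv {suc n} f (a , ρ) = f a , mapEnv f ρ

bitAt : List Bool → ℕ → Bool
bitAt []       _       = false
bitAt (b ∷ bs) zero    = b
bitAt (b ∷ bs) (suc i) = bitAt bs i

⌜_⌝ : Bool → ℕ
⌜ false ⌝ = 0
⌜ true  ⌝ = 1

-- Growth comes only from addition and bounded sums, which keeps all values polynomial; yet bounded
-- sums already yield products, bounded quantifiers and finite tables.
data Expr : ℕ → Set where
  var     : Fin n → Expr n
  one len : Expr n
  bit     : Expr n → Expr n
  plus    : Expr n → Expr n → Expr n
  monus   : Expr n → Expr n → Expr n
  sum     : Expr n → Expr (suc n) → Expr n

⟦_⟧ : Expr n → List Bool → Env n → ℕ
⟦ var i ⟧     x ρ = valueAt ρ i
⟦ one ⟧       x ρ = 1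
⟦ len ⟧       x ρ = length x
⟦ bit e ⟧     x ρ = ⌜ bitAt x (⟦ e ⟧ x ρ) ⌝
⟦ plus a b ⟧  x ρ = ⟦ a ⟧ x ρ + ⟦ b ⟧ x ρ
⟦ monus a b ⟧ x ρ = ⟦ a ⟧ x ρ ∸ ⟦ b ⟧ x ρ
⟦ sum a b ⟧   x ρ = Σ< (⟦ a ⟧ x ρ) (λ i → ⟦ b ⟧ x (i , ρ))

-- Bounds in terms of a bound B on the length of the word and on the variables.
size : Expr n → ℕ → ℕ
size (var i)     B = B
size one         B = 1
size len         B = B
size (bit e)     B = 1
size (plus a b)  B = size a B + size b B
size (monus a b) B = size a B
size (sum a b)   B = size a B * size b (B + size a B)

-- The constants follow the compiled code: a loop whose body takes s steps costs 2 + s per round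
-- (test, decrement, body) and 1 for the failing test. Hence 3 per unit for moving a value, 4 for
-- restoring two copies of it, 2 for clearing.
time : Expr n → ℕ → ℕ
time (var i)     B = (B * 3 + 1) + (B * 4 + 1)
time one         B = 1
time len         B = 1 + ((B * 3 + 1) + (suc B * 2 + 1))
time (bit e)     B = time e B + (1 + ((size e B * 3 + 1) + (1 + (suc (size e B) * 2 + 1))))
time (plus a b)  B = time a B + time b B
time (monus a b) B = time a B + (time b B + ((size b B * 3 + 1) + (size a B * 3 + 1)))
time (sum a b)   B = time a B + (size a B * (2 + time b (B + size a B)) + 1)

size-poly : (e : Expr n) → IsPolynomial (size e)
size-poly (var i)     = poly-id
size-poly one         = poly-const 1
size-poly len         = poly-id
size-poly (bit e)     = poly-const 1
size-poly (plus a b)  = poly-+ (size-poly a) (size-poly b)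
size-poly (monus a b) = size-poly a
size-poly (sum a b)   = poly-* (size-poly a) (poly-∘ (size-poly b) (poly-+ poly-id (size-poly a)))

time-poly : (e : Expr n) → IsPolynomial (time e)
time-poly (var i) =
  poly-+ (poly-+ (poly-* poly-id (poly-const 3)) (poly-const 1))
         (poly-+ (poly-* poly-id (poly-const 4)) (poly-const 1))
time-poly one = poly-const 1
time-poly len =
  poly-+ (poly-const 1)
    (poly-+ (poly-+ (poly-* poly-id (poly-const 3)) (poly-const 1))
            (poly-+ (poly-* (poly-+ (poly-const 1) poly-id) (poly-const 2)) (poly-const 1)))
time-poly (bit e) =
  poly-+ (time-poly e) (poly-+ (poly-const 1)
    (poly-+ (poly-+ (poly-* (size-poly e) (poly-const 3)) (poly-const 1))
      (poly-+ (poly-const 1)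
        (poly-+ (poly-* (poly-+ (poly-const 1) (size-poly e)) (poly-const 2)) (poly-const 1)))))
time-poly (plus a b) = poly-+ (time-poly a) (time-poly b)
time-poly (monus a b) =
  poly-+ (time-poly a) (poly-+ (time-poly b)
    (poly-+ (poly-+ (poly-* (size-poly b) (poly-const 3)) (poly-const 1))
            (poly-+ (poly-* (size-poly a) (poly-const 3)) (poly-const 1))))
time-poly (sum a b) =
  poly-+ (time-poly a)
    (poly-+ (poly-* (size-poly a) (poly-+ (poly-const 2) (poly-∘ (time-poly b) (poly-+ poly-id (size-poly a)))))
            (poly-const 1))

Σ<-≤ : ∀ n {f b} → (∀ i → i < n → f i ≤ b) → Σ< n f ≤ n * b
Σ<-≤ zero    f≤ = z≤n
Σ<-≤ (suc n) f≤ = +-mono-≤ (f≤ n ≤-refl) (Σ<-≤ n (λ i i<n → f≤ i (m<n⇒m<1+n i<n)))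

bit≤1 : ∀ b → ⌜ b ⌝ ≤ 1
bit≤1 false = z≤n
bit≤1 true  = ≤-refl

size-bound : ∀ (e : Expr n) {x ρ B} → length x ≤ B → (∀ i → valueAt ρ i ≤ B) → ⟦ e ⟧ x ρ ≤ size e B
size-bound (var i)     x≤ ρ≤ = ρ≤ i
size-bound one         x≤ ρ≤ = ≤-refl
size-bound len         x≤ ρ≤ = x≤
size-bound (bit e)     x≤ ρ≤ = bit≤1 _
size-bound (plus a b)  x≤ ρ≤ = +-mono-≤ (size-bound a x≤ ρ≤) (size-bound b x≤ ρ≤)
size-bound (monus a b) x≤ ρ≤ = ≤-trans (m∸n≤m _ (⟦ b ⟧ _ _)) (size-bound a x≤ ρ≤)
size-bound (sum a b) {x} {ρ} {B} x≤ ρ≤ =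
  ≤-trans (Σ<-≤ (⟦ a ⟧ x ρ) body) (*-monoˡ-≤ _ (size-bound a x≤ ρ≤))
  where
  body : ∀ i → i < ⟦ a ⟧ x ρ → ⟦ b ⟧ x (i , ρ) ≤ size b (B + size a B)
  body i i< = size-bound b (≤-trans x≤ (m≤m+n B _)) λ
    { zero    → ≤-trans (<⇒≤ i<) (≤-trans (size-bound a x≤ ρ≤) (m≤n+m _ B))
    ; (suc j) → ≤-trans (ρ≤ j) (m≤m+n B _) }

-- Registers

Store : Set
Store = ℕ → ℕ

choose : {P : Set} → Dec P → A → A → A
choose (yes _) a b = a
choose (no _)  a b = b

infixl 7 _[_≔_]

_[_≔_] : Store → ℕ → ℕ → Store
(σ [ r ≔ v ]) j = choose (j ≟ r) v (σ j)

≔-here : ∀ σ r v → (σ [ r ≔ v ]) r ≡ v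
≔-here σ r v with r ≟ r
... | yes _  = refl
... | no r≢r = contradiction refl r≢r

≔-away : ∀ σ r v {j} → j ≢ r → (σ [ r ≔ v ]) j ≡ σ j
≔-away σ r v {j} j≢r with j ≟ r
... | yes j≡r = contradiction j≡r j≢r
... | no _    = refl

bitSymbol : Bool → Symbol
bitSymbol b = just (inj₁ b)

-- Register 0 reads the input; a counter only sees the mark in its first cell.
content : List Bool → ℕ → ℕ → Symbol
content x r       zero    = mark
content x zero    (suc i) = nth (map bitSymbol x) i
content x (suc r) (suc i) = blank

isMark : Symbol → Bool
isMark mark = true
isMark _    = false

isBlank : Symbol → Bool
isBlank blank = true
isBlank _     = false

isTrue : Symbol → Bool
isTrue (just (inj₁ true)) = true
isTrue _                  = false

isMark-nth : ∀ x i → isMark (nth (map bitSymbol x) i) ≡ false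
isMark-nth []       i       = refl
isMark-nth (b ∷ bs) zero    = refl
isMark-nth (b ∷ bs) (suc i) = isMark-nth bs i

isMark-content : ∀ x r i → isMark (content x r (suc i)) ≡ false
isMark-content x zero    i = isMark-nth x i
isMark-content x (suc r) i = refl

isTrue-nth : ∀ x i → isTrue (nth (map bitSymbol x) i) ≡ bitAt x i
isTrue-nth []           i       = refl
isTrue-nth (false ∷ bs) zero    = refl
isTrue-nth (true ∷ bs)  zero    = refl
isTrue-nth (b ∷ bs)     (suc i) = isTrue-nth bs i

isBlank-nth : ∀ x i → i < length x → isBlank (nth (map bitSymbol x) i) ≡ false
isBlank-nth (b ∷ bs) zero    _         = refl
isBlank-nth (b ∷ bs) (suc i) (s≤s i<n) = isBlank-nth bs i i<n

module Programs (k : ℕ) where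
  open Blocks k

  register : Vec Symbol k → ℕ → Symbol
  register = get blank

  moveActions : (ℕ → Move) → Vec Symbol k → Vec (Symbol × Move) k
  moveActions d s = Vec.tabulate (λ i → register s (toℕ i) , d (toℕ i))

  -- Every tape gets back the symbol scanned on it, so only the head of register `r` changes
  -- anything. The symbol that decides on the move may come from another register `q`; this is how a
  -- bit of the input reaches a counter.
  shift : ℕ → (Symbol → Move) → ℕ → Block
  shift r φ q = atom λ { (o ∷ s) →
    (o , stay) ∷ moveActions (λ j → choose (j ≟ r) (φ (register s q)) stay) s }

  inc dec : ℕ → Block
  inc r = shift r (λ _ → right) r
  dec r = shift r (λ _ → left) r

  while : (Symbol → Bool) → ℕ → Block → Block
  while test r = loop λ { (o ∷ s) → test (register s r) }

  repeat : ℕ → Block → Block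
  repeat r b = while (not ∘ isMark) r (dec r ⨾ b)

  clear : ℕ → Block
  clear r = while (not ∘ isMark) r (dec r)

module Registers (k : ℕ) (x : List Bool) where
  open Blocks k
  open Programs k

  record Holds (σ : Store) (ts : Vec (Tape (Bool ⊎ ⊤)) k) : Set where
    constructor holds
    field
      at : ∀ r → r < k → At (content x r) (σ r) (get emptyTape ts r)

  open Holds public

  -- The first tape `o` is arbitrary and comes back untouched, so these programs can run between two
  -- writes of the output.
  record Spec (b : Block) (σ σ′ : Store) (m : ℕ) : Set where
    constructor spec
    field
      runs : ∀ {o ts} → Holds σ ts → ∃[ us ] Holds σ′ us × Runs b (o ∷ ts) m (o ∷ us)

  open Spec public

  spec-≤ : ∀ {b σ σ′ m m′} → m ≤ m′ → Spec b σ σ′ m → Spec b σ σ′ m′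
  spec-≤ m≤ s .runs h with runs s h
  ... | us , h′ , r = us , h′ , runs-≤ m≤ r

  spec-⨾ : ∀ {b c σ σ′ σ″ m m′} → Spec b σ σ′ m → Spec c σ′ σ″ m′ → Spec (b ⨾ c) σ σ″ (m + m′)
  spec-⨾ s s′ .runs h with runs s h
  ... | us , h′ , r with runs s′ h′
  ... | vs , h″ , r′ = vs , h″ , runs-⨾ r r′

  holds-≗ : ∀ {σ σ′ ts} → σ ≗ σ′ → Holds σ ts → Holds σ′ ts
  holds-≗ {ts = ts} σ≗ h .at r r<k =
    subst (λ i → At (content x r) i (get emptyTape ts r)) (σ≗ r) (h .at r r<k)

  spec-≗ : ∀ {b σ σ′ τ τ′ m} → σ ≗ τ → τ′ ≗ σ′ → Spec b τ τ′ m → Spec b σ σ′ m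
  spec-≗ σ≗ τ≗ s .runs h with runs s (holds-≗ σ≗ h)
  ... | us , h′ , r = us , holds-≗ τ≗ h′ , r

  holds-scan : ∀ {σ ts r} → Holds σ ts → r < k → register (Vec.map scanned ts) r ≡ content x r (σ r)
  holds-scan {σ} {ts} {r} h r<k =
    trans (get-scanned ts r) (at-scanned {h = σ r} {get emptyTape ts r} (h .at r r<k))

  spec-shift : ∀ {σ r φ q h} → q < k → Shift (φ (content x q (σ q))) (σ r) h →
               Spec (shift r φ q) σ (σ [ r ≔ h ]) 1
  spec-shift {σ} {r} {φ} {q} {h} q<k sh .runs {o} {ts} hold =
    _ , hold′ , runs-atom (o ∷ ts)
    where
    s = Vec.map scanned ts
    d : ℕ → Move
    d j = choose (j ≟ r) (φ (register s q)) stay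
    moved : ∀ j → Shift (d j) (σ j) ((σ [ r ≔ h ]) j)
    moved j with j ≟ r
    ... | yes refl = subst (λ s → Shift (φ s) (σ r) h) (sym (holds-scan hold q<k)) sh
    ... | no _     = stay
    hold′ : Holds (σ [ r ≔ h ]) (Vec.zipWith act ts (moveActions d s))
    hold′ .at j j<k
      rewrite get-act ts (λ j → register s j , d j) j j<k | get-scanned ts j
      = at-move {t = get emptyTape ts j} (moved j) (hold .at j j<k)

  spec-inc : ∀ {σ r} → r < k → Spec (inc r) σ (σ [ r ≔ suc (σ r) ]) 1
  spec-inc r<k = spec-shift r<k right

  spec-dec : ∀ {σ r h} → r < k → σ r ≡ suc h → Spec (dec r) σ (σ [ r ≔ h ]) 1
  spec-dec r<k eq = spec-shift r<k (subst (λ i → Shift left i _) (sym eq) left)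

  spec-done : ∀ {test r b σ} → r < k → test (content x r (σ r)) ≡ false → Spec (while test r b) σ σ 1
  spec-done {test} r<k e .runs {ts = ts} h = ts , h , runs-done (trans (cong test (holds-scan h r<k)) e)

  spec-again : ∀ {test r b σ σ′ σ″ m m′} → r < k → test (content x r (σ r)) ≡ true →
               Spec b σ σ′ m → Spec (while test r b) σ′ σ″ m′ → Spec (while test r b) σ σ″ (suc (m + m′))
  spec-again {test} r<k e s s′ .runs h with runs s h
  ... | us , h′ , r with runs s′ h′
  ... | vs , h″ , r′ = vs , h″ , runs-again (trans (cong test (holds-scan h r<k)) e) r r′

  positive : ∀ r {i h} → i ≡ suc h → not (isMark (content x r i)) ≡ true
  positive r refl = cong not (isMark-content x r _)

  null : ∀ r {i} → i ≡ 0 → not (isMark (content x r i)) ≡ false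
  null r refl = refl

  -- Inv i is the store when i rounds remain.
  spec-repeat : ∀ {r b m} (Inv : ℕ → Store) n → r < k → (∀ i → Inv i r ≡ i) →
                (∀ i → i < n → Spec b (Inv (suc i) [ r ≔ i ]) (Inv i) m) →
                Spec (repeat r b) (Inv n) (Inv 0) (n * (2 + m) + 1)
  spec-repeat {r} Inv zero r<k counts body = spec-done r<k (null r (counts 0))
  spec-repeat {r} {b} {m} Inv (suc n) r<k counts body =
    spec-≤ (≤-reflexive (sym (+-assoc (2 + m) (n * (2 + m)) 1)))
      (spec-again r<k (positive r (counts (suc n)))
        (spec-⨾ (spec-dec r<k (counts (suc n))) (body n ≤-refl))
        (spec-repeat Inv n r<k counts (λ i i<n → body i (m<n⇒m<1+n i<n))))

  spec-clear : ∀ {σ r} n → r < k → σ r ≡ n → Spec (clear r) σ (σ [ r ≔ 0 ]) (n * 2 + 1)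
  spec-clear {σ} {r} zero r<k eq = spec-≗ (λ _ → refl) same (spec-done r<k (null r eq))
    where
    same : σ ≗ σ [ r ≔ 0 ]
    same j with j ≟ r
    ... | yes refl = eq
    ... | no _     = refl
  spec-clear {σ} {r} (suc n) r<k eq =
    spec-again r<k (positive r eq) (spec-dec r<k eq)
      (spec-≗ (λ _ → refl) same (spec-clear n r<k (≔-here σ r n)))
    where
    same : σ [ r ≔ n ] [ r ≔ 0 ] ≗ σ [ r ≔ 0 ]
    same j with j ≟ r
    ... | yes _ = refl
    ... | no _  = refl

-- Compilation of expressions into register programs

module Compiler (k : ℕ) where
  open Blocks k
  open Programs k

  -- Adds the value of an expression to register r.  The variables are in the
  -- registers ρ, and the registers from f on are free and 0.
  compile : Expr n → Env n → ℕ → ℕ → Block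
  compile (var i)     ρ r f =
    repeat (valueAt ρ i) (inc f) ⨾ repeat f (inc (valueAt ρ i) ⨾ inc r)
  compile one         ρ r f = inc r
  compile len         ρ r f =
    inc 0 ⨾ while (not ∘ isBlank) 0 (inc 0 ⨾ inc r) ⨾ clear 0
  compile (bit e)     ρ r f =
    compile e ρ f (suc f) ⨾ inc 0 ⨾ repeat f (inc 0) ⨾
    shift r (λ a → if isTrue a then right else stay) 0 ⨾ clear 0
  compile (plus a b)  ρ r f = compile a ρ r f ⨾ compile b ρ r f
  compile (monus a b) ρ r f =
    compile a ρ f (suc f) ⨾ compile b ρ (suc f) (suc (suc f)) ⨾
    repeat (suc f) (shift f (λ a → if isMark a then stay else left) f) ⨾ repeat f (inc r)
  compile (sum a b)   ρ r f = compile a ρ f (suc f) ⨾ repeat f (compile b (f , ρ) r (suc f))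

room : Expr n → ℕ
room (var i)     = 1
room one         = 0
room len         = 0
room (bit e)     = suc (room e)
room (plus a b)  = room a + room b
room (monus a b) = suc (suc (room a + room b))
room (sum a b)   = suc (room a + room b)

module Correctness (k : ℕ) (x : List Bool) where
  open Blocks k
  open Programs k
  open Registers k x
  open Compiler k

  spec-transfer : ∀ {σ s r} n → s < k → r < k → s ≢ r → σ s ≡ n →
                  Spec (repeat s (inc r)) σ (σ [ s ≔ 0 ] [ r ≔ σ r + n ]) (n * 3 + 1)
  spec-transfer {σ} {s} {r} n s<k r<k s≢r eq =
    spec-≗ start (λ _ → refl) (spec-repeat Inv n s<k count body)
    where
    Inv : ℕ → Store
    Inv i = σ [ s ≔ i ] [ r ≔ σ r + (n ∸ i) ]
    count : ∀ i → Inv i s ≡ i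
    count i = trans (≔-away (σ [ s ≔ i ]) r _ s≢r) (≔-here σ s i)
    start : σ ≗ Inv n
    start j with j ≟ r | j ≟ s
    ... | yes refl | _        = sym (trans (cong (σ r +_) (n∸n≡0 n)) (+-identityʳ _))
    ... | no _     | yes refl = eq
    ... | no _     | no _     = refl
    body : ∀ i → i < n → Spec (inc r) (Inv (suc i) [ s ≔ i ]) (Inv i) 1
    body i i<n = spec-≗ (λ _ → refl) same (spec-inc r<k)
      where
      same : Inv (suc i) [ s ≔ i ] [ r ≔ suc ((Inv (suc i) [ s ≔ i ]) r) ] ≗ Inv i
      same j with j ≟ r
      ... | yes refl
        rewrite ≔-away (Inv (suc i)) s i (s≢r ∘ sym) | ≔-here (σ [ s ≔ suc i ]) r (σ r + (n ∸ suc i))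
        = trans (sym (+-suc (σ r) _)) (cong (σ r +_) (sym (+-∸-assoc 1 i<n)))
      ... | no j≢r with j ≟ s
      ...   | yes _ = refl
      ...   | no j≢s with j ≟ r
      ...     | yes j≡r = contradiction j≡r j≢r
      ...     | no _ with j ≟ s
      ...       | yes j≡s = contradiction j≡s j≢s
      ...       | no _    = refl

  -- The precondition of compiled code. Register 0 is the head on the input, which `len` and `bit`
  -- displace and rewind; so it must rest at 0 and be neither target nor variable. Variables must
  -- differ from the target, since reading a variable empties it temporarily.
  record Ready (ρ η : Env n) (r f : ℕ) (σ : Store) : Set where
    field
      target   : r < f
      nonInput : 0 < r
      bound    : ∀ i → valueAt ρ i < f
      distinct : ∀ i → valueAt ρ i ≢ r
      counter  : ∀ i → valueAt ρ i ≢ 0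
      values   : ∀ i → σ (valueAt ρ i) ≡ valueAt η i
      rest     : σ 0 ≡ 0
      fresh    : ∀ j → f ≤ j → σ j ≡ 0

  open Ready

  inner : ∀ {ρ η : Env n} {r f σ} → Ready ρ η r f σ → Ready ρ η f (suc f) σ
  inner R = record
    { target   = ≤-refl
    ; nonInput = ≤-trans (R .nonInput) (<⇒≤ (R .target))
    ; bound    = λ i → m<n⇒m<1+n (R .bound i)
    ; distinct = λ i → <⇒≢ (R .bound i)
    ; counter  = R .counter
    ; values   = R .values
    ; rest     = R .rest
    ; fresh    = λ j f<j → R .fresh j (<⇒≤ f<j)
    }

  accumulated : ∀ {ρ η : Env n} {r f σ} v → Ready ρ η r f σ → Ready ρ η r f (σ [ r ≔ v ])
  accumulated {r = r} {σ = σ} v R = record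
    { target   = R .target
    ; nonInput = R .nonInput
    ; bound    = R .bound
    ; distinct = R .distinct
    ; counter  = R .counter
    ; values   = λ i → trans (≔-away σ r v (R .distinct i)) (R .values i)
    ; rest     = trans (≔-away σ r v (<⇒≢ (R .nonInput))) (R .rest)
    ; fresh    = λ j f≤j → trans (≔-away σ r v (≢-sym (<⇒≢ (<-≤-trans (R .target) f≤j)))) (R .fresh j f≤j)
    }

  next-free : ∀ {ρ η : Env n} {r f σ} v → Ready ρ η r f σ → Ready ρ η (suc f) (suc (suc f)) (σ [ f ≔ v ])
  next-free {f = f} {σ} v R = record
    { target   = ≤-refl
    ; nonInput = s≤s z≤n
    ; bound    = λ i → m<n⇒m<1+n (m<n⇒m<1+n (R .bound i))
    ; distinct = λ i → <⇒≢ (m<n⇒m<1+n (R .bound i))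
    ; counter  = R .counter
    ; values   = λ i → trans (≔-away σ f v (<⇒≢ (R .bound i))) (R .values i)
    ; rest     = trans (≔-away σ f v (<⇒≢ (≤-trans (R .nonInput) (<⇒≤ (R .target))))) (R .rest)
    ; fresh    = λ j f<j → trans (≔-away σ f v (≢-sym (<⇒≢ (≤-trans (s≤s (n≤1+n f)) f<j))))
                                 (R .fresh j (≤-trans (n≤1+n f) (<⇒≤ f<j)))
    }

  -- For `sum`: the loop counter `f` doubles as the register of the bound variable, as its value
  -- during a round is exactly the current index.
  extended : ∀ {ρ η : Env n} {r f σ} i → Ready ρ η r f σ → Ready (f , ρ) (i , η) r (suc f) (σ [ f ≔ i ])
  extended {f = f} {σ} i R = record
    { target   = m<n⇒m<1+n (R .target)
    ; nonInput = R .nonInput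
    ; bound    = λ { zero → ≤-refl ; (suc j) → m<n⇒m<1+n (R .bound j) }
    ; distinct = λ { zero → ≢-sym (<⇒≢ (R .target)) ; (suc j) → R .distinct j }
    ; counter  = λ { zero → ≢-sym (<⇒≢ f>0) ; (suc j) → R .counter j }
    ; values   = λ { zero → ≔-here σ f i ; (suc j) → trans (≔-away σ f i (<⇒≢ (R .bound j))) (R .values j) }
    ; rest     = trans (≔-away σ f i (<⇒≢ f>0)) (R .rest)
    ; fresh    = λ j f<j → trans (≔-away σ f i (≢-sym (<⇒≢ f<j))) (R .fresh j (<⇒≤ f<j))
    }
    where
    f>0 : 0 < f
    f>0 = ≤-trans (R .nonInput) (<⇒≤ (R .target))

  -- The start value `a` of the accumulator is generalised because each round hands a larger one to
  -- the next.
  spec-accumulate : ∀ {b m s r} (σ : Store) (g : ℕ → ℕ) n a → s < k → s ≢ r →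
    (∀ i a → i < n → Spec b (σ [ s ≔ i ] [ r ≔ a ]) (σ [ s ≔ i ] [ r ≔ a + g i ]) m) →
    Spec (repeat s b) (σ [ s ≔ n ] [ r ≔ a ]) (σ [ s ≔ 0 ] [ r ≔ a + Σ< n g ]) (n * (2 + m) + 1)
  spec-accumulate {s = s} {r} σ g zero a s<k s≢r body =
    spec-≗ (λ _ → refl) (λ j → cong (λ v → (σ [ s ≔ 0 ] [ r ≔ v ]) j) (sym (+-identityʳ a)))
      (spec-done s<k (null s (trans (≔-away (σ [ s ≔ 0 ]) r a s≢r) (≔-here σ s 0))))
  spec-accumulate {m = m} {s} {r} σ g (suc n) a s<k s≢r body =
    spec-≤ (≤-reflexive (sym (+-assoc (2 + m) (n * (2 + m)) 1)))
      (spec-again s<k (positive s count)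
        (spec-⨾ (spec-dec s<k count) (spec-≗ swap (λ _ → refl) (body n a ≤-refl)))
        (spec-≗ (λ _ → refl) (λ j → cong (λ v → (σ [ s ≔ 0 ] [ r ≔ v ]) j) (+-assoc a (g n) _))
          (spec-accumulate σ g n (a + g n) s<k s≢r (λ i a i<n → body i a (m<n⇒m<1+n i<n)))))
    where
    count : (σ [ s ≔ suc n ] [ r ≔ a ]) s ≡ suc n
    count = trans (≔-away (σ [ s ≔ suc n ]) r a s≢r) (≔-here σ s (suc n))
    swap : σ [ s ≔ suc n ] [ r ≔ a ] [ s ≔ n ] ≗ σ [ s ≔ n ] [ r ≔ a ]
    swap j with j ≟ s | j ≟ r
    ... | yes refl | yes s≡r = contradiction s≡r s≢r
    ... | yes _    | no _    = refl
    ... | no _     | yes _   = refl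
    ... | no _     | no _    = refl

  -- A counter can be read only by running it down to 0. A variable is therefore first moved to a
  -- scratch register `s`, then poured back into `i` and at the same time added to `r`.
  spec-restore : ∀ {σ s i r} n → s < k → i < k → r < k → s ≢ i → s ≢ r → i ≢ r → σ i ≡ 0 → σ s ≡ n →
                 Spec (repeat s (inc i ⨾ inc r)) σ (σ [ s ≔ 0 ] [ i ≔ n ] [ r ≔ σ r + n ]) (n * 4 + 1)
  spec-restore {σ} {s} {i} {r} n s<k i<k r<k s≢i s≢r i≢r i-zero eq =
    spec-≗ start (λ _ → refl) (spec-repeat Inv n s<k count body)
    where
    Inv : ℕ → Store
    Inv h = σ [ s ≔ h ] [ i ≔ n ∸ h ] [ r ≔ σ r + (n ∸ h) ]
    at-i : ∀ h → Inv h i ≡ n ∸ h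
    at-i h = trans (≔-away (σ [ s ≔ h ] [ i ≔ n ∸ h ]) r _ i≢r) (≔-here (σ [ s ≔ h ]) i _)
    at-r : ∀ h → Inv h r ≡ σ r + (n ∸ h)
    at-r h = ≔-here (σ [ s ≔ h ] [ i ≔ n ∸ h ]) r _
    count : ∀ h → Inv h s ≡ h
    count h = trans (≔-away (σ [ s ≔ h ] [ i ≔ n ∸ h ]) r _ s≢r)
                    (trans (≔-away (σ [ s ≔ h ]) i _ s≢i) (≔-here σ s h))
    start : σ ≗ Inv n
    start j with j ≟ r | j ≟ i | j ≟ s
    ... | yes refl | _        | _        = sym (trans (cong (σ r +_) (n∸n≡0 n)) (+-identityʳ _))
    ... | no _     | yes refl | _        = trans i-zero (sym (n∸n≡0 n))
    ... | no _     | no _     | yes refl = eq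
    ... | no _     | no _     | no _     = refl
    body : ∀ h → h < n → Spec (inc i ⨾ inc r) (Inv (suc h) [ s ≔ h ]) (Inv h) 2
    body h h<n = spec-≗ (λ _ → refl) same (spec-⨾ (spec-inc i<k) (spec-inc r<k))
      where
      τ τ′ : Store
      τ = Inv (suc h) [ s ≔ h ]
      τ′ = τ [ i ≔ suc (τ i) ]
      τ-i : suc (τ i) ≡ n ∸ h
      τ-i = trans (cong suc (trans (≔-away (Inv (suc h)) s h (≢-sym s≢i)) (at-i (suc h))))
                  (sym (+-∸-assoc 1 h<n))
      τ-r : suc (τ′ r) ≡ σ r + (n ∸ h)
      τ-r = trans (cong suc (trans (≔-away τ i _ (≢-sym i≢r))
                              (trans (≔-away (Inv (suc h)) s h (≢-sym s≢r)) (at-r (suc h)))))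
                  (trans (sym (+-suc (σ r) _)) (cong (σ r +_) (sym (+-∸-assoc 1 h<n))))
      same : τ′ [ r ≔ suc (τ′ r) ] ≗ Inv h
      same j rewrite τ-r | τ-i with j ≟ r | j ≟ i | j ≟ s
      ... | yes refl | _        | _        = refl
      ... | no _     | yes refl | _        = refl
      ... | no _     | no _     | yes refl = refl
      ... | no _     | no _     | no _     = refl

  -- The subtraction is truncated because a head that has reached the mark stays there.
  spec-monus : ∀ {σ s f} n a → s < k → f < k → s ≢ f → σ s ≡ n → σ f ≡ a →
               Spec (repeat s (shift f (λ a → if isMark a then stay else left) f)) σ
                    (σ [ s ≔ 0 ] [ f ≔ a ∸ n ]) (n * 3 + 1)
  spec-monus {σ} {s} {f} n a s<k f<k s≢f eq eq′ =
    spec-≗ start (λ _ → refl) (spec-repeat Inv n s<k count body)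
    where
    Inv : ℕ → Store
    Inv h = σ [ s ≔ h ] [ f ≔ a ∸ (n ∸ h) ]
    count : ∀ h → Inv h s ≡ h
    count h = trans (≔-away (σ [ s ≔ h ]) f _ s≢f) (≔-here σ s h)
    start : σ ≗ Inv n
    start j with j ≟ f | j ≟ s
    ... | yes refl | _        = trans eq′ (sym (cong (a ∸_) (n∸n≡0 n)))
    ... | no _     | yes refl = eq
    ... | no _     | no _     = refl
    down : ∀ {v w} → w ≡ v ∸ 1 → Shift (if isMark (content x f v) then stay else left) v w
    down {zero}  refl = stay
    down {suc v} refl rewrite isMark-content x f v = left
    body : ∀ h → h < n → Spec _ (Inv (suc h) [ s ≔ h ]) (Inv h) 1
    body h h<n = spec-≗ (λ _ → refl) same (spec-shift f<k (down lower))
      where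
      τ : Store
      τ = Inv (suc h) [ s ≔ h ]
      τ-f : τ f ≡ a ∸ (n ∸ suc h)
      τ-f = trans (≔-away (Inv (suc h)) s h (≢-sym s≢f)) (≔-here (σ [ s ≔ suc h ]) f _)
      lower : a ∸ (n ∸ h) ≡ τ f ∸ 1
      lower rewrite τ-f = trans (cong (a ∸_) (trans (+-∸-assoc 1 h<n) (+-comm 1 (n ∸ suc h))))
                               (sym (∸-+-assoc a (n ∸ suc h) 1))
      same : τ [ f ≔ a ∸ (n ∸ h) ] ≗ Inv h
      same j with j ≟ f | j ≟ s
      ... | yes refl | _        = refl
      ... | no _     | yes refl = refl
      ... | no _     | no _     = refl

  -- The mark occupies cell 0, so bit i is scanned at position `suc i`; `n` counts the bits that are
  -- still ahead.
  spec-walk : ∀ {σ r} n i → 0 < k → r < k → 0 < r → σ 0 ≡ suc i → i + n ≡ length x →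
              Spec (while (not ∘ isBlank) 0 (inc 0 ⨾ inc r)) σ
                   (σ [ 0 ≔ suc (length x) ] [ r ≔ σ r + n ]) (n * 3 + 1)
  spec-walk {σ} {r} zero i 0<k r<k 0<r eq len-eq =
    spec-≗ (λ _ → refl) same (spec-done 0<k end)
    where
    end : not (isBlank (content x 0 (σ 0))) ≡ false
    end rewrite eq | nth-blank (map bitSymbol x) i
      (≤-reflexive (trans (length-map bitSymbol x) (trans (sym len-eq) (+-identityʳ i)))) = refl
    same : σ ≗ σ [ 0 ≔ suc (length x) ] [ r ≔ σ r + 0 ]
    same j with j ≟ r | j ≟ 0
    ... | yes refl | _        = sym (+-identityʳ _)
    ... | no _     | yes refl = trans eq (cong suc (trans (sym (+-identityʳ i)) len-eq))
    ... | no _     | no _     = refl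
  spec-walk {σ} {r} (suc n) i 0<k r<k 0<r eq len-eq =
    spec-again 0<k more (spec-⨾ (spec-inc 0<k) (spec-inc r<k))
      (spec-≗ (λ _ → refl) same (spec-walk n (suc i) 0<k r<k 0<r τ-0 (trans (sym (+-suc i n)) len-eq)))
    where
    more : not (isBlank (content x 0 (σ 0))) ≡ true
    more rewrite eq | isBlank-nth x i (subst (i <_) len-eq (m<m+n i (s≤s z≤n))) = refl
    τ τ′ : Store
    τ = σ [ 0 ≔ suc (σ 0) ]
    τ′ = τ [ r ≔ suc (τ r) ]
    τ-0 : τ′ 0 ≡ suc (suc i)
    τ-0 = trans (≔-away τ r _ (<⇒≢ 0<r)) (trans (≔-here σ 0 _) (cong suc eq))
    τ-r : τ′ r + n ≡ σ r + suc n
    τ-r = trans (cong (_+ n) (trans (≔-here τ r _) (cong suc (≔-away σ 0 _ (≢-sym (<⇒≢ 0<r))))))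
                (sym (+-suc (σ r) n))
    same : τ′ [ 0 ≔ suc (length x) ] [ r ≔ τ′ r + n ] ≗ σ [ 0 ≔ suc (length x) ] [ r ≔ σ r + suc n ]
    same j rewrite τ-r with j ≟ r | j ≟ 0
    ... | yes refl | _        = refl
    ... | no _     | yes refl = refl
    ... | no _     | no _     = refl

module CompilerCorrectness (k : ℕ) (x : List Bool) where
  open Blocks k
  open Programs k
  open Registers k x
  open Compiler k
  open Correctness k x
  open Ready

  room-here : ∀ {f c} → f + suc c ≤ k → f < k
  room-here {f} {c} f+c≤k = ≤-trans (≤-trans (m≤m+n (suc f) c) (≤-reflexive (sym (+-suc f c)))) f+c≤k

  room-inner : ∀ {f c d} → d ≤ c → f + suc c ≤ k → suc f + d ≤ k
  room-inner {f} {c} d≤c f+c≤k = ≤-trans (s≤s (+-monoʳ-≤ f d≤c)) (≤-trans (≤-reflexive (sym (+-suc f c))) f+c≤k)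

  -- Composing the blocks gives the final store as a chain of assignments; each `same` checks
  -- pointwise that the variables are restored and the scratch registers are 0 again, so that only
  -- `r` has changed.
  spec-compile : ∀ (e : Expr n) {ρ η r f σ B} → Ready ρ η r f σ → f + room e ≤ k →
                 length x ≤ B → (∀ i → valueAt η i ≤ B) → 0 < k → r < k →
                 Spec (compile e ρ r f) σ (σ [ r ≔ σ r + ⟦ e ⟧ x η ]) (time e B)
  spec-compile (var i) {ρ} {η} {r} {f} {σ} {B} R room≤ x≤ η≤ 0<k r<k =
    spec-≤ (+-mono-≤ (+-monoˡ-≤ 1 (*-monoˡ-≤ 3 (η≤ i))) (+-monoˡ-≤ 1 (*-monoˡ-≤ 4 (η≤ i))))
      (spec-≗ (λ _ → refl) same
        (spec-⨾ (spec-transfer v (<-trans (R .bound i) f<k) f<k q≢f (R .values i))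
          (spec-restore v f<k (<-trans (R .bound i) f<k) r<k (≢-sym q≢f) f≢r (R .distinct i) τ-q τ-f)))
    where
    f<k : f < k
    f<k = room-here room≤
    q v : ℕ
    q = valueAt ρ i
    v = valueAt η i
    q≢f : q ≢ f
    q≢f = <⇒≢ (R .bound i)
    f≢r : f ≢ r
    f≢r = ≢-sym (<⇒≢ (R .target))
    τ : Store
    τ = σ [ q ≔ 0 ] [ f ≔ σ f + v ]
    τ-q : τ q ≡ 0
    τ-q = trans (≔-away (σ [ q ≔ 0 ]) f _ q≢f) (≔-here σ q 0)
    τ-f : τ f ≡ v
    τ-f = trans (≔-here (σ [ q ≔ 0 ]) f _) (cong (_+ v) (R .fresh f ≤-refl))
    τ-r : τ r ≡ σ r
    τ-r = trans (≔-away (σ [ q ≔ 0 ]) f _ (≢-sym f≢r)) (≔-away σ q 0 (≢-sym (R .distinct i)))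
    same : τ [ f ≔ 0 ] [ q ≔ v ] [ r ≔ τ r + v ] ≗ σ [ r ≔ σ r + v ]
    same j rewrite τ-r with j ≟ r | j ≟ q | j ≟ f
    ... | yes _ | _        | _        = refl
    ... | no _  | yes refl | _        = sym (R .values i)
    ... | no _  | no _     | yes refl = sym (R .fresh f ≤-refl)
    ... | no _  | no _     | no _     = refl
  spec-compile one {r = r} {σ = σ} R room≤ x≤ η≤ 0<k r<k =
    spec-≗ (λ _ → refl) (λ j → cong (λ v → (σ [ r ≔ v ]) j) (+-comm 1 (σ r))) (spec-inc r<k)
  spec-compile len {r = r} {f} {σ} {B} R room≤ x≤ η≤ 0<k r<k =
    spec-≤ (s≤s (+-mono-≤ (+-monoˡ-≤ 1 (*-monoˡ-≤ 3 x≤)) (+-monoˡ-≤ 1 (*-monoˡ-≤ 2 (s≤s x≤)))))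
      (spec-≗ (λ _ → refl) same
        (spec-⨾ (spec-inc 0<k)
          (spec-⨾ (spec-walk (length x) 0 0<k r<k (R .nonInput) τ-0 refl)
            (spec-clear (suc (length x)) 0<k υ-0))))
    where
    τ υ : Store
    τ = σ [ 0 ≔ suc (σ 0) ]
    τ-0 : τ 0 ≡ 1
    τ-0 = trans (≔-here σ 0 _) (cong suc (R .rest))
    υ = τ [ 0 ≔ suc (length x) ] [ r ≔ τ r + length x ]
    υ-0 : υ 0 ≡ suc (length x)
    υ-0 = trans (≔-away (τ [ 0 ≔ _ ]) r _ (<⇒≢ (R .nonInput))) (≔-here τ 0 _)
    τ-r : τ r ≡ σ r
    τ-r = ≔-away σ 0 _ (≢-sym (<⇒≢ (R .nonInput)))
    same : υ [ 0 ≔ 0 ] ≗ σ [ r ≔ σ r + length x ]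
    same j rewrite τ-r with j ≟ r | j ≟ 0
    ... | yes refl | yes refl = contradiction refl (<⇒≢ (R .nonInput))
    ... | yes _    | no _     = refl
    ... | no _     | yes refl = sym (R .rest)
    ... | no _     | no _     = refl
  spec-compile (bit e) {ρ} {η} {r} {f} {σ} {B} R room≤ x≤ η≤ 0<k r<k =
    spec-≤ (+-monoʳ-≤ (time e B) (s≤s (+-mono-≤ (+-monoˡ-≤ 1 (*-monoˡ-≤ 3 v≤))
                                        (s≤s (+-monoˡ-≤ 1 (*-monoˡ-≤ 2 (s≤s v≤)))))))
      (spec-≗ (λ _ → refl) same
        (spec-⨾ (spec-compile e (inner R) (room-inner ≤-refl room≤) x≤ η≤ 0<k f<k)
          (spec-⨾ (spec-inc 0<k)
            (spec-⨾ (spec-transfer v f<k 0<k f≢0 σ₂-f)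
              (spec-⨾ (spec-shift 0<k read) (spec-clear (suc v) 0<k σ₄-0))))))
    where
    v b : ℕ
    v = ⟦ e ⟧ x η
    b = ⌜ bitAt x v ⌝
    f<k : f < k
    f<k = room-here room≤
    f≢0 : f ≢ 0
    f≢0 = ≢-sym (<⇒≢ (≤-trans (R .nonInput) (<⇒≤ (R .target))))
    r≢f : r ≢ f
    r≢f = <⇒≢ (R .target)
    r≢0 : r ≢ 0
    r≢0 = ≢-sym (<⇒≢ (R .nonInput))
    v≤ : v ≤ size e B
    v≤ = size-bound e x≤ η≤
    σ₁ σ₂ σ₃ σ₄ : Store
    σ₁ = σ [ f ≔ σ f + v ]
    σ₂ = σ₁ [ 0 ≔ suc (σ₁ 0) ]
    σ₃ = σ₂ [ f ≔ 0 ] [ 0 ≔ σ₂ 0 + v ]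
    σ₄ = σ₃ [ r ≔ σ r + b ]
    σ₂-f : σ₂ f ≡ v
    σ₂-f = trans (≔-away σ₁ 0 _ f≢0) (trans (≔-here σ f _) (cong (_+ v) (R .fresh f ≤-refl)))
    σ₂-0 : σ₂ 0 ≡ 1
    σ₂-0 = trans (≔-here σ₁ 0 _) (cong suc (trans (≔-away σ f _ (≢-sym f≢0)) (R .rest)))
    σ₃-0 : σ₃ 0 ≡ suc v
    σ₃-0 = trans (≔-here (σ₂ [ f ≔ 0 ]) 0 _) (cong (_+ v) σ₂-0)
    σ₃-r : σ₃ r ≡ σ r
    σ₃-r = trans (≔-away (σ₂ [ f ≔ 0 ]) 0 _ r≢0) (trans (≔-away σ₂ f _ r≢f)
             (trans (≔-away σ₁ 0 _ r≢0) (≔-away σ f _ r≢f)))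
    σ₄-0 : σ₄ 0 ≡ suc v
    σ₄-0 = trans (≔-away σ₃ r _ (≢-sym r≢0)) σ₃-0
    bump : ∀ c h → Shift (if c then right else stay) h (h + ⌜ c ⌝)
    bump false h = subst (Shift stay h) (sym (+-identityʳ h)) stay
    bump true  h = subst (Shift right h) (+-comm 1 h) right
    -- The initial `inc 0` steps over the mark, so after v further steps the head scans bit v.
    read : Shift (if isTrue (content x 0 (σ₃ 0)) then right else stay) (σ₃ r) (σ r + b)
    read = subst₂ (λ c h → Shift (if c then right else stay) h (σ r + b))
             (sym (trans (cong (isTrue ∘ content x 0) σ₃-0) (isTrue-nth x v))) (sym σ₃-r)
             (bump (bitAt x v) (σ r))
    same : σ₄ [ 0 ≔ 0 ] ≗ σ [ r ≔ σ r + b ]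
    same j with j ≟ 0 | j ≟ r | j ≟ f
    ... | yes refl | yes 0≡r | _        = contradiction (sym 0≡r) r≢0
    ... | yes refl | no _    | _        = sym (R .rest)
    ... | no _     | yes _   | _        = refl
    ... | no _     | no _    | yes refl = sym (R .fresh f ≤-refl)
    ... | no _     | no _    | no _     = refl
  spec-compile (plus a b) {ρ} {η} {r} {f} {σ} {B} R room≤ x≤ η≤ 0<k r<k =
    spec-≗ (λ _ → refl) same
      (spec-⨾ (spec-compile a R (≤-trans (+-monoʳ-≤ f (m≤m+n (room a) (room b))) room≤) x≤ η≤ 0<k r<k)
              (spec-compile b (accumulated _ R) (≤-trans (+-monoʳ-≤ f (m≤n+m (room b) (room a))) room≤)
                x≤ η≤ 0<k r<k))
    where
    τ : Store
    τ = σ [ r ≔ σ r + ⟦ a ⟧ x η ]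
    same : τ [ r ≔ τ r + ⟦ b ⟧ x η ] ≗ σ [ r ≔ σ r + (⟦ a ⟧ x η + ⟦ b ⟧ x η) ]
    same j rewrite ≔-here σ r (σ r + ⟦ a ⟧ x η) with j ≟ r
    ... | yes _ = +-assoc (σ r) _ _
    ... | no _  = refl
  spec-compile (monus a b) {ρ} {η} {r} {f} {σ} {B} R room≤ x≤ η≤ 0<k r<k =
    spec-≤ (+-monoʳ-≤ (time a B) (+-monoʳ-≤ (time b B)
             (+-mono-≤ (+-monoˡ-≤ 1 (*-monoˡ-≤ 3 (size-bound b x≤ η≤)))
                       (+-monoˡ-≤ 1 (*-monoˡ-≤ 3 (size-bound (monus a b) x≤ η≤))))))
      (spec-≗ (λ _ → refl) same
        (spec-⨾ (spec-compile a (inner R)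
                  (room-inner (≤-trans (m≤m+n (room a) (room b)) (n≤1+n _)) room≤) x≤ η≤ 0<k f<k)
          (spec-⨾ (spec-compile b (next-free _ R) room-b x≤ η≤ 0<k f′<k)
            (spec-⨾ (spec-monus w v f′<k f<k f′≢f σ₂-f′ σ₂-f)
              (spec-transfer (v ∸ w) f<k r<k (≢-sym r≢f) (≔-here (σ₂ [ suc f ≔ 0 ]) f _))))))
    where
    v w : ℕ
    v = ⟦ a ⟧ x η
    w = ⟦ b ⟧ x η
    f<k : f < k
    f<k = room-here room≤
    f′<k : suc f < k
    f′<k = ≤-trans (s≤s (≤-trans (s≤s (m≤m+n f _)) (≤-reflexive (sym (+-suc f _)))))
                   (≤-trans (≤-reflexive (sym (+-suc f _))) room≤)
    room-b : suc (suc f) + room b ≤ k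
    room-b = ≤-trans (s≤s (s≤s (+-monoʳ-≤ f (m≤n+m (room b) (room a)))))
               (≤-trans (≤-reflexive (sym (trans (+-suc f _) (cong suc (+-suc f _))))) room≤)
    f′≢f : suc f ≢ f
    f′≢f = ≢-sym (<⇒≢ ≤-refl)
    r≢f : r ≢ f
    r≢f = <⇒≢ (R .target)
    r≢f′ : r ≢ suc f
    r≢f′ = <⇒≢ (m<n⇒m<1+n (R .target))
    σ₁ σ₂ σ₃ : Store
    σ₁ = σ [ f ≔ σ f + v ]
    σ₂ = σ₁ [ suc f ≔ σ₁ (suc f) + w ]
    σ₃ = σ₂ [ suc f ≔ 0 ] [ f ≔ v ∸ w ]
    σ₂-f : σ₂ f ≡ v
    σ₂-f = trans (≔-away σ₁ (suc f) _ (≢-sym f′≢f)) (trans (≔-here σ f _) (cong (_+ v) (R .fresh f ≤-refl)))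
    σ₂-f′ : σ₂ (suc f) ≡ w
    σ₂-f′ = trans (≔-here σ₁ (suc f) _)
              (cong (_+ w) (trans (≔-away σ f _ f′≢f) (R .fresh (suc f) (n≤1+n f))))
    σ₃-r : σ₃ r ≡ σ r
    σ₃-r = trans (≔-away (σ₂ [ suc f ≔ 0 ]) f _ r≢f) (trans (≔-away σ₂ (suc f) _ r≢f′)
             (trans (≔-away σ₁ (suc f) _ r≢f′) (≔-away σ f _ r≢f)))
    same : σ₃ [ f ≔ 0 ] [ r ≔ σ₃ r + (v ∸ w) ] ≗ σ [ r ≔ σ r + (v ∸ w) ]
    same j rewrite σ₃-r with j ≟ r | j ≟ f | j ≟ suc f
    ... | yes _ | _        | _        = refl
    ... | no _  | yes refl | _        = sym (R .fresh f ≤-refl)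
    ... | no _  | no _     | yes refl = sym (R .fresh (suc f) (n≤1+n f))
    ... | no _  | no _     | no _     = refl
  spec-compile (sum a b) {ρ} {η} {r} {f} {σ} {B} R room≤ x≤ η≤ 0<k r<k =
    spec-≤ (+-monoʳ-≤ (time a B) (+-monoˡ-≤ 1 (*-monoˡ-≤ (2 + time b (B + size a B)) v≤)))
      (spec-≗ (λ _ → refl) same
        (spec-⨾ (spec-compile a (inner R) (room-inner (m≤m+n (room a) (room b)) room≤) x≤ η≤ 0<k f<k)
          (spec-≗ start (λ _ → refl) (spec-accumulate σ g v (σ r) f<k (≢-sym r≢f) body))))
    where
    v : ℕ
    v = ⟦ a ⟧ x η
    g : ℕ → ℕ
    g i = ⟦ b ⟧ x (i , η)
    v≤ : v ≤ size a B
    v≤ = size-bound a x≤ η≤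
    f<k : f < k
    f<k = room-here room≤
    r≢f : r ≢ f
    r≢f = <⇒≢ (R .target)
    start : σ [ f ≔ σ f + v ] ≗ σ [ f ≔ v ] [ r ≔ σ r ]
    start j with j ≟ r | j ≟ f
    ... | yes refl | yes refl = contradiction refl r≢f
    ... | yes refl | no _     = refl
    ... | no _     | yes refl = cong (_+ v) (R .fresh f ≤-refl)
    ... | no _     | no _     = refl
    same : σ [ f ≔ 0 ] [ r ≔ σ r + Σ< v g ] ≗ σ [ r ≔ σ r + Σ< v g ]
    same j with j ≟ r | j ≟ f
    ... | yes _ | _        = refl
    ... | no _  | yes refl = sym (R .fresh f ≤-refl)
    ... | no _  | no _     = refl
    body : ∀ i c → i < v → Spec (compile b (f , ρ) r (suc f)) (σ [ f ≔ i ] [ r ≔ c ])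
                                (σ [ f ≔ i ] [ r ≔ c + g i ]) (time b (B + size a B))
    body i c i<v =
      spec-≗ (λ _ → refl) again
        (spec-compile b (accumulated c (extended i R)) (room-inner (m≤n+m (room b) (room a)) room≤)
          (≤-trans x≤ (m≤m+n B _))
          (λ { zero    → ≤-trans (<⇒≤ i<v) (≤-trans v≤ (m≤n+m _ B))
             ; (suc j) → ≤-trans (η≤ j) (m≤m+n B _) })
          0<k r<k)
      where
      again : σ [ f ≔ i ] [ r ≔ c ] [ r ≔ (σ [ f ≔ i ] [ r ≔ c ]) r + g i ] ≗ σ [ f ≔ i ] [ r ≔ c + g i ]
      again j rewrite ≔-here (σ [ f ≔ i ]) r c with j ≟ r
      ... | yes _ = refl
      ... | no _  = refl

-- Machines that print a word given by expressions

positive? : ℕ → Bool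
positive? zero    = false
positive? (suc _) = true

generated : Expr 0 → Expr 1 → List Bool → List Bool
generated size bitE x = applyUpTo (λ i → positive? (⟦ bitE ⟧ x (i , tt))) (⟦ size ⟧ x tt)

module Generator (lenE : Expr 0) (bitE : Expr 1) where

  -- Register 0 reads the copied input, register 1 counts the output bits still to be printed,
  -- register 2 receives the value of the current bit; the others are scratch space.
  k : ℕ
  k = 3 + (room lenE + room bitE)

  open Blocks k
  open Programs k
  open Compiler k

  setup : Block
  setup = atom λ { (o ∷ s) → (o , stay) ∷ Vec.tabulate (λ i → mark , choose (toℕ i ≟ 0) right stay) }

  copyActions : Symbol → Vec Symbol k → ℕ → Symbol × Move
  copyActions o s r = choose (r ≟ 0) o (register s r) , choose (r ≟ 0) right stay

  copyBit : Block
  copyBit = atom λ { (o ∷ s) → (o , right) ∷ Vec.tabulate (copyActions o s ∘ toℕ) }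

  unread : Scan → Bool
  unread (o ∷ s) = not (isBlank o)

  -- The output is written from right to left. Copying leaves the first head on the blank behind the
  -- input; every bit is put one cell further left, the last bit first since register 1 counts down.
  -- Thus the head ends on the first bit of the output, and the blank behind the input ends the
  -- output.
  back put emit program : Block
  back = atom λ { (o ∷ s) → (o , left) ∷ idle s }
  put  = atom λ { (o ∷ s) → (bitSymbol (not (isMark (register s 2))) , stay) ∷ idle s }
  emit = compile bitE (1 , tt) 2 3 ⨾ (back ⨾ put) ⨾ clear 2
  program = setup ⨾ loop unread copyBit ⨾ clear 0 ⨾ compile lenE tt 1 2 ⨾ repeat 1 emit

  1<k : 1 < k
  1<k = s≤s (s≤s z≤n)

  2<k : 2 < k
  2<k = s≤s (s≤s (s≤s z≤n))

  origin : Store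
  origin _ = 0

  remaining : List Symbol → List Bool → Tape (Bool ⊎ ⊤)
  remaining l []       = tape l blank []
  remaining l (b ∷ bs) = tape l (bitSymbol b) (map bitSymbol bs)

  remaining-right : ∀ l b bs → move right (remaining l (b ∷ bs)) ≡ remaining (bitSymbol b ∷ l) bs
  remaining-right l b []      = refl
  remaining-right l b (_ ∷ _) = refl

  nth-∷ʳ-here : ∀ ys b → nth (map bitSymbol (ys ++ [ b ])) (length ys) ≡ bitSymbol b
  nth-∷ʳ-here []       b = refl
  nth-∷ʳ-here (y ∷ ys) b = nth-∷ʳ-here ys b

  nth-∷ʳ-away : ∀ ys b i → i ≢ length ys → nth (map bitSymbol (ys ++ [ b ])) i ≡ nth (map bitSymbol ys) i
  nth-∷ʳ-away []       b zero    i≢ = contradiction refl i≢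
  nth-∷ʳ-away []       b (suc i) i≢ = refl
  nth-∷ʳ-away (y ∷ ys) b zero    i≢ = refl
  nth-∷ʳ-away (y ∷ ys) b (suc i) i≢ = nth-∷ʳ-away ys b i (i≢ ∘ cong suc)

  open Registers k using (Holds; holds; at)

  content-other : ∀ ys zs r i → r ≢ 0 → content ys r i ≡ content zs r i
  content-other ys zs zero    i       r≢0 = contradiction refl r≢0
  content-other ys zs (suc r) zero    r≢0 = refl
  content-other ys zs (suc r) (suc i) r≢0 = refl

  -- Here alone the contents of a register change. The head of register 0 stands on the first blank
  -- after `ys`, so writing there extends the word by one bit.
  copied : ∀ ys b {ts} → Holds ys (origin [ 0 ≔ suc (length ys) ]) ts →
           Holds (ys ++ [ b ]) (origin [ 0 ≔ suc (length (ys ++ [ b ])) ])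
                 (Vec.zipWith act ts (Vec.tabulate (copyActions (bitSymbol b) (Vec.map scanned ts) ∘ toℕ)))
  copied ys b {ts} h .at r r<k p
    rewrite get-act ts (copyActions (bitSymbol b) (Vec.map scanned ts)) r r<k with r ≟ 0
  ... | no r≢0 rewrite get-scanned ts r =
    trans (trans (cong (λ i → cell i (get emptyTape ts r) p) (sym (≔-away origin 0 _ r≢0))) (h .at r r<k p))
          (content-other ys (ys ++ [ b ]) r p r≢0)
  ... | yes refl rewrite length-++ ys {[ b ]} | +-comm (length ys) 1 =
    trans (cell-right (suc (length ys)) (write (bitSymbol b) t) p) new
    where
    t : Tape (Bool ⊎ ⊤)
    t = get emptyTape ts 0
    new : cell (suc (length ys)) (write (bitSymbol b) t) p ≡ content (ys ++ [ b ]) 0 p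
    new with p ≟ suc (length ys)
    ... | yes refl = trans (cell-write-here (suc (length ys)) (bitSymbol b) t) (sym (nth-∷ʳ-here ys b))
    new | no p≢ = trans (cell-write-away (suc (length ys)) (bitSymbol b) t p p≢) (trans (h .at 0 r<k p) (old p p≢))
      where
      old : ∀ p → p ≢ suc (length ys) → content ys 0 p ≡ content (ys ++ [ b ]) 0 p
      old zero    p≢ = refl
      old (suc i) p≢ = sym (nth-∷ʳ-away ys b i (p≢ ∘ cong suc))

  copy-runs : ∀ ys zs l {ts} → Holds ys (origin [ 0 ≔ suc (length ys) ]) ts →
              ∃[ l′ ] ∃[ us ] Holds (ys ++ zs) (origin [ 0 ≔ suc (length (ys ++ zs)) ]) us ×
                Runs (loop unread copyBit) (remaining l zs ∷ ts) (length zs * 2 + 1) (tape l′ blank [] ∷ us)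
  copy-runs ys [] l h =
    l , _ , subst (λ w → Holds w (origin [ 0 ≔ suc (length w) ]) _) (sym (++-identityʳ ys)) h , runs-done refl
  copy-runs ys (b ∷ zs) l {ts} h with copy-runs (ys ++ [ b ]) zs (bitSymbol b ∷ l) (copied ys b h)
  ... | l′ , us , h′ , r =
    l′ , us , subst (λ w → Holds w (origin [ 0 ≔ suc (length w) ]) us) (++-assoc ys [ b ] zs) h′ ,
    runs-again refl (runs-atom (remaining l (b ∷ zs) ∷ ts))
      (subst (λ o → Runs _ (o ∷ _) _ _) (sym (remaining-right l b zs)) r)

  get-replicate : ∀ n r → get emptyTape (Vec.replicate n emptyTape) r ≡ emptyTape
  get-replicate zero    r       = refl
  get-replicate (suc n) zero    = refl
  get-replicate (suc n) (suc r) = get-replicate n r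

  module _ (x : List Bool) where
    open Registers k x hiding (Holds; holds; at)
    open CompilerCorrectness k x

    HoldsX : Store → Vec (Tape (Bool ⊎ ⊤)) k → Set
    HoldsX = Holds x

    setup-runs : ∃[ us ] Holds [] (origin [ 0 ≔ 1 ]) us ×
                 Runs setup (remaining [] x ∷ Vec.replicate k emptyTape) 1 (remaining [] x ∷ us)
    setup-runs = _ , hold , runs-atom (remaining [] x ∷ Vec.replicate k emptyTape)
      where
      hold : Holds [] (origin [ 0 ≔ 1 ])
               (Vec.zipWith act (Vec.replicate k emptyTape)
                 (Vec.tabulate {n = k} (λ i → mark , choose (toℕ i ≟ 0) right stay)))
      hold .at r r<k p
        rewrite get-act (Vec.replicate k emptyTape) (λ r → mark , choose (r ≟ 0) right stay) r r<k
              | get-replicate k r with r ≟ 0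
      hold .at r       r<k zero          | yes refl = refl
      hold .at r       r<k (suc zero)    | yes refl = refl
      hold .at r       r<k (suc (suc p)) | yes refl = refl
      hold .at zero    r<k p             | no r≢0 = contradiction refl r≢0
      hold .at (suc r) r<k zero          | no r≢0 = refl
      hold .at (suc r) r<k (suc p)       | no r≢0 = refl

    Written : Tape (Bool ⊎ ⊤) → List Bool → Set
    Written o bs = untilBlank (scanned o ∷ rights o) ≡ map inj₁ bs

    emitted : Tape (Bool ⊎ ⊤) → Bool → Tape (Bool ⊎ ⊤)
    emitted o b = write (bitSymbol b) (move left o)

    written-emitted : ∀ o b bs → Written o bs → Written (emitted o b) (b ∷ bs)
    written-emitted (tape []      a r) b bs w = cong (inj₁ b ∷_) w
    written-emitted (tape (_ ∷ l) a r) b bs w = cong (inj₁ b ∷_) w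

    B₀ B₁ : ℕ
    B₀ = length x
    B₁ = B₀ + size lenE B₀

    emit-time : ℕ
    emit-time = time bitE B₁ + (2 + (size bitE B₁ * 2 + 1))

    outputBit : ℕ → Bool
    outputBit i = positive? (⟦ bitE ⟧ x (i , tt))

    evaluated : ∀ {o ts} i → i ≤ B₁ → HoldsX (origin [ 1 ≔ i ]) ts →
                ∃[ us ] HoldsX (origin [ 1 ≔ i ] [ 2 ≔ ⟦ bitE ⟧ x (i , tt) ]) us ×
                  Runs (compile bitE (1 , tt) 2 3) (o ∷ ts) (time bitE B₁) (o ∷ us)
    evaluated {o} i i≤ h = runs s h
      where
      s : Spec (compile bitE (1 , tt) 2 3) (origin [ 1 ≔ i ]) (origin [ 1 ≔ i ] [ 2 ≔ ⟦ bitE ⟧ x (i , tt) ])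
               (time bitE B₁)
      s = spec-compile bitE
        (record
          { target   = ≤-refl
          ; nonInput = s≤s z≤n
          ; bound    = λ { zero → s≤s (s≤s z≤n) }
          ; distinct = λ { zero () }
          ; counter  = λ { zero () }
          ; values   = λ { zero → refl }
          ; rest     = refl
          ; fresh    = λ { (suc (suc j)) (s≤s (s≤s _)) → refl }
          })
        (+-monoʳ-≤ 3 (m≤n+m (room bitE) (room lenE)))
        (m≤m+n B₀ _) (λ { zero → i≤ }) (s≤s z≤n) 2<k

    unmarked : ∀ v → not (isMark (content x 2 v)) ≡ positive? v
    unmarked zero    = refl
    unmarked (suc v) = refl

    put-runs : ∀ {σ ts} o → HoldsX σ ts →
               Runs (back ⨾ put) (o ∷ ts) 2 (emitted o (positive? (σ 2)) ∷ ts)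
    put-runs {σ} {ts} o h = runs-⨾ run-back run-put
      where
      run-back : Runs back (o ∷ ts) 1 (move left o ∷ ts)
      run-back = subst (λ ws → Runs back (o ∷ ts) 1 (move left o ∷ ws)) (after-idle ts) (runs-atom (o ∷ ts))
      bit-read : not (isMark (register (Vec.map scanned ts) 2)) ≡ positive? (σ 2)
      bit-read = trans (cong (not ∘ isMark) (holds-scan h 2<k)) (unmarked (σ 2))
      run-put : Runs put (move left o ∷ ts) 1 (emitted o (positive? (σ 2)) ∷ ts)
      run-put = subst₂ (λ b ws → Runs put (move left o ∷ ts) 1 (emitted o b ∷ ws)) bit-read (after-idle ts)
                  (runs-atom (move left o ∷ ts))

    cleared : ∀ {o ts} σ → σ 2 ≤ size bitE B₁ → HoldsX σ ts →
              ∃[ us ] HoldsX (σ [ 2 ≔ 0 ]) us × Runs (clear 2) (o ∷ ts) (size bitE B₁ * 2 + 1) (o ∷ us)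
    cleared σ v≤ h = runs (spec-≤ (+-monoˡ-≤ 1 (*-monoˡ-≤ 2 v≤)) (spec-clear (σ 2) 2<k refl)) h

    emit-runs : ∀ {o ts} i → i ≤ B₁ → HoldsX (origin [ 1 ≔ i ]) ts →
                ∃[ us ] HoldsX (origin [ 1 ≔ i ]) us ×
                  Runs emit (o ∷ ts) emit-time (emitted o (outputBit i) ∷ us)
    emit-runs {o} {ts} i i≤ h = from (evaluated i i≤ h)
      where
      σ : Store
      σ = origin [ 1 ≔ i ] [ 2 ≔ ⟦ bitE ⟧ x (i , tt) ]
      forgotten : σ [ 2 ≔ 0 ] ≗ origin [ 1 ≔ i ]
      forgotten j with j ≟ 2
      ... | yes refl = refl
      ... | no _     = refl
      from : ∃[ us ] HoldsX σ us × Runs (compile bitE (1 , tt) 2 3) (o ∷ ts) (time bitE B₁) (o ∷ us) →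
             ∃[ us ] HoldsX (origin [ 1 ≔ i ]) us ×
               Runs emit (o ∷ ts) emit-time (emitted o (outputBit i) ∷ us)
      from (us , h₁ , run₁) =
        from′ (cleared σ (size-bound bitE (m≤m+n B₀ _) (λ { zero → i≤ })) h₁)
        where
        from′ : ∃[ vs ] HoldsX (σ [ 2 ≔ 0 ]) vs ×
                  Runs (clear 2) (emitted o (outputBit i) ∷ us) (size bitE B₁ * 2 + 1)
                       (emitted o (outputBit i) ∷ vs) → _
        from′ (vs , h₂ , run₂) = vs , holds-≗ forgotten h₂ , runs-⨾ run₁ (runs-⨾ (put-runs o h₁) run₂)

    -- `bs` is the tail that is already on the tape; each round puts one bit in front of it.
    output-runs : ∀ n {o ts} bs → n ≤ size lenE B₀ → HoldsX (origin [ 1 ≔ n ]) ts → Written o bs →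
                  ∃[ o′ ] ∃[ us ] Written o′ (applyUpTo outputBit n ++ bs) ×
                    Runs (repeat 1 emit) (o ∷ ts) (n * (2 + emit-time) + 1) (o′ ∷ us)
    output-runs zero    {o} {ts} bs n≤ h w =
      o , ts , w , runs-done (trans (cong (not ∘ isMark) (holds-scan h 1<k)) refl)
    output-runs (suc n) {o} {ts} bs n≤ h w
      with spec-dec {σ = origin [ 1 ≔ suc n ]} 1<k refl .runs {o} h
    ... | ts₁ , h₁ , run₁
      with emit-runs {o} n (≤-trans (<⇒≤ n≤) (m≤n+m _ B₀)) (holds-≗ decremented h₁)
      where
      decremented : origin [ 1 ≔ suc n ] [ 1 ≔ n ] ≗ origin [ 1 ≔ n ]
      decremented j with j ≟ 1
      ... | yes _ = refl
      ... | no _  = refl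
    ... | ts₂ , h₂ , run₂
      with output-runs n (outputBit n ∷ bs) (<⇒≤ n≤) h₂ (written-emitted o (outputBit n) bs w)
    ... | o′ , us , w′ , run₃ =
      o′ , us , subst (Written o′) shifted w′ ,
      runs-≤ (≤-reflexive (sym (+-assoc (2 + emit-time) (n * (2 + emit-time)) 1)))
        (runs-again (trans (cong (not ∘ isMark) (holds-scan h 1<k)) refl) (runs-⨾ run₁ run₂) run₃)
      where
      shifted : applyUpTo outputBit n ++ outputBit n ∷ bs ≡ applyUpTo outputBit (suc n) ++ bs
      shifted = trans (sym (++-assoc (applyUpTo outputBit n) [ outputBit n ] bs))
                      (cong (_++ bs) (applyUpTo-∷ʳ outputBit n))

    total : ℕ
    total = 1 + ((B₀ * 2 + 1) + ((suc B₀ * 2 + 1) + (time lenE B₀ + (size lenE B₀ * (2 + emit-time) + 1))))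

    outputLength : ℕ
    outputLength = ⟦ lenE ⟧ x tt

    size≤ : outputLength ≤ size lenE B₀
    size≤ = size-bound lenE ≤-refl (λ ())

    σ₀ σ₁ σ₂ : Store
    σ₀ = origin [ 0 ≔ suc B₀ ]
    σ₁ = σ₀ [ 0 ≔ 0 ]
    σ₂ = σ₁ [ 1 ≔ outputLength ]

    rewound : Spec (clear 0) σ₀ σ₁ (suc B₀ * 2 + 1)
    rewound = spec-clear (suc B₀) (s≤s z≤n) refl

    measured : Spec (compile lenE tt 1 2) σ₁ σ₂ (time lenE B₀)
    measured = spec-compile lenE
      (record
        { target   = ≤-refl
        ; nonInput = s≤s z≤n
        ; bound    = λ ()
        ; distinct = λ ()
        ; counter  = λ ()
        ; values   = λ ()
        ; rest     = refl
        ; fresh    = λ { (suc (suc j)) (s≤s (s≤s _)) → refl }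
        })
      (+-mono-≤ (n≤1+n 2) (m≤m+n (room lenE) (room bitE))) ≤-refl (λ ()) (s≤s z≤n) 1<k

    all-output : ∀ {o ts} → HoldsX σ₂ ts → Written o [] →
                 ∃[ o′ ] ∃[ us ] Written o′ (generated lenE bitE x) ×
                   Runs (repeat 1 emit) (o ∷ ts) (size lenE B₀ * (2 + emit-time) + 1) (o′ ∷ us)
    all-output {o} {ts} h w = finish (output-runs outputLength [] size≤ (holds-≗ only h) w)
      where
      only : σ₂ ≗ origin [ 1 ≔ outputLength ]
      only zero          = refl
      only (suc zero)    = refl
      only (suc (suc j)) = refl
      finish : ∃[ o′ ] ∃[ us ] Written o′ (applyUpTo outputBit outputLength ++ []) ×
                 Runs (repeat 1 emit) (o ∷ ts) (outputLength * (2 + emit-time) + 1) (o′ ∷ us) →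
               ∃[ o′ ] ∃[ us ] Written o′ (generated lenE bitE x) ×
                 Runs (repeat 1 emit) (o ∷ ts) (size lenE B₀ * (2 + emit-time) + 1) (o′ ∷ us)
      finish (o′ , us , w′ , run) =
        o′ , us , trans w′ (cong (map inj₁) (++-identityʳ _)) ,
        runs-≤ (+-monoˡ-≤ 1 (*-monoˡ-≤ (2 + emit-time) size≤)) run

    Final : Block → Memory → ℕ → Set
    Final b ts t = ∃[ o ] ∃[ us ] Written o (generated lenE bitE x) × Runs b ts t (o ∷ us)

    final-⨾ : ∀ {b c ts m us m′} → Runs b ts m us → Final c us m′ → Final (b ⨾ c) ts (m + m′)
    final-⨾ run (o , vs , w , run′) = o , vs , w , runs-⨾ run run′

    from-measured : ∀ {o ts} → HoldsX σ₁ ts → Written o [] →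
                    Final (compile lenE tt 1 2 ⨾ repeat 1 emit) (o ∷ ts)
                          (time lenE B₀ + (size lenE B₀ * (2 + emit-time) + 1))
    from-measured {o} {ts} h w = from (runs measured h)
      where
      from : ∃[ us ] HoldsX σ₂ us × Runs (compile lenE tt 1 2) (o ∷ ts) (time lenE B₀) (o ∷ us) →
             Final (compile lenE tt 1 2 ⨾ repeat 1 emit) (o ∷ ts)
                   (time lenE B₀ + (size lenE B₀ * (2 + emit-time) + 1))
      from (us , h′ , run) = final-⨾ run (all-output h′ w)

    from-copied : ∀ {o ts} → HoldsX σ₀ ts → Written o [] →
                  Final (clear 0 ⨾ compile lenE tt 1 2 ⨾ repeat 1 emit) (o ∷ ts)
                        ((suc B₀ * 2 + 1) + (time lenE B₀ + (size lenE B₀ * (2 + emit-time) + 1)))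
    from-copied {o} {ts} h w = from (runs rewound h)
      where
      from : ∃[ us ] HoldsX σ₁ us × Runs (clear 0) (o ∷ ts) (suc B₀ * 2 + 1) (o ∷ us) →
             Final (clear 0 ⨾ compile lenE tt 1 2 ⨾ repeat 1 emit) (o ∷ ts)
                   ((suc B₀ * 2 + 1) + (time lenE B₀ + (size lenE B₀ * (2 + emit-time) + 1)))
      from (us , h′ , run) = final-⨾ run (from-measured h′ w)

    from-setup : ∀ {ts} → Holds [] (origin [ 0 ≔ 1 ]) ts →
                 Final (loop unread copyBit ⨾ clear 0 ⨾ compile lenE tt 1 2 ⨾ repeat 1 emit) (remaining [] x ∷ ts)
                   ((B₀ * 2 + 1) + ((suc B₀ * 2 + 1) + (time lenE B₀ + (size lenE B₀ * (2 + emit-time) + 1))))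
    from-setup {ts} h = from (copy-runs [] x [] h)
      where
      from : ∃[ l ] ∃[ us ] HoldsX σ₀ us ×
               Runs (loop unread copyBit) (remaining [] x ∷ ts) (B₀ * 2 + 1) (tape l blank [] ∷ us) →
             Final (loop unread copyBit ⨾ clear 0 ⨾ compile lenE tt 1 2 ⨾ repeat 1 emit) (remaining [] x ∷ ts)
               ((B₀ * 2 + 1) + ((suc B₀ * 2 + 1) + (time lenE B₀ + (size lenE B₀ * (2 + emit-time) + 1))))
      from (l , us , h , run) = final-⨾ run (from-copied h refl)

    from-start : ∀ {ts us} → Holds [] (origin [ 0 ≔ 1 ]) us →
                 Runs setup (remaining [] x ∷ ts) 1 (remaining [] x ∷ us) →
                 Final program (remaining [] x ∷ ts) total
    from-start h run = final-⨾ {setup} {m = 1} run (from-setup h)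

    program-runs : Final program (remaining [] x ∷ Vec.replicate k emptyTape) total
    program-runs = from-start (proj₁ (proj₂ setup-runs)) (proj₂ (proj₂ setup-runs))

  total-poly : IsPolynomial (λ B → 1 + ((B * 2 + 1) + ((suc B * 2 + 1) + (time lenE B +
                 (size lenE B * (2 + (time bitE (B + size lenE B) +
                   (2 + (size bitE (B + size lenE B) * 2 + 1)))) + 1)))))
  total-poly =
    1+ (poly-+ (poly-+ (poly-* poly-id (poly-const 2)) (poly-const 1))
      (poly-+ (poly-+ (poly-* (1+ poly-id) (poly-const 2)) (poly-const 1))
        (poly-+ (time-poly lenE)
          (poly-+ (poly-* (size-poly lenE)
                    (1+ (1+ (poly-+ (poly-∘ (time-poly bitE) bound)
                      (1+ (1+ (poly-+ (poly-* (poly-∘ (size-poly bitE) bound) (poly-const 2)) (poly-const 1))))))))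
                  (poly-const 1)))))
    where
    1+ : ∀ {f} → IsPolynomial f → IsPolynomial (λ B → suc (f B))
    1+ = poly-+ (poly-const 1)
    bound : IsPolynomial (λ B → B + size lenE B)
    bound = poly-+ poly-id (size-poly lenE)

  polyTime : PolyTime (generated lenE bitE)
  polyTime = toMachine program , coefficients total-poly , λ x → result x (program-runs x)
    where
    open Run (toMachine program)
    starts : ∀ x → initial x ≡ config (inj₂ (entry program)) (remaining [] x ∷ Vec.replicate k emptyTape)
    starts []      = refl
    starts (b ∷ x) = refl
    result : ∀ x → (∃[ o ] ∃[ us ] Written x o (generated lenE bitE x) ×
                     Runs program (remaining [] x ∷ Vec.replicate k emptyTape) (total x) (o ∷ us)) →
             ∃[ t ] ∃[ c ] initial x ⇓[ t ] c × t ≤ eval (coefficients total-poly) (length x) ×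
               Outputs c (generated lenE bitE x)
    result x (o , us , w , t , t≤ , run) =
      t , config (inj₁ tt) (o ∷ us) ,
      subst (λ c → c ⇓[ t ] config (inj₁ tt) (o ∷ us)) (sym (starts x)) (exec-machine program run) ,
      ≤-trans t≤ (≤-reflexive (sym (evaluates total-poly (length x)))) , w

-- Definable functions and predicates

rename : (Fin n → Fin m) → Expr n → Expr m
rename θ (var i)     = var (θ i)
rename θ one         = one
rename θ len         = len
rename θ (bit e)     = bit (rename θ e)
rename θ (plus a b)  = plus (rename θ a) (rename θ b)
rename θ (monus a b) = monus (rename θ a) (rename θ b)
rename θ (sum a b)   = sum (rename θ a) (rename (λ { zero → zero ; (suc i) → suc (θ i) }) b)

Σ<-cong : ∀ n {f g} → (∀ i → i < n → f i ≡ g i) → Σ< n f ≡ Σ< n g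
Σ<-cong zero    f≗g = refl
Σ<-cong (suc n) f≗g = cong₂ _+_ (f≗g n ≤-refl) (Σ<-cong n (λ i i<n → f≗g i (m<n⇒m<1+n i<n)))

rename-⟦⟧ : ∀ (θ : Fin n → Fin m) e x {ρ η} → (∀ i → valueAt η (θ i) ≡ valueAt ρ i) →
            ⟦ rename θ e ⟧ x η ≡ ⟦ e ⟧ x ρ
rename-⟦⟧ θ (var i)     x eq = eq i
rename-⟦⟧ θ one         x eq = refl
rename-⟦⟧ θ len         x eq = refl
rename-⟦⟧ θ (bit e)     x eq = cong (λ v → ⌜ bitAt x v ⌝) (rename-⟦⟧ θ e x eq)
rename-⟦⟧ θ (plus a b)  x eq = cong₂ _+_ (rename-⟦⟧ θ a x eq) (rename-⟦⟧ θ b x eq)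
rename-⟦⟧ θ (monus a b) x eq = cong₂ _∸_ (rename-⟦⟧ θ a x eq) (rename-⟦⟧ θ b x eq)
rename-⟦⟧ θ (sum a b)   x {ρ} {η} eq
  rewrite rename-⟦⟧ θ a x eq
  = Σ<-cong (⟦ a ⟧ x ρ) λ i _ → rename-⟦⟧ _ b x λ { zero → refl ; (suc j) → eq j }

record Computable (f : List Bool → Env n → ℕ) : Set where
  constructor computes
  field
    expr  : Expr n
    value : ∀ x ρ → ⟦ expr ⟧ x ρ ≡ f x ρ

open Computable public

-- Truth values are exactly 0 or 1, so that the connectives become truncated arithmetic: `1 ∸ v` for
-- negation, `v + w ∸ 1` for conjunction, `1 ∸ (v ∸ w)` for implication.
data Truth (P : Set) : ℕ → Set where
  holds-true  : P → Truth P 1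
  holds-false : ¬ P → Truth P 0

record Definable (P : List Bool → Env n → Set) : Set where
  constructor defines
  field
    formula : Expr n
    truth   : ∀ x ρ → Truth (P x ρ) (⟦ formula ⟧ x ρ)

open Definable public

wkᶜ : {f : List Bool → Env n → ℕ} → Computable f → Computable (λ x (ρ : Env (suc n)) → f x (proj₂ ρ))
wkᶜ (computes e v) = computes (rename suc e) λ x ρ → trans (rename-⟦⟧ suc e x (λ _ → refl)) (v x (proj₂ ρ))

varᶜ : (i : Fin n) → Computable {n} (λ x ρ → valueAt ρ i)
varᶜ i = computes (var i) λ _ _ → refl

lenᶜ : Computable {n} (λ x ρ → length x)
lenᶜ = computes len λ _ _ → refl

infixl 7 _*ᶜ_
infixl 6 _+ᶜ_ _∸ᶜ_
infix  4 _≤ᵈ_ _<ᵈ_ _≡ᵈ_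
infix  3 ¬ᵈ_
infixr 2 _×ᵈ_
infixr 1 _⊎ᵈ_ _→ᵈ_

_+ᶜ_ : {f g : List Bool → Env n → ℕ} → Computable f → Computable g → Computable (λ x ρ → f x ρ + g x ρ)
computes a u +ᶜ computes b v = computes (plus a b) λ x ρ → cong₂ _+_ (u x ρ) (v x ρ)

_∸ᶜ_ : {f g : List Bool → Env n → ℕ} → Computable f → Computable g → Computable (λ x ρ → f x ρ ∸ g x ρ)
computes a u ∸ᶜ computes b v = computes (monus a b) λ x ρ → cong₂ _∸_ (u x ρ) (v x ρ)

sumᶜ : {f : List Bool → Env n → ℕ} {g : List Bool → Env (suc n) → ℕ} → Computable f → Computable g →
       Computable (λ x ρ → Σ< (f x ρ) (λ i → g x (i , ρ)))
sumᶜ {f = f} (computes a u) (computes b v) = computes (sum a b) λ x ρ →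
  trans (cong (λ k → Σ< k _) (u x ρ)) (Σ<-cong (f x ρ) (λ i _ → v x (i , ρ)))

Σ<-const : ∀ n c → Σ< n (λ _ → c) ≡ n * c
Σ<-const zero    c = refl
Σ<-const (suc n) c = cong (c +_) (Σ<-const n c)

_*ᶜ_ : {f g : List Bool → Env n → ℕ} → Computable f → Computable g → Computable (λ x ρ → f x ρ * g x ρ)
_*ᶜ_ {f = f} {g} a b = computes (expr s) λ x ρ → trans (value s x ρ) (Σ<-const (f x ρ) (g x ρ))
  where s = sumᶜ a (wkᶜ b)

constᶜ : ∀ c → Computable {n} (λ x ρ → c)
constᶜ zero    = computes (monus one one) λ _ _ → refl
constᶜ (suc c) = computes one (λ _ _ → refl) +ᶜ constᶜ c

sucᶜ : {f : List Bool → Env n → ℕ} → Computable f → Computable (λ x ρ → suc (f x ρ))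
sucᶜ a = constᶜ 1 +ᶜ a

evalᶜ : ∀ p {f : List Bool → Env n → ℕ} → Computable f → Computable (λ x ρ → eval p (f x ρ))
evalᶜ []      a = constᶜ 0
evalᶜ (c ∷ p) a = constᶜ c +ᶜ a *ᶜ evalᶜ p a

bitᵈ : {f : List Bool → Env n → ℕ} → Computable f → Definable (λ x ρ → T (bitAt x (f x ρ)))
bitᵈ (computes a u) = defines (bit a) λ x ρ →
  subst (λ v → Truth (T (bitAt x v)) ⌜ bitAt x (⟦ a ⟧ x ρ) ⌝) (u x ρ) (bit-truth (bitAt x (⟦ a ⟧ x ρ)))
  where
  bit-truth : ∀ b → Truth (T b) ⌜ b ⌝
  bit-truth false = holds-false id
  bit-truth true  = holds-true tt

⇔ᵈ : {P Q : List Bool → Env n → Set} → (∀ x ρ → P x ρ → Q x ρ) → (∀ x ρ → Q x ρ → P x ρ) →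
     Definable P → Definable Q
⇔ᵈ to from (defines e t) = defines e λ x ρ → case-truth (to x ρ) (from x ρ) (t x ρ)
  where
  case-truth : ∀ {P Q v} → (P → Q) → (Q → P) → Truth P v → Truth Q v
  case-truth to from (holds-true p)   = holds-true (to p)
  case-truth to from (holds-false ¬p) = holds-false (¬p ∘ from)

¬ᵈ_ : {P : List Bool → Env n → Set} → Definable P → Definable (λ x ρ → ¬ P x ρ)
¬ᵈ defines e t = defines (monus one e) λ x ρ → negate (t x ρ)
  where
  negate : ∀ {P v} → Truth P v → Truth (¬ P) (1 ∸ v)
  negate (holds-true p)   = holds-false (λ ¬p → ¬p p)
  negate (holds-false ¬p) = holds-true ¬p

_×ᵈ_ : {P Q : List Bool → Env n → Set} → Definable P → Definable Q → Definable (λ x ρ → P x ρ × Q x ρ)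
defines a t ×ᵈ defines b u = defines (monus (plus a b) one) λ x ρ → both (t x ρ) (u x ρ)
  where
  both : ∀ {P Q v w} → Truth P v → Truth Q w → Truth (P × Q) (v + w ∸ 1)
  both (holds-true p)   (holds-true q)   = holds-true (p , q)
  both (holds-true p)   (holds-false ¬q) = holds-false (¬q ∘ proj₂)
  both (holds-false ¬p) (holds-true q)   = holds-false (¬p ∘ proj₁)
  both (holds-false ¬p) (holds-false ¬q) = holds-false (¬p ∘ proj₁)

_⊎ᵈ_ : {P Q : List Bool → Env n → Set} → Definable P → Definable Q → Definable (λ x ρ → P x ρ ⊎ Q x ρ)
defines a t ⊎ᵈ defines b u = defines (monus one (monus one (plus a b))) λ x ρ → either (t x ρ) (u x ρ)
  where
  either : ∀ {P Q v w} → Truth P v → Truth Q w → Truth (P ⊎ Q) (1 ∸ (1 ∸ (v + w)))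
  either (holds-true p)   (holds-true _)   = holds-true (inj₁ p)
  either (holds-true p)   (holds-false _)  = holds-true (inj₁ p)
  either (holds-false ¬p) (holds-true q)   = holds-true (inj₂ q)
  either (holds-false ¬p) (holds-false ¬q) = holds-false λ { (inj₁ p) → ¬p p ; (inj₂ q) → ¬q q }

_→ᵈ_ : {P Q : List Bool → Env n → Set} → Definable P → Definable Q → Definable (λ x ρ → P x ρ → Q x ρ)
defines a t →ᵈ defines b u = defines (monus one (monus a b)) λ x ρ → implies (t x ρ) (u x ρ)
  where
  implies : ∀ {P Q v w} → Truth P v → Truth Q w → Truth (P → Q) (1 ∸ (v ∸ w))
  implies (holds-true p)   (holds-true q)   = holds-true λ _ → q
  implies (holds-true p)   (holds-false ¬q) = holds-false λ f → ¬q (f p)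
  implies (holds-false ¬p) (holds-true q)   = holds-true λ _ → q
  implies (holds-false ¬p) (holds-false ¬q) = holds-true λ p → ⊥-elim (¬p p)

_≤ᵈ_ : {f g : List Bool → Env n → ℕ} → Computable f → Computable g → Definable (λ x ρ → f x ρ ≤ g x ρ)
_≤ᵈ_ {f = f} {g = g} (computes a u) (computes b v) = defines (monus one (monus a b)) λ x ρ →
  subst₂ (λ k l → Truth (f x ρ ≤ g x ρ) (1 ∸ (k ∸ l))) (sym (u x ρ)) (sym (v x ρ)) (compare-≤ (f x ρ) (g x ρ))
  where
  compare-≤ : ∀ k l → Truth (k ≤ l) (1 ∸ (k ∸ l))
  compare-≤ zero    zero    = holds-true z≤n
  compare-≤ zero    (suc l) = holds-true z≤n
  compare-≤ (suc k) zero    rewrite 0∸n≡0 k = holds-false λ ()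
  compare-≤ (suc k) (suc l) with 1 ∸ (k ∸ l) | compare-≤ k l
  ... | _ | holds-true k≤l  = holds-true (s≤s k≤l)
  ... | _ | holds-false k≰l = holds-false λ { (s≤s k≤l) → k≰l k≤l }

_<ᵈ_ : {f g : List Bool → Env n → ℕ} → Computable f → Computable g → Definable (λ x ρ → f x ρ < g x ρ)
a <ᵈ b = sucᶜ a ≤ᵈ b

_≡ᵈ_ : {f g : List Bool → Env n → ℕ} → Computable f → Computable g → Definable (λ x ρ → f x ρ ≡ g x ρ)
a ≡ᵈ b = ⇔ᵈ (λ _ _ (p , q) → ≤-antisym p q) (λ _ _ e → ≤-reflexive e , ≤-reflexive (sym e)) ((a ≤ᵈ b) ×ᵈ (b ≤ᵈ a))

Some All : ℕ → (ℕ → Set) → Set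
Some n P = Σ[ i ∈ ℕ ] i < n × P i
All  n P = ∀ i → i < n → P i

-- A sum of truth values counts witnesses. Only its being positive matters, and `capped` brings it
-- back to 0 or 1.
data Count (P : Set) : ℕ → Set where
  some : ∀ {k} → P → Count P (suc k)
  none : ¬ P → Count P 0

capped : ∀ {P v} → Count P v → Truth P (1 ∸ (1 ∸ v))
capped (some {k} p) rewrite 0∸n≡0 k = holds-true p
capped (none ¬p)    = holds-false ¬p

someᵈ : {f : List Bool → Env n → ℕ} {P : List Bool → Env (suc n) → Set} → Computable f → Definable P →
        Definable (λ x ρ → Some (f x ρ) (λ i → P x (i , ρ)))
someᵈ {n} {f} {P} a (defines e t) = defines (monus one (monus one (expr s))) λ x ρ →
  subst (λ v → Truth (Some (f x ρ) (λ i → P x (i , ρ))) (1 ∸ (1 ∸ v))) (sym (value s x ρ))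
    (capped (search (f x ρ) (λ i → t x (i , ρ))))
  where
  s : Computable (λ x ρ → Σ< (f x ρ) (λ i → ⟦ e ⟧ x (i , ρ)))
  s = sumᶜ a (computes e λ _ _ → refl)
  search : ∀ n {P : ℕ → Set} {g} → (∀ i → Truth (P i) (g i)) → Count (Some n P) (Σ< n g)
  search zero    t = none λ ()
  search (suc n) {P} {g} t with g n | t n | Σ< n g | search n {P} {g} t
  ... | _ | holds-true p   | _ | _                    = some (n , ≤-refl , p)
  ... | _ | holds-false ¬p | _ | some (i , i<n , p)   = some (i , m<n⇒m<1+n i<n , p)
  ... | _ | holds-false ¬p | _ | none ¬q              = none λ (i , i<1+n , p) → last i i<1+n p
    where
    last : ∀ i → i < suc n → P i → ⊥
    last i i<1+n p with i ≟ n
    ... | yes refl = ¬p p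
    ... | no i≢n   = ¬q (i , ≤∧≢⇒< (≤-pred i<1+n) i≢n , p)

-- The quantifier is expressed as "no counterexample". This is constructively sound because a
-- definable predicate is decided by its formula, hence stable under double negation.
allᵈ : {f : List Bool → Env n → ℕ} {P : List Bool → Env (suc n) → Set} → Computable f → Definable P →
       Definable (λ x ρ → All (f x ρ) (λ i → P x (i , ρ)))
allᵈ {f = f} {P} a d = ⇔ᵈ (λ x ρ ¬some i i< → stable x (i , ρ) λ ¬p → ¬some (i , i< , ¬p))
                          (λ x ρ all (i , i< , ¬p) → ¬p (all i i<))
                          (¬ᵈ someᵈ a (¬ᵈ d))
  where
  stable : ∀ x ρ → ¬ ¬ P x ρ → P x ρ
  stable x ρ ¬¬p with truth d x ρ
  ... | t = decide t
    where
    decide : ∀ {v} → Truth (P x ρ) v → P x ρ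
    decide (holds-true p)   = p
    decide (holds-false ¬p) = contradiction ¬p ¬¬p

v₀ : Computable {suc n} (λ x ρ → proj₁ ρ)
v₀ = varᶜ zero
v₁ : Computable {suc (suc n)} (λ x ρ → proj₁ (proj₂ ρ))
v₁ = wkᶜ v₀
v₂ : Computable {3 + n} (λ x ρ → proj₁ (proj₂ (proj₂ ρ)))
v₂ = wkᶜ v₁
v₃ : Computable {4 + n} (λ x ρ → proj₁ (proj₂ (proj₂ (proj₂ ρ))))
v₃ = wkᶜ v₂
v₄ : Computable {5 + n} (λ x ρ → proj₁ (proj₂ (proj₂ (proj₂ (proj₂ ρ)))))
v₄ = wkᶜ v₃
v₅ : Computable {6 + n} (λ x ρ → proj₁ (proj₂ (proj₂ (proj₂ (proj₂ (proj₂ ρ))))))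
v₅ = wkᶜ v₄

-- Makes every function on a bounded range definable; it is 0 from d on.
table : ℕ → (ℕ → ℕ) → ℕ → ℕ
table zero    F i = 0
table (suc d) F i = F d * (1 ∸ ((i ∸ d) + (d ∸ i))) + table d F i

-- The factor `1 ∸ ((i ∸ d) + (d ∸ i))` of a table entry is 1 if i = d and 0 otherwise; for larger i
-- every factor vanishes.
table-≥ : ∀ d F i → d ≤ i → table d F i ≡ 0
table-≥ zero    F i d≤i = refl
table-≥ (suc d) F i d<i
  rewrite m≤n⇒m∸n≡0 (≤-trans (m<n⇒0<n∸m d<i) (m≤m+n (i ∸ d) (d ∸ i))) | *-zeroʳ (F d)
  = table-≥ d F i (<⇒≤ d<i)

table-< : ∀ d F i → i < d → table d F i ≡ F i
table-< (suc d) F i i<1+d with i ≟ d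
... | yes refl rewrite n∸n≡0 i | table-≥ i F i ≤-refl | *-identityʳ (F i) = +-identityʳ (F i)
... | no i≢d
  rewrite m≤n⇒m∸n≡0 (≤-trans (m<n⇒0<n∸m (≤∧≢⇒< (≤-pred i<1+d) i≢d)) (m≤n+m (d ∸ i) (i ∸ d))) | *-zeroʳ (F d)
  = table-< d F i (≤∧≢⇒< (≤-pred i<1+d) i≢d)

tableᶜ : ∀ d F {f : List Bool → Env n → ℕ} → Computable f → Computable (λ x ρ → table d F (f x ρ))
tableᶜ zero    F a = constᶜ 0
tableᶜ (suc d) F a = constᶜ (F d) *ᶜ (constᶜ 1 ∸ᶜ ((a ∸ᶜ constᶜ d) +ᶜ (constᶜ d ∸ᶜ a))) +ᶜ tableᶜ d F a

bitAt-applyUpTo : ∀ g n {i} → i < n → bitAt (applyUpTo g n) i ≡ g i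
bitAt-applyUpTo g (suc n) {zero}  _         = refl
bitAt-applyUpTo g (suc n) {suc i} (s≤s i<n) = bitAt-applyUpTo (g ∘ suc) n i<n

positive-truth : ∀ {P v} → Truth P v → T (positive? v) ⇔ P
positive-truth (holds-true p)   = mk⇔ (λ _ → p) (λ _ → tt)
positive-truth (holds-false ¬p) = mk⇔ (λ ()) (λ p → ¬p p)

-- What the reduction needs to know of the machines: a length and a predicate on positions determine
-- a word that is printed in polynomial time.
record Tabulation (ℓ : List Bool → ℕ) (P : List Bool → ℕ → Set) : Set₁ where
  field
    output    : List Bool → List Bool
    poly-time : PolyTime output
    length-≡  : ∀ x → length (output x) ≡ ℓ x
    bits      : ∀ x i → i < ℓ x → T (bitAt (output x) i) ⇔ P x i

tabulation : ∀ {ℓ : List Bool → ℕ} {P : List Bool → ℕ → Set} →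
             Computable {0} (λ x ρ → ℓ x) → Definable {1} (λ x ρ → P x (proj₁ ρ)) → Tabulation ℓ P
tabulation {ℓ} {P} (computes a u) (defines b t) = record
  { output    = generated a b
  ; poly-time = Generator.polyTime a b
  ; length-≡  = λ x → trans (length-applyUpTo (bit-of x) (⟦ a ⟧ x tt)) (u x tt)
  ; bits      = λ x i i< →
      subst (λ c → T c ⇔ P x i) (sym (bitAt-applyUpTo (bit-of x) (⟦ a ⟧ x tt) (subst (i <_) (sym (u x tt)) i<)))
        (positive-truth (t x (i , tt)))
  }
  where
  bit-of : List Bool → ℕ → Bool
  bit-of x i = positive? (⟦ b ⟧ x (i , tt))

record Decision (P : List Bool → Set) : Set₁ where
  field
    decide    : List Bool → Bool
    decidable : PolyTimeDecidable decide
    correct   : ∀ x → decide x ≡ true ⇔ P x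

-- An answer is an output word of length 1, so the variable for the position of the output bit takes
-- the value 0.
decision : ∀ {P : List Bool → Set} → Definable {1} (λ x ρ → P x) → Decision P
decision {P} (defines b t) = record
  { decide    = λ x → positive? (⟦ b ⟧ x (0 , tt))
  ; decidable = Generator.polyTime one b
  ; correct   = λ x → reflect (positive-truth (t x (0 , tt)))
  }
  where
  reflect : ∀ {b Q} → T b ⇔ Q → b ≡ true ⇔ Q
  reflect {true}  e = mk⇔ (λ _ → Equivalence.to e tt) (λ _ → refl)
  reflect {false} e = mk⇔ (λ ()) (λ q → ⊥-elim (Equivalence.from e q))

-- Mixed radix numbers

module _ {d} .{{_ : NonZero d}} where

  radix-% : ∀ {a} h → a < d → (a + h * d) % d ≡ a
  radix-% {a} h a<d = trans ([m+kn]%n≡m%n a h d) (m<n⇒m%n≡m a<d)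

  radix-/ : ∀ {a} h → a < d → (a + h * d) / d ≡ h
  radix-/ {a} h a<d = trans (+-distrib-/-∣ʳ a (n∣m*n h)) (cong₂ _+_ (m<n⇒m/n≡0 a<d) (m*n/n≡m h d))

radix-unique : ∀ {d a b} h k → a < d → b < d → a + h * d ≡ b + k * d → a ≡ b × h ≡ k
radix-unique {suc d} h k a<d b<d eq =
  trans (sym (radix-% h a<d)) (trans (cong (_% suc d) eq) (radix-% k b<d)) ,
  trans (sym (radix-/ h a<d)) (trans (cong (_/ suc d) eq) (radix-/ k b<d))

radix-exists : ∀ {i} k d → i < k * d → Σ[ a ∈ ℕ ] Σ[ h ∈ ℕ ] a < d × h < k × i ≡ a + h * d
radix-exists {i} k zero    i<kd rewrite *-zeroʳ k = contradiction i<kd λ ()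
radix-exists {i} k (suc d) i<kd =
  i % suc d , i / suc d , m%n<n i (suc d) , m<n*o⇒m/o<n {i} {k} {suc d} i<kd , m≡m%n+[m/n]*n i (suc d)

radix-< : ∀ {a h k d} → a < d → h < k → a + h * d < k * d
radix-< {a} {h} {k} {d} a<d h<k = <-≤-trans (+-monoˡ-< (h * d) a<d) (*-monoˡ-≤ d h<k)

-- Finite alphabets

record Code (A : Set) : Set where
  field
    card        : ℕ
    code        : A → Fin card
    decode      : Fin card → A
    decode-code : ∀ a → decode (code a) ≡ a

open Code public

finite⇒code : Finite A → Code A
finite⇒code (n , f) = record
  { card = n ; code = Inverse.to f ; decode = Inverse.from f ; decode-code = Inverse.strictlyInverseʳ f }

code-Bool : Code Bool
code-Bool = record
  { card = 2
  ; code = λ { false → zero ; true → suc zero }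
  ; decode = λ { zero → false ; (suc zero) → true }
  ; decode-code = λ { false → refl ; true → refl }
  }

code-Maybe : Code A → Code (Maybe A)
code-Maybe a = record
  { card = suc (card a)
  ; code = λ { nothing → zero ; (just x) → suc (code a x) }
  ; decode = λ { zero → nothing ; (suc i) → just (decode a i) }
  ; decode-code = λ { nothing → refl ; (just x) → cong just (decode-code a x) }
  }

code-⊎ : Code A → Code B → Code (A ⊎ B)
code-⊎ {A} {B} a b = record
  { card = card a + card b
  ; code = λ { (inj₁ x) → code a x Fin.↑ˡ card b ; (inj₂ y) → card a Fin.↑ʳ code b y }
  ; decode = λ i → back (Fin.splitAt (card a) i)
  ; decode-code = λ
      { (inj₁ x) → trans (cong back (Fin.splitAt-↑ˡ (card a) (code a x) (card b))) (cong inj₁ (decode-code a x))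
      ; (inj₂ y) → trans (cong back (Fin.splitAt-↑ʳ (card a) (card b) (code b y))) (cong inj₂ (decode-code b y)) }
  }
  where
  back : Fin (card a) ⊎ Fin (card b) → A ⊎ B
  back (inj₁ i) = inj₁ (decode a i)
  back (inj₂ j) = inj₂ (decode b j)

code-× : Code A → Code B → Code (A × B)
code-× {A} {B} a b = record
  { card = card a * card b
  ; code = λ (x , y) → Fin.combine (code a x) (code b y)
  ; decode = λ i → back (Fin.remQuot (card b) i)
  ; decode-code = λ (x , y) → trans (cong back (Fin.remQuot-combine (code a x) (code b y)))
                                     (cong₂ _,_ (decode-code a x) (decode-code b y))
  }
  where
  back : Fin (card a) × Fin (card b) → A × B
  back (i , j) = decode a i , decode b j

code-Vec : Code A → ∀ n → Code (Vec A n)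
code-Vec a zero = record
  { card = 1 ; code = λ _ → zero ; decode = λ _ → [] ; decode-code = λ { [] → refl } }
code-Vec {A} a (suc n) = record
  { card = card ab
  ; code = λ { (x ∷ xs) → code ab (x , xs) }
  ; decode = λ i → cons (decode ab i)
  ; decode-code = λ { (x ∷ xs) → cong cons (decode-code ab (x , xs)) }
  }
  where
  ab : Code (A × Vec A n)
  ab = code-× a (code-Vec a n)
  cons : A × Vec A n → Vec A (suc n)
  cons (x , xs) = x ∷ xs

number : (a : Code A) → A → ℕ
number a x = toℕ (code a x)

number-< : ∀ (a : Code A) x → number a x < card a
number-< a x = Fin.toℕ<n (code a x)

-- Numbers above the cardinality are read as an arbitrary letter.
letter : Code A → A → ℕ → A
letter a x i with i <? card a
... | yes i< = decode a (fromℕ< i<)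
... | no _   = x

letter-number : ∀ (a : Code A) x y → letter a x (number a y) ≡ y
letter-number a x y with number a y <? card a
... | yes i< = trans (cong (decode a) (Fin.fromℕ<-toℕ (code a y) i<)) (decode-code a y)
... | no i≮  = contradiction (number-< a y) i≮

-- Propositional clauses

-- Variables are below n, clauses below m; clause 0 is ignored.
Satisfiable : ℕ → ℕ → (Bool → ℕ → ℕ → Set) → Set
Satisfiable n m Lit =
  Σ[ σ ∈ (ℕ → Bool) ] (∀ j → 0 < j → j < m → Some n (λ i → Lit (σ i) i j))

-- The tableau of a computation, in the frame of the heads

module Frame (M : TuringMachine) where
  open TuringMachine M hiding (state-finite; marker-finite)
  open Run M renaming (next to advance; step to transition)

  Sym : Set
  Sym = Maybe Letter

  Column : Set
  Column = State × Vec Sym tapes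

  -- All tapes are aligned at their heads, which stand at `W` in every row: a move shifts the tape
  -- instead of the head, so head positions need no encoding. Every column repeats the state, which
  -- makes column `W` sufficient to determine the transition.
  column : ℕ → Configuration → ℕ → Column
  column W (config q ts) p = q , Vec.map (λ t → cell W t p) ts

  -- A halted configuration is repeated, so every row beyond the running time shows the final
  -- configuration.
  follow : Configuration → Configuration
  follow c = maybe id c (transition c)

  row : Configuration → ℕ → Configuration
  row c zero    = c
  row c (suc t) = follow (row c t)

  row-follow : ∀ c t → row (follow c) t ≡ row c (suc t)
  row-follow c zero    = refl
  row-follow c (suc t) = cong follow (row-follow c t)

  row-halted : ∀ c t → transition c ≡ nothing → row c t ≡ c
  row-halted c zero    h = refl
  row-halted c (suc t) h rewrite row-halted c t h | h = refl

  row-⇓ : ∀ {c d t} T → c ⇓[ t ] d → t ≤ T → row c T ≡ d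
  row-⇓ {c} T       (halt h)      _         = row-halted c T h
  row-⇓ {c} (suc T) (advance e r) (s≤s t≤T) = trans (sym (row-follow c T))
    (trans (cong (λ d → row d T) (cong (maybe id c) e)) (row-⇓ T r t≤T))

  -- The position of a column relative to the head: the head is at the left, in
  -- the middle or at the right of the three columns that determine it, or further away.
  data Near (W p : ℕ) : ℕ → Set where
    at-left   : p ≡ W → Near W p 1
    at-middle : suc p ≡ W → Near W p 2
    at-right  : suc (suc p) ≡ W → Near W p 3
    away      : p ≢ W → suc p ≢ W → suc (suc p) ≢ W → Near W p 0

  near : ∀ W p → ∃[ κ ] Near W p κ
  near W p with p ≟ W
  ... | yes e = 1 , at-left e
  ... | no a with suc p ≟ W
  ...   | yes e = 2 , at-middle e
  ...   | no b with suc (suc p) ≟ W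
  ...     | yes e = 3 , at-right e
  ...     | no c  = 0 , away a b c

  replaced : ℕ → ℕ → A → A → A
  replaced κ l w old = choose (κ ≟ l) w old

  -- If the head moves left, the contents move right in its frame, and the new middle cell is the
  -- old left one; dually for the right. `κ` tells which of the three cells was scanned, and this
  -- one carries the written symbol `w`.
  mix : ∀ {n} → ℕ → Vec (Sym × Move) n → Vec Sym n → Vec Sym n → Vec Sym n → Vec Sym n
  mix κ []               []       []       []       = []
  mix κ ((w , left)  ∷ as) (a ∷ ls) (b ∷ ms) (c ∷ rs) = replaced κ 1 w a ∷ mix κ as ls ms rs
  mix κ ((w , stay)  ∷ as) (a ∷ ls) (b ∷ ms) (c ∷ rs) = replaced κ 2 w b ∷ mix κ as ls ms rs
  mix κ ((w , right) ∷ as) (a ∷ ls) (b ∷ ms) (c ∷ rs) = replaced κ 3 w c ∷ mix κ as ls ms rs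

  update : ℕ → Column → Column → Column → Column → Column
  update κ (q , ss) (_ , ls) (_ , ms) (_ , rs) =
    Maybe.maybe′ (λ (q′ , as) → q′ , mix κ as ls ms rs) (q , ms) (δ q ss)

  written : ∀ W p {κ l} w (t : Tape Letter) → (p ≡ W → κ ≡ l) → (κ ≡ l → p ≡ W) →
            cell W (write w t) p ≡ replaced κ l w (cell W t p)
  written W p {κ} {l} w t to from with κ ≟ l
  ... | yes e rewrite from e = cell-write-here W w t
  ... | no ne = cell-write-away W w t p (ne ∘ to)

  mix-act : ∀ {n} W p {κ} → Near W p κ → (ts : Vec (Tape Letter) n) (as : Vec (Sym × Move) n) →
            Vec.map (λ t → cell W t (suc p)) (Vec.zipWith act ts as) ≡
            mix κ as (Vec.map (λ t → cell W t p) ts) (Vec.map (λ t → cell W t (suc p)) ts)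
                     (Vec.map (λ t → cell W t (suc (suc p))) ts)
  mix-act W p near []       []                 = refl
  mix-act W p {κ} near (t ∷ ts) ((w , left)  ∷ as) = cong₂ _∷_
    (trans (cell-left W (write w t) (suc p)) (written W p w t (to near) (from near))) (mix-act W p near ts as)
    where
    to : ∀ {κ} → Near W p κ → p ≡ W → κ ≡ 1
    to (at-left _)    e = refl
    to (at-middle e′) e = contradiction (trans e′ (sym e)) (≢-sym (<⇒≢ ≤-refl))
    to (at-right e′)  e = contradiction (trans e′ (sym e)) (≢-sym (<⇒≢ (n≤1+n _)))
    to (away a _ _)   e = contradiction e a
    from : ∀ {κ} → Near W p κ → κ ≡ 1 → p ≡ W
    from (at-left e) refl = e
  mix-act W p {κ} near (t ∷ ts) ((w , stay)  ∷ as) = cong₂ _∷_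
    (written W (suc p) w t (to near) (from near)) (mix-act W p near ts as)
    where
    to : ∀ {κ} → Near W p κ → suc p ≡ W → κ ≡ 2
    to (at-left e′)  e = contradiction (trans e (sym e′)) (≢-sym (<⇒≢ ≤-refl))
    to (at-middle _) e = refl
    to (at-right e′) e = contradiction (trans e′ (sym e)) (≢-sym (<⇒≢ ≤-refl))
    to (away _ b _)  e = contradiction e b
    from : ∀ {κ} → Near W p κ → κ ≡ 2 → suc p ≡ W
    from (at-middle e) refl = e
  mix-act W p {κ} near (t ∷ ts) ((w , right) ∷ as) = cong₂ _∷_
    (trans (cell-right W (write w t) (suc (suc p))) (written W (suc (suc p)) w t (to near) (from near)))
    (mix-act W p near ts as)
    where
    to : ∀ {κ} → Near W p κ → suc (suc p) ≡ W → κ ≡ 3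
    to (at-left e′)   e = contradiction (trans e (sym e′)) (≢-sym (<⇒≢ (n≤1+n _)))
    to (at-middle e′) e = contradiction (trans e (sym e′)) (≢-sym (<⇒≢ ≤-refl))
    to (at-right _)   e = refl
    to (away _ _ c)   e = contradiction e c
    from : ∀ {κ} → Near W p κ → κ ≡ 3 → suc (suc p) ≡ W
    from (at-right e) refl = e

  column-follow : ∀ W p {κ} → Near W p κ → ∀ c →
                  column W (follow c) (suc p) ≡
                  update κ (column W c W) (column W c p) (column W c (suc p)) (column W c (suc (suc p)))
  column-follow W p near (config q ts)
    rewrite Vec.map-cong (cell-scanned W) ts with δ q (Vec.map scanned ts)
  ... | nothing        = refl
  ... | just (q′ , as) = cong (q′ ,_) (mix-act W p near ts as)

number-injective : ∀ (a : Code A) {x y} → number a x ≡ number a y → x ≡ y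
number-injective a {x} {y} eq =
  trans (sym (decode-code a x)) (trans (cong (decode a) (Fin.toℕ-injective eq)) (decode-code a y))

-- Positions in a paired word

symbolAt : List A → ℕ → Maybe A
symbolAt []       _       = nothing
symbolAt (a ∷ as) zero    = just a
symbolAt (a ∷ as) (suc i) = symbolAt as i

symbolAt-< : ∀ (as : List A) i {a} → symbolAt as i ≡ just a → i < length as
symbolAt-< (a ∷ as) zero    _ = s≤s z≤n
symbolAt-< (a ∷ as) (suc i) e = s≤s (symbolAt-< as i e)

pair-even : ∀ x (c : List Bool) i → i < length x → symbolAt ⟨ x , c ⟩ (i * 2) ≡ just true
pair-even (b ∷ x) c zero    _         = refl
pair-even (b ∷ x) c (suc i) (s≤s i<n) = pair-even x c i i<n

pair-odd : ∀ x (c : List Bool) i → i < length x → symbolAt ⟨ x , c ⟩ (suc (i * 2)) ≡ just (bitAt x i)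
pair-odd (b ∷ x) c zero    _         = refl
pair-odd (b ∷ x) c (suc i) (s≤s i<n) = pair-odd x c i i<n

pair-middle : ∀ x (c : List Bool) → symbolAt ⟨ x , c ⟩ (length x * 2) ≡ just false
pair-middle []      c = refl
pair-middle (b ∷ x) c = pair-middle x c

pair-certificate : ∀ x (c : List Bool) j → symbolAt ⟨ x , c ⟩ (length x * 2 + suc j) ≡ symbolAt c j
pair-certificate []      c j = refl
pair-certificate (b ∷ x) c j = pair-certificate x c j

length-pair : ∀ x (c : List Bool) → length ⟨ x , c ⟩ ≡ suc (length x * 2 + length c)
length-pair []      c = refl
length-pair (b ∷ x) c = cong (2 +_) (length-pair x c)

-- Clauses that describe the run of a verifier

columnCode : ∀ M → Code (Frame.Column M)
columnCode M =
  code-× (finite⇒code state-finite)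
         (code-Vec (code-Maybe (code-⊎ code-Bool (finite⇒code marker-finite))) tapes)
  where open TuringMachine M

-- The codes are parameters, so that they do not unfold in the proofs.
module Tableau (M : TuringMachine) (columns : Code (Frame.Column M))
               (windows : Code (Frame.Column M × Frame.Column M × Frame.Column M × Frame.Column M)) where
  open Frame M
  open TuringMachine M
  open Run M using (Configuration; initial)

  d Γ : ℕ
  d = card columns
  Γ = card windows

  inputColumn : Maybe Bool → Column
  inputColumn b = start , Maybe.map inj₁ b ∷ Vec.replicate extraTapes nothing

  num : Column → ℕ
  num = number columns

  window : ℕ → Column × Column × Column × Column
  window = letter windows (inputColumn nothing , inputColumn nothing , inputColumn nothing , inputColumn nothing)

  accepting : Column → Bool
  accepting (_ , just (inj₁ b) ∷ _) = b
  accepting _                       = false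

  part : ℕ → Column × Column × Column × Column → Column
  part 0 (a , _ , _ , _) = a
  part 1 (_ , a , _ , _) = a
  part 2 (_ , _ , a , _) = a
  part _ (_ , _ , _ , a) = a

  updated : ℕ → Column × Column × Column × Column → Column
  updated κ (a , b , c , e) = update κ a b c e

  -- The machine enters the clauses only through finite tables over the windows: a window g lists
  -- the scanned column and three adjacent ones, `α` gives the number of one of them and `β` that of
  -- the column which results from them.
  α β : ℕ → ℕ → ℕ
  α k = table Γ (λ g → num (part k (window g)))
  β κ = table Γ (λ g → num (updated κ (window g)))

  accepts : ℕ → ℕ
  accepts = table Γ (λ g → ⌜ accepting (part 0 (window g)) ⌝)

  cell-beyond : ∀ W (t : Tape A) o → cell W t (W + o) ≡ nth (scanned t ∷ rights t) o
  cell-beyond zero    t o = refl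
  cell-beyond (suc W) t o = cell-beyond W t o

  cell-input : ∀ W (z : List Bool) o →
               cell W (fromCells (map (λ b → just (inj₁ {B = Marker} b)) z)) (W + o) ≡ Maybe.map inj₁ (symbolAt z o)
  cell-input W z o = trans (cell-beyond W (fromCells (map _ z)) o) (lemma z o)
    where
    look : ∀ z o → nth (map (λ b → just (inj₁ {B = Marker} b)) z) o ≡ Maybe.map inj₁ (symbolAt z o)
    look []      o       = refl
    look (b ∷ z) zero    = refl
    look (b ∷ z) (suc o) = look z o
    lemma : ∀ z o → nth (scanned (fromCells (map (λ b → just (inj₁ {B = Marker} b)) z)) ∷
                         rights (fromCells (map (λ b → just (inj₁ b)) z))) o ≡ Maybe.map inj₁ (symbolAt z o)
    lemma []      zero    = refl
    lemma []      (suc o) = refl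
    lemma (b ∷ z) o       = look (b ∷ z) o

  cell-before : ∀ W (as : List Sym) p → p < W → cell W (fromCells as) p ≡ nothing
  cell-before (suc W) []       zero    _         = refl
  cell-before (suc W) (a ∷ as) zero    _         = refl
  cell-before (suc W) as       (suc p) (s≤s p<W) = cell-before W as p p<W

  cell-empty : ∀ W p → cell {Letter} W (fromCells []) p ≡ nothing
  cell-empty zero    zero    = refl
  cell-empty zero    (suc p) = refl
  cell-empty (suc W) zero    = refl
  cell-empty (suc W) (suc p) = cell-empty W p

  column-empty : ∀ W p n → Vec.map (λ t → cell W t p) (Vec.replicate n (fromCells {Letter} [])) ≡
                           Vec.replicate n nothing
  column-empty W p zero    = refl
  column-empty W p (suc n) = cong₂ _∷_ (cell-empty W p) (column-empty W p n)

  column-initial : ∀ W z o → column W (initial z) (W + o) ≡ inputColumn (symbolAt z o)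
  column-initial W z o = cong (start ,_) (cong₂ _∷_ (cell-input W z o) (column-empty W (W + o) extraTapes))

  column-before : ∀ W z p → p < W → column W (initial z) p ≡ inputColumn nothing
  column-before W z p p<W = cong (start ,_) (cong₂ _∷_ (cell-before W _ p p<W) (column-empty W p extraTapes))

  window-number : ∀ w → window (number windows w) ≡ w
  window-number w = letter-number windows _ w

  α-number : ∀ k w → α k (number windows w) ≡ num (part k w)
  α-number k w = trans (table-< Γ _ _ (number-< windows w)) (cong (num ∘ part k) (window-number w))

  β-number : ∀ κ w → β κ (number windows w) ≡ num (updated κ w)
  β-number κ w = trans (table-< Γ _ _ (number-< windows w)) (cong (num ∘ updated κ) (window-number w))

  accepts-number : ∀ w → accepts (number windows w) ≡ ⌜ accepting (part 0 w) ⌝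
  accepts-number w =
    trans (table-< Γ _ _ (number-< windows w)) (cong (⌜_⌝ ∘ accepting ∘ part 0) (window-number w))

  zeroᶠ oneᶠ blankᶠ : ℕ
  zeroᶠ  = num (inputColumn (just false))
  oneᶠ   = num (inputColumn (just true))
  blankᶠ = num (inputColumn nothing)

  -- T steps, columns below P, head at column T, certificates of length at most q.
  module Clauses (T P q : ℕ) (x : List Bool) where

    ℓ : ℕ
    ℓ = length x

    -- The variable "row t has letter a in column p". The `suc` keeps variable 0 out of all clauses,
    -- and rows have 2 + P columns because a clause with p < P also speaks of the columns p + 1 and
    -- p + 2.
    X : ℕ → ℕ → ℕ → ℕ
    X t p a = suc (a + (p + t * (2 + P)) * d)

    variables : ℕ
    variables = suc (suc T * (2 + P) * d)

    -- Each window g has its own clauses. A step clause is the implication: if row t shows the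
    -- columns of g at T, p, p + 1 and p + 2, then row t + 1 shows `β` of g at p + 1. The `suc`
    -- skips the ignored clause 0.
    index : ℕ → ℕ → ℕ → ℕ → ℕ
    index κ t p g = suc (κ + (g + (p + t * P) * Γ) * 4)

    clauses : ℕ
    clauses = suc (T * P * Γ * 4)

    -- Blanks left of the head, then the flags and bits of the word, its end flag, and a certificate
    -- region where both bits and the blank are possible. No clause forbids a second letter in a
    -- column: it suffices for soundness that the letters of one particular run are true.
    Allowed : ℕ → ℕ → Set
    Allowed p a =
      (p < T × a ≡ blankᶠ) ⊎
      Some ℓ (λ i → p ≡ T + i * 2 × a ≡ oneᶠ) ⊎
      Some ℓ (λ i → p ≡ T + suc (i * 2) × (Tr i × a ≡ oneᶠ ⊎ ¬ Tr i × a ≡ zeroᶠ)) ⊎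
      (p ≡ T + ℓ * 2 × a ≡ zeroᶠ) ⊎
      Some q (λ j → p ≡ T + (ℓ * 2 + suc j) × (a ≡ zeroᶠ ⊎ a ≡ oneᶠ)) ⊎
      (T + ℓ * 2 < p × a ≡ blankᶠ)
      where
      Tr : ℕ → Set
      Tr i = Data.Bool.T (bitAt x i)

    -- Clause kinds: 0 a step of the machine, 1 the initial row, 2 blanks after
    -- the end of the certificate, 3 acceptance.
    LitAt : Bool → ℕ → ℕ → ℕ → ℕ → ℕ → Set
    LitAt true κ t p g i =
      (κ ≡ 0 × (p ≡ T × i ≡ X (suc t) (suc p) (β 1 g) ⊎
                suc p ≡ T × i ≡ X (suc t) (suc p) (β 2 g) ⊎
                suc (suc p) ≡ T × i ≡ X (suc t) (suc p) (β 3 g) ⊎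
                (¬ (p ≡ T) × ¬ (suc p ≡ T) × ¬ (suc (suc p) ≡ T)) × i ≡ X (suc t) (suc p) (β 0 g))) ⊎
      (κ ≡ 1 × Some d (λ a → Allowed p a × i ≡ X 0 p a)) ⊎
      (κ ≡ 2 × (i ≡ X 0 (suc p) blankᶠ ⊎ p ≤ T + ℓ * 2 × i ≡ X 0 p blankᶠ)) ⊎
      (κ ≡ 3 × accepts g ≡ 1 × i ≡ X T T (α 0 g))
    LitAt false κ t p g i =
      (κ ≡ 0 × (i ≡ X t T (α 0 g) ⊎ i ≡ X t p (α 1 g) ⊎ i ≡ X t (suc p) (α 2 g) ⊎ i ≡ X t (suc (suc p)) (α 3 g))) ⊎
      (κ ≡ 2 × i ≡ X 0 p blankᶠ) ⊎
      (κ ≡ 3 × i ≡ X T T (α 0 g))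

    Lit : Bool → ℕ → ℕ → Set
    Lit b i j = Some T λ t → Some P λ p → Some Γ λ g → Some 4 λ κ → j ≡ index κ t p g × LitAt b κ t p g i

    Lit-0 : ∀ b j → ¬ Lit b 0 j
    Lit-0 true j (t , _ , p , _ , g , _ , κ , _ , _ , l) with l
    ... | inj₁ (_ , inj₁ (_ , ()))
    ... | inj₁ (_ , inj₂ (inj₁ (_ , ())))
    ... | inj₁ (_ , inj₂ (inj₂ (inj₁ (_ , ()))))
    ... | inj₁ (_ , inj₂ (inj₂ (inj₂ (_ , ()))))
    ... | inj₂ (inj₁ (_ , _ , _ , _ , ()))
    ... | inj₂ (inj₂ (inj₁ (_ , inj₁ ())))
    ... | inj₂ (inj₂ (inj₁ (_ , inj₂ ())))
    ... | inj₂ (inj₂ (inj₂ (_ , _ , ())))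
    Lit-0 false j (t , _ , p , _ , g , _ , κ , _ , _ , l) with l
    ... | inj₁ (_ , inj₁ ())
    ... | inj₁ (_ , inj₂ (inj₁ ()))
    ... | inj₁ (_ , inj₂ (inj₂ (inj₁ ())))
    ... | inj₁ (_ , inj₂ (inj₂ (inj₂ ())))
    ... | inj₂ (inj₁ (_ , ()))
    ... | inj₂ (inj₂ (_ , ()))

    index-< : ∀ {κ t p g} → κ < 4 → t < T → p < P → g < Γ → index κ t p g < clauses
    index-< κ< t< p< g< = s≤s (radix-< κ< (radix-< g< (radix-< p< t<)))

    beyond-fixed : ∀ {o} k → o ≡ ℓ * 2 + suc k → ¬ (o ≤ ℓ * 2)
    beyond-fixed k refl o≤ = <⇒≱ (m<m+n (ℓ * 2) (s≤s z≤n)) o≤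

    allowed-fixed : ∀ c o {a} → o ≤ ℓ * 2 → Allowed (T + o) a → a ≡ num (inputColumn (symbolAt ⟨ x , c ⟩ o))
    allowed-fixed c o o≤ (inj₁ (p<T , _)) = contradiction p<T (m+n≮m T o)
    allowed-fixed c o o≤ (inj₂ (inj₁ (i , i<ℓ , eq , a≡)))
      rewrite +-cancelˡ-≡ T _ _ eq | pair-even x c i i<ℓ = a≡
    allowed-fixed c o o≤ (inj₂ (inj₂ (inj₁ (i , i<ℓ , eq , b))))
      rewrite +-cancelˡ-≡ T _ _ eq | pair-odd x c i i<ℓ with bitAt x i | b
    ... | true  | inj₁ (_ , a≡)  = a≡
    ... | true  | inj₂ (¬t , _)  = contradiction tt ¬t
    ... | false | inj₂ (_ , a≡)  = a≡
    allowed-fixed c o o≤ (inj₂ (inj₂ (inj₂ (inj₁ (eq , a≡)))))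
      rewrite +-cancelˡ-≡ T _ _ eq | pair-middle x c = a≡
    allowed-fixed c o o≤ (inj₂ (inj₂ (inj₂ (inj₂ (inj₁ (j , _ , eq , _)))))) =
      contradiction o≤ (beyond-fixed j (+-cancelˡ-≡ T _ _ eq))
    allowed-fixed c o o≤ (inj₂ (inj₂ (inj₂ (inj₂ (inj₂ (p> , _)))))) =
      contradiction (+-cancelˡ-< T _ _ p>) (≤⇒≯ o≤)

    allowed-before : ∀ {p a} → p < T → Allowed p a → a ≡ blankᶠ
    allowed-before p<T (inj₁ (_ , a≡)) = a≡
    allowed-before p<T (inj₂ (inj₁ (i , _ , refl , _))) = contradiction p<T (m+n≮m T _)
    allowed-before p<T (inj₂ (inj₂ (inj₁ (i , _ , refl , _)))) = contradiction p<T (m+n≮m T _)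
    allowed-before p<T (inj₂ (inj₂ (inj₂ (inj₁ (refl , _))))) = contradiction p<T (m+n≮m T _)
    allowed-before p<T (inj₂ (inj₂ (inj₂ (inj₂ (inj₁ (j , _ , refl , _)))))) = contradiction p<T (m+n≮m T _)
    allowed-before p<T (inj₂ (inj₂ (inj₂ (inj₂ (inj₂ (T<p , _)))))) =
      contradiction (<-trans p<T (≤-<-trans (m≤m+n T _) T<p)) (<-irrefl refl)

    allowed-free : ∀ k {a} → Allowed (T + (ℓ * 2 + suc k)) a →
                   a ≡ blankᶠ ⊎ (k < q × (a ≡ zeroᶠ ⊎ a ≡ oneᶠ))
    allowed-free k (inj₁ (p<T , _)) = contradiction p<T (m+n≮m T _)
    allowed-free k (inj₂ (inj₁ (i , i<ℓ , eq , _))) =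
      contradiction (<⇒≤ (radix-< {0} {i} {ℓ} {2} (s≤s z≤n) i<ℓ)) (beyond-fixed k (sym (+-cancelˡ-≡ T _ _ eq)))
    allowed-free k (inj₂ (inj₂ (inj₁ (i , i<ℓ , eq , _)))) =
      contradiction (<⇒≤ (radix-< {1} {i} {ℓ} {2} (s≤s (s≤s z≤n)) i<ℓ))
                    (beyond-fixed k (sym (+-cancelˡ-≡ T _ _ eq)))
    allowed-free k (inj₂ (inj₂ (inj₂ (inj₁ (eq , _))))) =
      contradiction ≤-refl (beyond-fixed k (sym (+-cancelˡ-≡ T _ _ eq)))
    allowed-free k (inj₂ (inj₂ (inj₂ (inj₂ (inj₁ (j , j<q , eq , b))))))
      rewrite suc-injective (+-cancelˡ-≡ (ℓ * 2) _ _ (+-cancelˡ-≡ T _ _ eq)) = inj₂ (j<q , b)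
    allowed-free k (inj₂ (inj₂ (inj₂ (inj₂ (inj₂ (_ , a≡)))))) = inj₁ a≡

    data Offset : ℕ → Set where
      even        : ∀ i → i < ℓ → Offset (i * 2)
      odd         : ∀ i → i < ℓ → Offset (suc (i * 2))
      middle      : Offset (ℓ * 2)
      certificate : ∀ k → Offset (ℓ * 2 + suc k)

    offset : ∀ o → Offset o
    offset o with o <? ℓ * 2
    ... | yes o< with radix-exists {o} ℓ 2 o<
    ...   | 0 , i , _ , i<ℓ , refl = even i i<ℓ
    ...   | 1 , i , _ , i<ℓ , refl = odd i i<ℓ
    ...   | suc (suc _) , i , s≤s (s≤s ()) , _
    offset o | no o≮ with ℓ * 2 ≟ o
    ... | yes refl = middle
    ... | no ne = subst Offset (trans (+-suc (ℓ * 2) _) (m+[n∸m]≡n (≤∧≢⇒< (≮⇒≥ o≮) ne)))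
                    (certificate (o ∸ suc (ℓ * 2)))

    offset-fixed : ∀ {o} → Offset o → o ≤ ℓ * 2 ⊎ ∃[ k ] o ≡ ℓ * 2 + suc k
    offset-fixed (even i i<ℓ)    = inj₁ (<⇒≤ (radix-< {0} {i} {ℓ} {2} (s≤s z≤n) i<ℓ))
    offset-fixed (odd i i<ℓ)     = inj₁ (<⇒≤ (radix-< {1} {i} {ℓ} {2} (s≤s (s≤s z≤n)) i<ℓ))
    offset-fixed middle          = inj₁ ≤-refl
    offset-fixed (certificate k) = inj₂ (k , refl)

    Satisfied : (ℕ → Bool) → ℕ → ℕ → ℕ → ℕ → Set
    Satisfied σ κ t p g = ∃[ i ] i < variables × LitAt (σ i) κ t p g i

    -- The digits of a clause number are unique, so the true literal found for `index κ t p g`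
    -- belongs to these very κ, t, p, g.
    satisfied : ∀ {σ} → (∀ j → 0 < j → j < clauses → Some variables (λ i → Lit (σ i) i j)) →
                ∀ {κ t p g} → κ < 4 → t < T → p < P → g < Γ → Satisfied σ κ t p g
    satisfied {σ} sat {κ} {t} {p} {g} κ< t< p< g<
      with sat (index κ t p g) (s≤s z≤n) (index-< κ< t< p< g<)
    ... | i , i< , t′ , t′< , p′ , p′< , g′ , g′< , κ′ , κ′< , eq , l
      with radix-unique (g + (p + t * P) * Γ) (g′ + (p′ + t′ * P) * Γ) κ< κ′< (suc-injective eq)
    ... | refl , eq₁ with radix-unique (p + t * P) (p′ + t′ * P) g< g′< eq₁
    ... | refl , eq₂ with radix-unique t t′ p< p′< eq₂
    ... | refl , refl = i , i< , l

    module _ (2T<P : T + T < P) (input<P : T + (ℓ * 2 + q) < P) where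

      T<P : T < P
      T<P = ≤-trans (s≤s (m≤m+n T T)) 2T<P

      module Sound (0<T : 0 < T) (σ : ℕ → Bool)
                   (sat : ∀ j → 0 < j → j < clauses → Some variables (λ i → Lit (σ i) i j)) where

        Γ>0 : 0 < Γ
        Γ>0 = ≤-trans (s≤s z≤n) (number-< windows (window 0))

        True : ℕ → ℕ → ℕ → Set
        True t p a = σ (X t p a) ≡ true

        clash : ∀ {i t p a b} → True t p a → i ≡ X t p b → b ≡ a → σ i ≡ false → ⊥
        clash tr refl refl f with trans (sym tr) f
        ... | ()

        allowed : ∀ p → p < P → Σ[ a ∈ ℕ ] Allowed p a × True 0 p a
        allowed p p<P with satisfied sat {1} {0} {p} {0} (s≤s (s≤s z≤n)) 0<T p<P Γ>0
        ... | i , _ , l with σ i in e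
        allowed p p<P | i , _ , inj₂ (inj₁ (_ , a , _ , ok , refl)) | true = a , ok , e
        allowed p p<P | i , _ , inj₁ (() , _) | true
        allowed p p<P | i , _ , inj₂ (inj₂ (inj₁ (() , _))) | true
        allowed p p<P | i , _ , inj₂ (inj₂ (inj₂ (() , _))) | true
        allowed p p<P | i , _ , inj₁ (() , _) | false
        allowed p p<P | i , _ , inj₂ (inj₁ (() , _)) | false
        allowed p p<P | i , _ , inj₂ (inj₂ (() , _)) | false

        -- Beyond the end flag of the word the alternative `p ≤ T + ℓ * 2` fails, and a clause of
        -- kind 2 becomes the implication from p to p + 1.
        blank-step : ∀ p → p < P → T + ℓ * 2 < p → True 0 p blankᶠ → True 0 (suc p) blankᶠ
        blank-step p p<P T<p tr with satisfied sat {2} {0} {p} {0} (s≤s (s≤s (s≤s z≤n))) 0<T p<P Γ>0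
        ... | i , _ , l with σ i in e
        blank-step p p<P T<p tr | i , _ , inj₁ (() , _) | true
        blank-step p p<P T<p tr | i , _ , inj₂ (inj₁ (() , _)) | true
        blank-step p p<P T<p tr | i , _ , inj₂ (inj₂ (inj₁ (_ , inj₁ refl))) | true = e
        blank-step p p<P T<p tr | i , _ , inj₂ (inj₂ (inj₁ (_ , inj₂ (p≤ , _)))) | true = contradiction p≤ (<⇒≱ T<p)
        blank-step p p<P T<p tr | i , _ , inj₂ (inj₂ (inj₂ (() , _))) | true
        blank-step p p<P T<p tr | i , _ , inj₁ (() , _) | false
        blank-step p p<P T<p tr | i , _ , inj₂ (inj₁ (_ , eq)) | false = ⊥-elim (clash {t = 0} {p} tr eq refl e)
        blank-step p p<P T<p tr | i , _ , inj₂ (inj₂ (() , _)) | false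

        free : ℕ → ℕ
        free k = T + (ℓ * 2 + suc k)

        free> : ∀ k → T + ℓ * 2 < free k
        free> k = +-monoʳ-< T (m<m+n (ℓ * 2) (s≤s z≤n))

        free-suc : ∀ k → suc (free k) ≡ free (suc k)
        free-suc k = trans (sym (+-suc T _)) (cong (T +_) (sym (+-suc (ℓ * 2) (suc k))))

        -- Extracts the certificate from the assignment. A position may have several true letters: a
        -- true blank ends the certificate, otherwise `oneᶠ` takes precedence over `zeroᶠ`.
        read : ℕ → ℕ → List Bool
        read zero    j = []
        read (suc r) j = if σ (X 0 (free j) blankᶠ) then [] else σ (X 0 (free j) oneᶠ) ∷ read r (suc j)

        read-length : ∀ r j → length (read r j) ≤ r
        read-length zero    j = z≤n
        read-length (suc r) j with σ (X 0 (free j) blankᶠ)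
        ... | true  = z≤n
        ... | false = s≤s (read-length r (suc j))

        all-blank : ∀ o j → True 0 (free j) blankᶠ → free (j + o) < P → True 0 (free (j + o)) blankᶠ
        all-blank zero    j tr j<P rewrite +-identityʳ j = tr
        all-blank (suc o) j tr j<P rewrite +-suc j o =
          all-blank o (suc j)
            (subst (λ p → True 0 p blankᶠ) (free-suc j)
              (blank-step (free j) (≤-trans (s≤s (+-monoʳ-≤ T
                  (+-monoʳ-≤ (ℓ * 2) (s≤s (≤-trans (m≤m+n j o) (n≤1+n _)))))) j<P)
                          (free> j) tr))
            j<P

        Reads : ℕ → ℕ → List Bool → Set
        Reads j o c = True 0 (free (j + o)) (num (inputColumn (symbolAt c o)))

        end-true : ∀ k → q ≤ k → Σ[ a ∈ ℕ ] Allowed (free k) a × True 0 (free k) a → True 0 (free k) blankᶠ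
        end-true k q≤k (a , ok , tr) = from (allowed-free k ok)
          where
          from : a ≡ blankᶠ ⊎ (k < q × (a ≡ zeroᶠ ⊎ a ≡ oneᶠ)) → True 0 (free k) blankᶠ
          from (inj₁ e)         = subst (True 0 (free k)) e tr
          from (inj₂ (k<q , _)) = contradiction q≤k (<⇒≱ k<q)

        bit-true : ∀ k → σ (X 0 (free k) blankᶠ) ≡ false → ∀ b → σ (X 0 (free k) oneᶠ) ≡ b →
                   Σ[ a ∈ ℕ ] Allowed (free k) a × True 0 (free k) a → True 0 (free k) (num (inputColumn (just b)))
        bit-true k no-blank true  e _             = e
        bit-true k no-blank false e (a , ok , tr) = from (allowed-free k ok)
          where
          from : a ≡ blankᶠ ⊎ (k < q × (a ≡ zeroᶠ ⊎ a ≡ oneᶠ)) → True 0 (free k) zeroᶠ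
          from (inj₁ refl)            = contradiction (trans (sym no-blank) tr) λ ()
          from (inj₂ (_ , inj₁ refl)) = tr
          from (inj₂ (_ , inj₂ refl)) = contradiction (trans (sym e) tr) λ ()

        -- Behind the extracted certificate the blank must be true: either reading stopped at a true
        -- blank, which the clauses of kind 2 carry to the right, or q symbols have been read and
        -- only the blank is allowed.
        read-true : ∀ r j o → j + r ≡ q → free (j + o) < P → Reads j o (read r j)
        read-true zero j o eq j<P =
          end-true (j + o) (≤-trans (≤-reflexive (trans (sym eq) (+-identityʳ j))) (m≤m+n j o))
              (allowed (free (j + o)) j<P)
        read-true (suc r) j o eq j<P = cases (σ (X 0 (free j) blankᶠ)) refl
          where
          later : σ (X 0 (free j) blankᶠ) ≡ false → ∀ o → free (j + o) < P →
                  Reads j o (σ (X 0 (free j) oneᶠ) ∷ read r (suc j))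
          later e zero    j<P =
            subst (λ k → True 0 (free k) (num (inputColumn (just (σ (X 0 (free j) oneᶠ)))))) (sym (+-identityʳ j))
              (bit-true j e _ refl (allowed (free j) (subst (λ k → free k < P) (+-identityʳ j) j<P)))
          later e (suc o) j<P =
            subst (λ k → True 0 (free k) (num (inputColumn (symbolAt (read r (suc j)) o)))) (sym (+-suc j o))
              (read-true r (suc j) o (trans (sym (+-suc j r)) eq) (subst (λ k → free k < P) (+-suc j o) j<P))
          cases : ∀ b → σ (X 0 (free j) blankᶠ) ≡ b →
                  Reads j o (if b then [] else σ (X 0 (free j) oneᶠ) ∷ read r (suc j))
          cases true  e = all-blank o j e j<P
          cases false e = later e o j<P

        certificateOf : List Bool
        certificateOf = read q 0

        input : List Bool
        input = ⟨ x , certificateOf ⟩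

        conf : ℕ → Configuration
        conf = row (initial input)

        before-true : ∀ p → p < T → Σ[ a ∈ ℕ ] Allowed p a × True 0 p a → True 0 p (num (column T (initial input) p))
        before-true p p<T (a , ok , tr) =
          subst (True 0 p) (trans (allowed-before p<T ok) (cong num (sym (column-before T input p p<T)))) tr

        offset-true : ∀ o → T + o < P → True 0 (T + o) (num (column T (initial input) (T + o)))
        offset-true o o<P = subst (λ b → True 0 (T + o) (num b)) (sym (column-initial T input o))
            (from (offset-fixed (offset o)))
          where
          fixed : o ≤ ℓ * 2 → Σ[ a ∈ ℕ ] Allowed (T + o) a × True 0 (T + o) a →
                  True 0 (T + o) (num (inputColumn (symbolAt input o)))
          fixed o≤ (a , ok , tr) = subst (True 0 (T + o)) (allowed-fixed certificateOf o o≤ ok) tr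
          from : o ≤ ℓ * 2 ⊎ ∃[ k ] o ≡ ℓ * 2 + suc k → True 0 (T + o) (num (inputColumn (symbolAt input o)))
          from (inj₁ o≤)         = fixed o≤ (allowed (T + o) o<P)
          from (inj₂ (k , refl)) = subst (λ b → True 0 (free k) (num (inputColumn b)))
            (sym (pair-certificate x certificateOf k)) (read-true q 0 k refl o<P)

        initial-true : ∀ p → p < P → True 0 p (num (column T (initial input) p))
        initial-true p p<P = cases (p <? T)
          where
          cases : Dec (p < T) → True 0 p (num (column T (initial input) p))
          cases (yes p<T) = before-true p p<T (allowed p p<P)
          cases (no p≮T)  = subst (λ p → True 0 p (num (column T (initial input) p))) (m+[n∸m]≡n (≮⇒≥ p≮T))
            (offset-true (p ∸ T) (subst (_< P) (sym (m+[n∸m]≡n (≮⇒≥ p≮T))) p<P))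

        -- A column depends on its neighbours on both sides, so the known region loses one column at
        -- either end per row, whence `t ≤ p` and `p + t < P`. As T + T < P, column T is still
        -- inside it in row T.
        row-true : ∀ t p → t ≤ T → t ≤ p → p + t < P → True t p (num (column T (conf t) p))
        row-true zero    p t≤T t≤p p+t<P = initial-true p (subst (_< P) (+-identityʳ p) p+t<P)
        row-true (suc t) (suc p) t<T (s≤s t≤p) p+t<P = derive
            (satisfied sat {0} (s≤s z≤n) t<T p<P (number-< windows w))
          where
          wide : suc (suc p) + t < P
          wide = subst (_< P) (cong suc (+-suc p t)) p+t<P
          p<P : p < P
          p<P = ≤-<-trans (≤-trans (≤-trans (n≤1+n p) (n≤1+n _)) (m≤m+n (suc (suc p)) t)) wide
          t≤T : t ≤ T
          t≤T = <⇒≤ t<T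
          w : Column × Column × Column × Column
          w = column T (conf t) T , column T (conf t) p , column T (conf t) (suc p) , column T (conf t) (suc (suc p))
          g : ℕ
          g = number windows w
          new : ∀ {κ i} → Near T p κ → i ≡ X (suc t) (suc p) (β κ g) → σ i ≡ true →
                True (suc t) (suc p) (num (column T (conf (suc t)) (suc p)))
          new {κ} near refl tr =
            subst (True (suc t) (suc p)) (trans (β-number κ w) (cong num (sym (column-follow T p near (conf t))))) tr
          derive : Satisfied σ 0 t p g → True (suc t) (suc p) (num (column T (conf (suc t)) (suc p)))
          derive (i , _ , l) with σ i in e
          derive (i , _ , inj₁ (_ , inj₁ (n , eq))) | true = new (at-left n) eq e
          derive (i , _ , inj₁ (_ , inj₂ (inj₁ (n , eq)))) | true = new (at-middle n) eq e
          derive (i , _ , inj₁ (_ , inj₂ (inj₂ (inj₁ (n , eq))))) | true = new (at-right n) eq e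
          derive (i , _ , inj₁ (_ , inj₂ (inj₂ (inj₂ ((a , b , c) , eq))))) | true = new (away a b c) eq e
          derive (i , _ , inj₂ (inj₁ (() , _))) | true
          derive (i , _ , inj₂ (inj₂ (inj₁ (() , _)))) | true
          derive (i , _ , inj₂ (inj₂ (inj₂ (() , _)))) | true
          derive (i , _ , inj₁ (_ , inj₁ eq)) | false =
            ⊥-elim (clash {t = t} {T} (row-true t T t≤T t≤T (≤-<-trans (+-monoʳ-≤ T t≤T) 2T<P)) eq (α-number 0 w) e)
          derive (i , _ , inj₁ (_ , inj₂ (inj₁ eq))) | false =
            ⊥-elim (clash {t = t} {p} (row-true t p t≤T t≤p
                (≤-<-trans (+-monoˡ-≤ t (≤-trans (n≤1+n p) (n≤1+n _))) wide)) eq (α-number 1 w) e)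
          derive (i , _ , inj₁ (_ , inj₂ (inj₂ (inj₁ eq)))) | false =
            ⊥-elim (clash {t = t} {suc p} (row-true t (suc p) t≤T (≤-trans t≤p (n≤1+n p))
                (≤-<-trans (n≤1+n _) wide)) eq (α-number 2 w) e)
          derive (i , _ , inj₁ (_ , inj₂ (inj₂ (inj₂ eq)))) | false =
            ⊥-elim (clash {t = t} {suc (suc p)} (row-true t (suc (suc p)) t≤T
                (≤-trans t≤p (≤-trans (n≤1+n p) (n≤1+n _))) wide) eq (α-number 3 w) e)
          derive (i , _ , inj₂ (inj₁ (() , _))) | false
          derive (i , _ , inj₂ (inj₂ (() , _))) | false

        -- For an accepting window the clause of kind 3 contains a variable together with its
        -- negation; for any other window it forbids the scanned column of that window. The column
        -- that the run shows is true, hence not forbidden.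
        accepted : accepting (column T (conf T) T) ≡ true
        accepted = derive (satisfied sat {3} {0} {0} {g} ≤-refl 0<T (≤-<-trans z≤n T<P) (number-< windows w))
          where
          w : Column × Column × Column × Column
          w = column T (conf T) T , column T (conf T) T , column T (conf T) T , column T (conf T) T
          g : ℕ
          g = number windows w
          positive-bit : ∀ b → ⌜ b ⌝ ≡ 1 → b ≡ true
          positive-bit true _ = refl
          derive : Satisfied σ 3 0 0 g → accepting (column T (conf T) T) ≡ true
          derive (i , _ , l) with σ i in e
          derive (i , _ , inj₁ (() , _)) | true
          derive (i , _ , inj₂ (inj₁ (() , _))) | true
          derive (i , _ , inj₂ (inj₂ (inj₁ (() , _)))) | true
          derive (i , _ , inj₂ (inj₂ (inj₂ (_ , acc , _)))) | true =
            positive-bit _ (trans (sym (accepts-number w)) acc)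
          derive (i , _ , inj₁ (() , _)) | false
          derive (i , _ , inj₂ (inj₁ (() , _))) | false
          derive (i , _ , inj₂ (inj₂ (_ , eq))) | false =
            ⊥-elim (clash {t = T} {T} (row-true T T ≤-refl ≤-refl 2T<P) eq (α-number 0 w) e)

-- A satisfying assignment from an accepting run

module TableauComplete (M : TuringMachine) (columns : Code (Frame.Column M))
                (windows : Code (Frame.Column M × Frame.Column M × Frame.Column M × Frame.Column M))
                (T P q : ℕ) (x c : List Bool) where
  open Frame M
  open TuringMachine M
  open Run M using (Configuration; initial)
  open Tableau M columns windows
  open Clauses T P q x

  input : List Bool
  input = ⟨ x , c ⟩

  conf : ℕ → Configuration
  conf = row (initial input)

  truth-at : ℕ → ℕ → ℕ
  truth-at t p = num (column T (conf t) p)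

  instance
    nonZero-d : NonZero d
    nonZero-d = >-nonZero (≤-<-trans z≤n (number-< columns (inputColumn nothing)))

  -- The digits of r undo `X`: letter, then column, then row. True is exactly what the run shows.
  σ : ℕ → Bool
  σ zero    = false
  σ (suc r) = does (r % d ≟ truth-at ((r / d) / (2 + P)) ((r / d) % (2 + P)))

  σ-X : ∀ t p a → p < 2 + P → a < d → σ (X t p a) ≡ does (a ≟ truth-at t p)
  σ-X t p a p< a<
    rewrite radix-% (p + t * (2 + P)) a< | radix-/ (p + t * (2 + P)) a<
          | radix-% t p< | radix-/ t p< = refl

  σ-true : ∀ t p {a} → p < 2 + P → a ≡ truth-at t p → σ (X t p a) ≡ true
  σ-true t p p< refl with truth-at t p ≟ truth-at t p | σ-X t p (truth-at t p) p< (number-< columns _)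
  ... | yes _ | eq = trans eq (does-≟ (truth-at t p))
    where
    does-≟ : ∀ n → does (n ≟ n) ≡ true
    does-≟ zero    = refl
    does-≟ (suc n) = does-≟ n
  ... | no ne | _ = contradiction refl ne

  σ-false : ∀ t p {a} → p < 2 + P → a < d → a ≢ truth-at t p → σ (X t p a) ≡ false
  σ-false t p {a} p< a< ne = trans (σ-X t p a p< a<) (does-≢ a _ ne)
    where
    does-≢ : ∀ n k → n ≢ k → does (n ≟ k) ≡ false
    does-≢ zero    zero    ne = contradiction refl ne
    does-≢ zero    (suc k) ne = refl
    does-≢ (suc n) zero    ne = refl
    does-≢ (suc n) (suc k) ne = does-≢ n k (ne ∘ cong suc)

  X-< : ∀ {t p a} → t ≤ T → p < 2 + P → a < d → X t p a < variables
  X-< t≤ p< a< = s≤s (radix-< a< (radix-< p< (s≤s t≤)))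

  α-< : ∀ k {g} → g < Γ → α k g < d
  α-< k g< = subst (_< d) (sym (table-< Γ _ _ g<)) (number-< columns _)

  β-< : ∀ κ {g} → g < Γ → β κ g < d
  β-< κ g< = subst (_< d) (sym (table-< Γ _ _ g<)) (number-< columns _)

  allowed-initial : length c ≤ q → ∀ p → Allowed p (truth-at 0 p)
  allowed-initial c≤q p with p <? T
  ... | yes p<T rewrite column-before T input p p<T = inj₁ (p<T , refl)
  ... | no p≮T = subst (λ p → Allowed p (truth-at 0 p)) (m+[n∸m]≡n (≮⇒≥ p≮T)) (at-offset (offset (p ∸ T)))
    where
    at-offset : ∀ {o} → Offset o → Allowed (T + o) (truth-at 0 (T + o))
    at-offset (even i i<ℓ) rewrite column-initial T input (i * 2) | pair-even x c i i<ℓ =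
      inj₂ (inj₁ (i , i<ℓ , refl , refl))
    at-offset (odd i i<ℓ) rewrite column-initial T input (suc (i * 2)) | pair-odd x c i i<ℓ =
      inj₂ (inj₂ (inj₁ (i , i<ℓ , refl , bit-case)))
      where
      bit-case : (Data.Bool.T (bitAt x i) × num (inputColumn (just (bitAt x i))) ≡ oneᶠ) ⊎
                 (¬ Data.Bool.T (bitAt x i) × num (inputColumn (just (bitAt x i))) ≡ zeroᶠ)
      bit-case with bitAt x i
      ... | true  = inj₁ (tt , refl)
      ... | false = inj₂ (id , refl)
    at-offset middle rewrite column-initial T input (ℓ * 2) | pair-middle x c =
      inj₂ (inj₂ (inj₂ (inj₁ (refl , refl))))
    at-offset (certificate k)
      rewrite column-initial T input (ℓ * 2 + suc k) | pair-certificate x c k with symbolAt c k in e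
    ... | nothing    = inj₂ (inj₂ (inj₂ (inj₂ (inj₂ (+-monoʳ-< T (m<m+n (ℓ * 2) (s≤s z≤n)) , refl)))))
    ... | just false = inj₂ (inj₂ (inj₂ (inj₂ (inj₁ (k , <-≤-trans (symbolAt-< c k e) c≤q , refl , inj₁ refl)))))
    ... | just true  = inj₂ (inj₂ (inj₂ (inj₂ (inj₁ (k , <-≤-trans (symbolAt-< c k e) c≤q , refl , inj₂ refl)))))

  symbol-end : ∀ (c : List Bool) k → symbolAt c k ≡ nothing → symbolAt c (suc k) ≡ nothing
  symbol-end []          k       _ = refl
  symbol-end (b ∷ [])    zero    ()
  symbol-end (b ∷ _ ∷ c) zero    ()
  symbol-end (b ∷ c)     (suc k) e = symbol-end c k e

  inputColumn-injective : ∀ {b} → inputColumn b ≡ inputColumn nothing → b ≡ nothing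
  inputColumn-injective {nothing} _ = refl

  blank-stays : ∀ p → T + ℓ * 2 < p → blankᶠ ≡ truth-at 0 p → blankᶠ ≡ truth-at 0 (suc p)
  blank-stays p T<p eq =
    subst (λ p → blankᶠ ≡ truth-at 0 p → blankᶠ ≡ truth-at 0 (suc p)) p≡ (stays (p ∸ suc (T + ℓ * 2))) eq
    where
    p≡ : T + (ℓ * 2 + suc (p ∸ suc (T + ℓ * 2))) ≡ p
    p≡ = trans (sym (+-assoc T (ℓ * 2) _)) (trans (+-suc (T + ℓ * 2) _) (m+[n∸m]≡n T<p))
    stays : ∀ k → blankᶠ ≡ truth-at 0 (T + (ℓ * 2 + suc k)) → blankᶠ ≡ truth-at 0 (suc (T + (ℓ * 2 + suc k)))
    stays k e
      rewrite sym (+-suc T (ℓ * 2 + suc k)) | sym (+-suc (ℓ * 2) (suc k))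
            | column-initial T input (ℓ * 2 + suc k) | pair-certificate x c k
            | column-initial T input (ℓ * 2 + suc (suc k)) | pair-certificate x c (suc k)
      = cong (num ∘ inputColumn)
          (sym (symbol-end c k (inputColumn-injective (sym (number-injective columns e)))))

  module _ (2T<P : T + T < P) (c≤q : length c ≤ q) (acc : accepting (column T (conf T) T) ≡ true) where

    Goal : ℕ → ℕ → ℕ → ℕ → Set
    Goal κ t p g = ∃[ i ] i < variables × LitAt (σ i) κ t p g i

    positive-literal : ∀ {κ t p g} t′ p′ {a} → t′ ≤ T → p′ < 2 + P → a < d → a ≡ truth-at t′ p′ →
                       LitAt true κ t p g (X t′ p′ a) → Goal κ t p g
    positive-literal {κ} {t} {p} {g} t′ p′ {a} t≤ p< a< eq l =
      X t′ p′ a , X-< t≤ p< a< , subst (λ b → LitAt b κ t p g (X t′ p′ a)) (sym (σ-true t′ p′ p< eq)) l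

    negative-literal : ∀ {κ t p g} t′ p′ {a} → t′ ≤ T → p′ < 2 + P → a < d → a ≢ truth-at t′ p′ →
                       LitAt false κ t p g (X t′ p′ a) → Goal κ t p g
    negative-literal {κ} {t} {p} {g} t′ p′ {a} t≤ p< a< ne l =
      X t′ p′ a , X-< t≤ p< a< , subst (λ b → LitAt b κ t p g (X t′ p′ a)) (sym (σ-false t′ p′ p< a< ne)) l

    T< : T < 2 + P
    T< = ≤-trans (≤-<-trans (m≤m+n T T) 2T<P) (≤-trans (n≤1+n P) (n≤1+n _))

    -- A window that differs from the run in one of its four columns has a true negative literal
    -- there. Otherwise it is the window of the run, and locality makes the positive literal true.
    step-literal : ∀ {t p g} → t < T → p < P → g < Γ → Goal 0 t p g
    step-literal {t} {p} {g} t< p< g< with α 0 g ≟ truth-at t T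
    ... | no ne = negative-literal t T (<⇒≤ t<) T< (α-< 0 g<) ne (inj₁ (refl , inj₁ refl))
    ... | yes e₀ with α 1 g ≟ truth-at t p
    ... | no ne = negative-literal t p (<⇒≤ t<) p<₀ (α-< 1 g<) ne (inj₁ (refl , inj₂ (inj₁ refl)))
      where
      p<₀ : p < 2 + P
      p<₀ = ≤-trans p< (≤-trans (n≤1+n P) (n≤1+n _))
    ... | yes e₁ with α 2 g ≟ truth-at t (suc p)
    ... | no ne = negative-literal t (suc p) (<⇒≤ t<) (s≤s (m<n⇒m<1+n p<)) (α-< 2 g<) ne
                    (inj₁ (refl , inj₂ (inj₂ (inj₁ refl))))
    ... | yes e₂ with α 3 g ≟ truth-at t (suc (suc p))
    ... | no ne = negative-literal t (suc (suc p)) (<⇒≤ t<) (s≤s (s≤s p<)) (α-< 3 g<) ne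
                    (inj₁ (refl , inj₂ (inj₂ (inj₂ refl))))
    ... | yes e₃ = derived (near T p)
      where
      part-≡ : ∀ k {w} → α k g ≡ num w → part k (window g) ≡ w
      part-≡ k e = number-injective columns (trans (sym (table-< Γ _ _ g<)) e)
      new : ∀ {κ} → Near T p κ → β κ g ≡ truth-at (suc t) (suc p)
      new {κ} near = trans (table-< Γ _ _ g<) (cong num (trans
        (cong (updated κ) (cong₂ _,_ (part-≡ 0 e₀) (cong₂ _,_ (part-≡ 1 e₁) (cong₂ _,_ (part-≡ 2 e₂) (part-≡ 3 e₃)))))
        (sym (column-follow T p near (conf t)))))
      literal : ∀ {κ} → Near T p κ → LitAt true 0 t p g (X (suc t) (suc p) (β κ g)) → Goal 0 t p g
      literal {κ} near l =
        positive-literal (suc t) (suc p) t< (s≤s (m<n⇒m<1+n p<)) (β-< κ g<) (new near) l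
      derived : ∃[ κ ] Near T p κ → Goal 0 t p g
      derived (_ , at-left e)     = literal (at-left e) (inj₁ (refl , inj₁ (e , refl)))
      derived (_ , at-middle e)   = literal (at-middle e) (inj₁ (refl , inj₂ (inj₁ (e , refl))))
      derived (_ , at-right e)    = literal (at-right e) (inj₁ (refl , inj₂ (inj₂ (inj₁ (e , refl)))))
      derived (_ , away a b c)    = literal (away a b c) (inj₁ (refl , inj₂ (inj₂ (inj₂ ((a , b , c) , refl)))))

    clause-literal : ∀ κ {t p g} → κ < 4 → t < T → p < P → g < Γ → Goal κ t p g
    clause-literal 0 _ t< p< g< = step-literal t< p< g<
    clause-literal 1 {t} {p} {g} _ t< p< g< =
      positive-literal 0 p z≤n (≤-trans p< (≤-trans (n≤1+n P) (n≤1+n _))) (number-< columns _) refl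
        (inj₂ (inj₁ (refl , truth-at 0 p , number-< columns _ , allowed-initial c≤q p , refl)))
    -- Up to the end flag of the word the clause contains the blank at p with both signs, since
    -- blanks in front of the head are followed by the word.
    clause-literal 2 {t} {p} {g} _ t< p< g< with blankᶠ ≟ truth-at 0 p | p ≤? T + ℓ * 2
    ... | no ne | _      = negative-literal 0 p z≤n (≤-trans p< (≤-trans (n≤1+n P) (n≤1+n _))) (number-< columns _) ne
                             (inj₂ (inj₁ (refl , refl)))
    ... | yes e | yes p≤ = positive-literal 0 p z≤n (≤-trans p< (≤-trans (n≤1+n P) (n≤1+n _))) (number-< columns _) e
                             (inj₂ (inj₂ (inj₁ (refl , inj₂ (p≤ , refl)))))
    ... | yes e | no p≰  = positive-literal 0 (suc p) z≤n (s≤s (m<n⇒m<1+n p<)) (number-< columns _)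
                             (blank-stays p (≰⇒> p≰) e) (inj₂ (inj₂ (inj₁ (refl , inj₁ refl))))
    clause-literal 3 {t} {p} {g} _ t< p< g< with α 0 g ≟ truth-at T T
    ... | no ne = negative-literal T T ≤-refl T< (α-< 0 g<) ne (inj₂ (inj₂ (refl , refl)))
    ... | yes e = positive-literal T T ≤-refl T< (α-< 0 g<) e (inj₂ (inj₂ (inj₂ (refl , accepts-1 , refl))))
      where
      accepts-1 : accepts g ≡ 1
      accepts-1 = trans (table-< Γ _ _ g<)
        (cong ⌜_⌝ (trans (cong accepting (number-injective columns (trans (sym (table-< Γ _ _ g<)) e))) acc))
    clause-literal (suc (suc (suc (suc _)))) (s≤s (s≤s (s≤s (s≤s ()))))

    satisfying : ∀ j → 0 < j → j < clauses → Some variables (λ i → Lit (σ i) i j)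
    satisfying (suc j) _ (s≤s j<)
      with radix-exists {j} (T * P * Γ) 4 j<
    ... | κ , h , κ< , h< , refl with radix-exists {h} (T * P) Γ h<
    ... | g , h′ , g< , h′< , refl with radix-exists {h′} T P h′<
    ... | p , t , p< , t< , refl with clause-literal κ κ< t< p< g<
    ... | i , i< , l = i , i< , t , t< , p , p< , g , g< , κ , κ< , refl , l

-- From NP to satisfiability

record SatProblem (L : Language) : Set₁ where
  field
    variables clauses  : List Bool → ℕ
    Lit                : List Bool → Bool → ℕ → ℕ → Set
    unused             : ∀ x b j → ¬ Lit x b 0 j
    variables-nonZero  : ∀ x → 0 < variables x
    clauses-≥2         : ∀ x → 2 ≤ clauses x
    satisfiable        : ∀ x → L x ⇔ Satisfiable (variables x) (clauses x) (Lit x)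
    variablesᶜ         : ∀ {n} → Computable {n} (λ x ρ → variables x)
    clausesᶜ           : ∀ {n} → Computable {n} (λ x ρ → clauses x)
    Litᵈ               : ∀ b → Definable {2} (λ x ρ → Lit x b (proj₁ ρ) (proj₁ (proj₂ ρ)))

module SatOfVerifier (M : TuringMachine) (columns : Code (Frame.Column M))
         (windows : Code (Frame.Column M × Frame.Column M × Frame.Column M × Frame.Column M))
         (timeBound certificateBound : Polynomial) where
  open Frame M
  open TuringMachine M hiding (tapes)
  open Run M using (initial; _⇓[_]_; Outputs; config)
  open Tableau M columns windows

  -- The paired word has length at most 1 + 2ℓ + q. The outer `suc` of `steps` makes T positive, so
  -- that row 0 has clauses. `width` exceeds both T + T, for the shrinking region, and T + 2ℓ + q,
  -- for the input.
  q steps width : List Bool → ℕ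
  q x = eval certificateBound (length x)
  steps x = suc (eval timeBound (suc (length x * 2 + q x)))
  width x = suc (steps x + steps x + (length x * 2 + q x))

  module _ (x : List Bool) where
    open Clauses (steps x) (width x) (q x) x using (variables; clauses; Lit) public

  2T<P : ∀ x → steps x + steps x < width x
  2T<P x = s≤s (m≤m+n (steps x + steps x) _)

  input<P : ∀ x → steps x + (length x * 2 + q x) < width x
  input<P x = s≤s (+-monoˡ-≤ _ (m≤m+n (steps x) (steps x)))

  module _ {verify : List Bool → Bool}
           (runs : ∀ z → ∃[ t ] ∃[ c ] initial z ⇓[ t ] c × t ≤ eval timeBound (length z) ×
                         Outputs c [ verify z ]) where

    final-accepting : ∀ W c b → Outputs c [ b ] → accepting (column W c W) ≡ b
    final-accepting W (config s (t ∷ ts)) b out rewrite cell-scanned W t = first (scanned t) out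
      where
      first : ∀ a {as ss} → untilBlank (a ∷ as) ≡ inj₁ b ∷ [] → accepting (s , a ∷ ss) ≡ b
      first (just (inj₁ _)) eq = inj₁-injective (∷-injectiveˡ eq)
      first (just (inj₂ _)) ()
      first nothing         ()

    accepting-≡ : ∀ x c → length c ≤ q x →
                  accepting (column (steps x) (row (initial ⟨ x , c ⟩) (steps x)) (steps x)) ≡ verify ⟨ x , c ⟩
    accepting-≡ x c c≤q with runs ⟨ x , c ⟩
    ... | t , conf , halts , t≤ , out
      rewrite row-⇓ (steps x) halts (≤-trans t≤ (≤-trans (eval-mono timeBound
                (≤-trans (≤-reflexive (length-pair x c)) (s≤s (+-monoʳ-≤ (length x * 2) c≤q)))) (n≤1+n _)))
      = final-accepting (steps x) conf _ out

    satisfiable⇔ : ∀ x → (∃[ c ] length c ≤ q x × verify ⟨ x , c ⟩ ≡ true) ⇔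
                         Satisfiable (variables x) (clauses x) (Lit x)
    satisfiable⇔ x = mk⇔ to from
      where
      to : ∃[ c ] length c ≤ q x × verify ⟨ x , c ⟩ ≡ true → Satisfiable (variables x) (clauses x) (Lit x)
      to (c , c≤q , accept) =
        TableauComplete.σ M columns windows (steps x) (width x) (q x) x c ,
        TableauComplete.satisfying M columns windows (steps x) (width x) (q x) x c (2T<P x) c≤q
          (trans (accepting-≡ x c c≤q) accept)
      from : Satisfiable (variables x) (clauses x) (Lit x) → ∃[ c ] length c ≤ q x × verify ⟨ x , c ⟩ ≡ true
      from (σ , sat) = certificateOf , read-length (q x) 0 ,
        trans (sym (accepting-≡ x certificateOf (read-length (q x) 0))) accepted
        where
        open Clauses.Sound (steps x) (width x) (q x) x (2T<P x) (input<P x) (s≤s z≤n) σ sat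

  clauses≥2 : ∀ x → 2 ≤ clauses x
  clauses≥2 x = ≤-trans (s≤s (s≤s z≤n))
    (Clauses.index-< (steps x) (width x) (q x) x {0} {0} {0} {number windows (window 0)}
      (s≤s z≤n) (s≤s z≤n) (s≤s z≤n) (number-< windows (window 0)))

  qᶜ : Computable {n} (λ x ρ → q x)
  qᶜ = evalᶜ certificateBound lenᶜ

  Tᶜ : Computable {n} (λ x ρ → steps x)
  Tᶜ = sucᶜ (evalᶜ timeBound (sucᶜ (lenᶜ *ᶜ constᶜ 2 +ᶜ qᶜ)))

  Pᶜ : Computable {n} (λ x ρ → width x)
  Pᶜ = sucᶜ (Tᶜ +ᶜ Tᶜ +ᶜ (lenᶜ *ᶜ constᶜ 2 +ᶜ qᶜ))

  Xᶜ : {t p a : List Bool → Env n → ℕ} → Computable t → Computable p → Computable a →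
       Computable (λ x ρ → Clauses.X (steps x) (width x) (q x) x (t x ρ) (p x ρ) (a x ρ))
  Xᶜ t p a = sucᶜ (a +ᶜ (p +ᶜ t *ᶜ (constᶜ 2 +ᶜ Pᶜ)) *ᶜ constᶜ d)

  Allowedᵈ : {p a : List Bool → Env n → ℕ} → Computable p → Computable a →
             Definable (λ x ρ → Clauses.Allowed (steps x) (width x) (q x) x (p x ρ) (a x ρ))
  Allowedᵈ p a =
    (p <ᵈ Tᶜ) ×ᵈ (a ≡ᵈ constᶜ blankᶠ) ⊎ᵈ
    someᵈ lenᶜ (wkᶜ p ≡ᵈ Tᶜ +ᶜ v₀ *ᶜ constᶜ 2 ×ᵈ wkᶜ a ≡ᵈ constᶜ oneᶠ) ⊎ᵈ
    someᵈ lenᶜ (wkᶜ p ≡ᵈ Tᶜ +ᶜ sucᶜ (v₀ *ᶜ constᶜ 2) ×ᵈ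
      (bitᵈ v₀ ×ᵈ wkᶜ a ≡ᵈ constᶜ oneᶠ ⊎ᵈ (¬ᵈ bitᵈ v₀) ×ᵈ wkᶜ a ≡ᵈ constᶜ zeroᶠ)) ⊎ᵈ
    p ≡ᵈ Tᶜ +ᶜ lenᶜ *ᶜ constᶜ 2 ×ᵈ a ≡ᵈ constᶜ zeroᶠ ⊎ᵈ
    someᵈ qᶜ (wkᶜ p ≡ᵈ Tᶜ +ᶜ (lenᶜ *ᶜ constᶜ 2 +ᶜ sucᶜ v₀) ×ᵈ
      (wkᶜ a ≡ᵈ constᶜ zeroᶠ ⊎ᵈ wkᶜ a ≡ᵈ constᶜ oneᶠ)) ⊎ᵈ
    (Tᶜ +ᶜ lenᶜ *ᶜ constᶜ 2) <ᵈ p ×ᵈ a ≡ᵈ constᶜ blankᶠ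

  indexᶜ : {κ t p g : List Bool → Env n → ℕ} → Computable κ → Computable t → Computable p → Computable g →
           Computable (λ x ρ → Clauses.index (steps x) (width x) (q x) x (κ x ρ) (t x ρ) (p x ρ) (g x ρ))
  indexᶜ κ t p g = sucᶜ (κ +ᶜ (g +ᶜ (p +ᶜ t *ᶜ Pᶜ) *ᶜ constᶜ Γ) *ᶜ constᶜ 4)

  αᶜ : ∀ k {g : List Bool → Env n → ℕ} → Computable g → Computable (λ x ρ → α k (g x ρ))
  αᶜ k = tableᶜ Γ (λ g → num (part k (window g)))

  βᶜ : ∀ κ {g : List Bool → Env n → ℕ} → Computable g → Computable (λ x ρ → β κ (g x ρ))
  βᶜ κ = tableᶜ Γ (λ g → num (updated κ (window g)))

  LitAtᵈ : ∀ b {κ t p g i : List Bool → Env n → ℕ} →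
           Computable κ → Computable t → Computable p → Computable g → Computable i →
           Definable (λ x ρ → Clauses.LitAt (steps x) (width x) (q x) x b (κ x ρ) (t x ρ) (p x ρ) (g x ρ) (i x ρ))
  LitAtᵈ true κ t p g i =
    κ ≡ᵈ constᶜ 0 ×ᵈ
      (p ≡ᵈ Tᶜ ×ᵈ i ≡ᵈ Xᶜ (sucᶜ t) (sucᶜ p) (βᶜ 1 g) ⊎ᵈ
       sucᶜ p ≡ᵈ Tᶜ ×ᵈ i ≡ᵈ Xᶜ (sucᶜ t) (sucᶜ p) (βᶜ 2 g) ⊎ᵈ
       sucᶜ (sucᶜ p) ≡ᵈ Tᶜ ×ᵈ i ≡ᵈ Xᶜ (sucᶜ t) (sucᶜ p) (βᶜ 3 g) ⊎ᵈ
       ((¬ᵈ (p ≡ᵈ Tᶜ)) ×ᵈ (¬ᵈ (sucᶜ p ≡ᵈ Tᶜ)) ×ᵈ (¬ᵈ (sucᶜ (sucᶜ p) ≡ᵈ Tᶜ))) ×ᵈ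
         i ≡ᵈ Xᶜ (sucᶜ t) (sucᶜ p) (βᶜ 0 g)) ⊎ᵈ
    κ ≡ᵈ constᶜ 1 ×ᵈ someᵈ (constᶜ d) (Allowedᵈ (wkᶜ p) v₀ ×ᵈ wkᶜ i ≡ᵈ Xᶜ (constᶜ 0) (wkᶜ p) v₀) ⊎ᵈ
    κ ≡ᵈ constᶜ 2 ×ᵈ
      (i ≡ᵈ Xᶜ (constᶜ 0) (sucᶜ p) (constᶜ blankᶠ) ⊎ᵈ
       p ≤ᵈ Tᶜ +ᶜ lenᶜ *ᶜ constᶜ 2 ×ᵈ i ≡ᵈ Xᶜ (constᶜ 0) p (constᶜ blankᶠ)) ⊎ᵈ
    κ ≡ᵈ constᶜ 3 ×ᵈ tableᶜ Γ (λ g → ⌜ accepting (part 0 (window g)) ⌝) g ≡ᵈ constᶜ 1 ×ᵈ i ≡ᵈ Xᶜ Tᶜ Tᶜ (αᶜ 0 g)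
  LitAtᵈ false κ t p g i =
    κ ≡ᵈ constᶜ 0 ×ᵈ
      (i ≡ᵈ Xᶜ t Tᶜ (αᶜ 0 g) ⊎ᵈ i ≡ᵈ Xᶜ t p (αᶜ 1 g) ⊎ᵈ
       i ≡ᵈ Xᶜ t (sucᶜ p) (αᶜ 2 g) ⊎ᵈ i ≡ᵈ Xᶜ t (sucᶜ (sucᶜ p)) (αᶜ 3 g)) ⊎ᵈ
    κ ≡ᵈ constᶜ 2 ×ᵈ i ≡ᵈ Xᶜ (constᶜ 0) p (constᶜ blankᶠ) ⊎ᵈ
    κ ≡ᵈ constᶜ 3 ×ᵈ i ≡ᵈ Xᶜ Tᶜ Tᶜ (αᶜ 0 g)

  literals : ∀ b → Definable {2} (λ x ρ → Lit x b (proj₁ ρ) (proj₁ (proj₂ ρ)))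
  literals b = someᵈ Tᶜ (someᵈ Pᶜ (someᵈ (constᶜ Γ) (someᵈ (constᶜ 4)
    (v₅ ≡ᵈ indexᶜ v₀ v₃ v₂ v₁ ×ᵈ LitAtᵈ b v₀ v₃ v₂ v₁ v₄))))

np⇒sat : ∀ {L} → NP L → SatProblem L
np⇒sat {L} (verify , bound , (M , p , runs) , spec) = record
  { variables         = variables
  ; clauses           = clauses
  ; Lit               = Lit
  ; unused            = λ x → Clauses.Lit-0 (steps x) (width x) (eval bound (length x)) x
  ; variables-nonZero = λ x → s≤s z≤n
  ; clauses-≥2        = clauses≥2
  ; satisfiable       = λ x → mk⇔
      (Equivalence.to (satisfiable⇔ runs x) ∘ Equivalence.to (spec x))
      (Equivalence.from (spec x) ∘ Equivalence.from (satisfiable⇔ runs x))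
  ; variablesᶜ        = sucᶜ (sucᶜ Tᶜ *ᶜ (constᶜ 2 +ᶜ Pᶜ) *ᶜ constᶜ d)
  ; clausesᶜ          = sucᶜ (Tᶜ *ᶜ Pᶜ *ᶜ constᶜ Γ *ᶜ constᶜ 4)
  ; Litᵈ              = literals
  }
  where
  open SatOfVerifier M (columnCode M)
    (code-× (columnCode M) (code-× (columnCode M) (code-× (columnCode M) (columnCode M)))) p bound
  open Tableau M (columnCode M)
    (code-× (columnCode M) (code-× (columnCode M) (code-× (columnCode M) (columnCode M))))
    using (d; Γ; module Clauses)

-- Shortest walks

least : {P : ℕ → Set} → (∀ k → Dec (P k)) → ∀ n → P n → ∃[ k ] P k × (∀ j → P j → k ≤ j)
least P? zero    p = 0 , p , λ _ _ → z≤n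
least P? (suc n) p with P? 0
... | yes p₀ = 0 , p₀ , λ _ _ → z≤n
... | no ¬p₀ with least (P? ∘ suc) n p
...   | k , pk , min = suc k , pk , λ { zero q → contradiction q ¬p₀ ; (suc j) q → s≤s (min j q) }

lookup-injective : ∀ {as : List A} → Unique as → ∀ i j → Data.List.lookup as i ≡ Data.List.lookup as j → i ≡ j
lookup-injective (a∉ ∷ u) zero    zero    eq = refl
lookup-injective (a∉ ∷ u) zero    (suc j) eq = contradiction eq (All.lookup a∉ (∈-lookup j))
lookup-injective (a∉ ∷ u) (suc i) zero    eq = contradiction (sym eq) (All.lookup a∉ (∈-lookup i))
lookup-injective (a∉ ∷ u) (suc i) (suc j) eq = cong suc (lookup-injective u i j eq)

module Walks (G : Graph) where
  open Graph G

  infixr 5 _++ʷ_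

  _++ʷ_ : ∀ {u v w} → Walk G u v → Walk G v w → Walk G u w
  stop     ++ʷ q = q
  step e p ++ʷ q = step e (p ++ʷ q)

  edgeCount-++ : ∀ {u v w} (p : Walk G u v) (q : Walk G v w) → edgeCount (p ++ʷ q) ≡ edgeCount p + edgeCount q
  edgeCount-++ stop       q = refl
  edgeCount-++ (step e p) q = cong suc (edgeCount-++ p q)

  _⟶[_]_ : Vertex → ℕ → Vertex → Set
  u ⟶[ k ] v = Σ[ w ∈ Walk G u v ] edgeCount w ≡ k

  walk? : ∀ k u v → Dec (u ⟶[ k ] v)
  walk? zero    u v = map′ (λ { refl → stop , refl }) (λ { (stop , _) → refl }) (u Fin.≟ v)
  walk? (suc k) u v = map′ (λ (w , e , p , eq) → step e p , cong suc eq)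
                           (λ { (step {v = w} e p , eq) → w , e , p , suc-injective eq })
                           (Fin.any? λ w → T? (adjacent u w) ×-dec walk? k w v)

  Minimal : ∀ {u v} → Walk G u v → Set
  Minimal {u} {v} w = (w′ : Walk G u v) → edgeCount w ≤ edgeCount w′

  minimal : ∀ {u v} → Walk G u v → Σ[ w ∈ Walk G u v ] Minimal w
  minimal {u} {v} w with least (λ k → walk? k u v) (edgeCount w) (w , refl)
  ... | _ , (w₀ , refl) , min = w₀ , λ w′ → min _ (w′ , refl)

  suffix : ∀ {u v x} (w : Walk G u v) → x ∈ˡ vertices w → Σ[ w′ ∈ Walk G x v ] edgeCount w′ ≤ edgeCount w
  suffix stop       (here refl) = stop , ≤-refl
  suffix (step e w) (here refl) = step e w , ≤-refl
  suffix (step e w) (there x∈)  with suffix w x∈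
  ... | w′ , ≤ = w′ , ≤-trans ≤ (n≤1+n _)

  -- A repetition of the first vertex would leave a shorter walk from its second occurrence, and
  -- tails of minimal walks are minimal.
  minimal⇒unique : ∀ {u v} (w : Walk G u v) → Minimal w → Unique (vertices w)
  minimal⇒unique stop       min = All.[] ∷ []
  minimal⇒unique {u} (step e w) min =
    ¬Any⇒All¬ (vertices w) (λ u∈ → ≤⇒≯ (min (proj₁ (suffix w u∈))) (s≤s (proj₂ (suffix w u∈))))
    ∷ minimal⇒unique w (λ w′ → ≤-pred (min (step e w′)))

  minimal⇒shortest : ∀ {u v} (w : Walk G u v) → Minimal w → ShortestPath G u v
  minimal⇒shortest w min = record
    { path = record { walk = w ; simple = minimal⇒unique w min }
    ; shortest = λ p → min (walk p)
    }

  -- `shortest` compares with simple paths only; but a minimal walk is simple, so the comparison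
  -- extends to all walks.
  shortest-≤ : ∀ {u v} (s : ShortestPath G u v) → Minimal (walk (path s))
  shortest-≤ s w with minimal w
  ... | w₀ , min = ≤-trans (shortest s (record { walk = w₀ ; simple = minimal⇒unique w₀ min })) (min w)

  length-vertices : ∀ {u v} (w : Walk G u v) → length (vertices w) ≡ suc (edgeCount w)
  length-vertices stop       = refl
  length-vertices (step e w) = cong suc (length-vertices w)

  minimal-< : ∀ {u v} (w : Walk G u v) → Minimal w → edgeCount w < order
  minimal-< w min = subst (_≤ order) (length-vertices w)
    (Fin.injective⇒≤ (λ {i} {j} → lookup-injective (minimal⇒unique w min) i j))

  module Distances (walks : ∀ u v → Walk G u v) where

    geodesic : ∀ u v → Walk G u v
    geodesic u v = proj₁ (minimal (walks u v))

    geodesic-minimal : ∀ u v → Minimal (geodesic u v)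
    geodesic-minimal u v = proj₂ (minimal (walks u v))

    dist : Vertex → Vertex → ℕ
    dist u v = edgeCount (geodesic u v)

    dist-≤ : ∀ {u v} (w : Walk G u v) → dist u v ≤ edgeCount w
    dist-≤ {u} {v} = geodesic-minimal u v

    isConnected : Connected G
    isConnected u v = path (minimal⇒shortest (geodesic u v) (geodesic-minimal u v))

    distance : ∀ u v → Distance G u v (dist u v)
    distance u v = minimal⇒shortest (geodesic u v) (geodesic-minimal u v) , refl

    distance-unique : ∀ {u v k} → Distance G u v k → k ≡ dist u v
    distance-unique {u} {v} (s , refl) =
      ≤-antisym (shortest-≤ s (geodesic u v)) (dist-≤ (walk (path s)))

    largest : ∀ k .{{_ : NonZero k}} (f : Fin k → ℕ) → ∃[ i ] (∀ j → f j ≤ f i)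
    largest (suc zero)    f = zero , λ { zero → ≤-refl }
    largest (suc (suc k)) f with largest (suc k) (f ∘ suc)
    ... | i , max with f zero ≤? f (suc i)
    ...   | yes ≤ = suc i , λ { zero → ≤ ; (suc j) → max j }
    ...   | no ≰  = zero , λ { zero → ≤-refl ; (suc j) → ≤-trans (max j) (<⇒≤ (≰⇒> ≰)) }

    diameter : ∀ {b} → (∀ u v → dist u v ≤ b) → ∃[ D ] Diameter G D × D ≤ b
    diameter {b} dist≤ =
      dist u (far u) , ((u , far u , distance u (far u)) , max) , dist≤ u (far u)
      where
      far : Vertex → Vertex
      far u = proj₁ (largest order (dist u))
      u : Vertex
      u = proj₁ (largest order (λ u → dist u (far u)))
      max : ∀ v w k → Distance G v w k → k ≤ dist u (far u)
      max v w k d rewrite distance-unique d =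
        ≤-trans (proj₂ (largest order (dist v)) w) (proj₂ (largest order (λ u → dist u (far u))) v)

-- The bits of an encoded input

bitAt-++ˡ : ∀ xs ys {i} → i < length xs → bitAt (xs ++ ys) i ≡ bitAt xs i
bitAt-++ˡ (x ∷ xs) ys {zero}  _         = refl
bitAt-++ˡ (x ∷ xs) ys {suc i} (s≤s i<n) = bitAt-++ˡ xs ys i<n

bitAt-++ʳ : ∀ xs ys i → bitAt (xs ++ ys) (length xs + i) ≡ bitAt ys i
bitAt-++ʳ []       ys i = refl
bitAt-++ʳ (x ∷ xs) ys i = bitAt-++ʳ xs ys i

bitAt-≥ : ∀ xs {i} → length xs ≤ i → bitAt xs i ≡ false
bitAt-≥ []       _         = refl
bitAt-≥ (x ∷ xs) (s≤s n≤i) = bitAt-≥ xs n≤i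

bitAt-ext : ∀ {xs ys} → length xs ≡ length ys → (∀ i → i < length xs → bitAt xs i ≡ bitAt ys i) → xs ≡ ys
bitAt-ext {[]}     {[]}     _ _  = refl
bitAt-ext {x ∷ xs} {y ∷ ys} l eq =
  cong₂ _∷_ (eq 0 (s≤s z≤n)) (bitAt-ext (suc-injective l) (λ i i< → eq (suc i) (s≤s i<)))

bitAt-replicate : ∀ n b {i} → i < n → bitAt (replicate n b) i ≡ b
bitAt-replicate (suc n) b {zero}  _         = refl
bitAt-replicate (suc n) b {suc i} (s≤s i<n) = bitAt-replicate n b i<n

bitAt-tabulate : ∀ {n} (f : A → Bool) (g : Fin n → A) i → bitAt (map f (Data.List.tabulate g)) (toℕ i) ≡ f (g i)
bitAt-tabulate f g zero    = refl
bitAt-tabulate f g (suc i) = bitAt-tabulate f (g ∘ suc) i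

bitAt-toList : ∀ {n} (v : Vec Bool n) i → bitAt (Vec.toList v) (toℕ i) ≡ Vec.lookup v i
bitAt-toList (b ∷ v) zero    = refl
bitAt-toList (b ∷ v) (suc i) = bitAt-toList v i

module _ {N : ℕ} (f : A → List Bool) (length-f : ∀ a → length (f a) ≡ N) where

  length-rows : ∀ {n} (g : Fin n → A) → length (concatMap f (Data.List.tabulate g)) ≡ n * N
  length-rows {zero}  g = refl
  length-rows {suc n} g = trans (length-++ (f (g zero))) (cong₂ _+_ (length-f (g zero)) (length-rows (g ∘ suc)))

  bitAt-rows : ∀ {n} (g : Fin n → A) i {j} → j < N →
               bitAt (concatMap f (Data.List.tabulate g)) (j + toℕ i * N) ≡ bitAt (f (g i)) j
  bitAt-rows g zero {j} j<N =
    trans (cong (bitAt (concatMap f (Data.List.tabulate g))) (+-identityʳ j))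
          (bitAt-++ˡ (f (g zero)) _ (subst (j <_) (sym (length-f _)) j<N))
  bitAt-rows g (suc i) {j} j<N =
    trans (cong (bitAt (concatMap f (Data.List.tabulate g))) shifted)
      (trans (bitAt-++ʳ (f (g zero)) _ (j + toℕ i * N)) (bitAt-rows (g ∘ suc) i j<N))
    where
    shifted : j + (N + toℕ i * N) ≡ length (f (g zero)) + (j + toℕ i * N)
    shifted rewrite length-f (g zero) = lemma j N (toℕ i * N)
      where
      lemma : ∀ j N k → j + (N + k) ≡ N + (j + k)
      lemma = solve-∀

-- Fixes a code word by its bits. Decoded inputs and printed words are identified with `encodeInput`
-- through `encodes-unique`, without any computation on lists.
record Encodes (y : List Bool) (N : ℕ) (adjacent : Fin N → Fin N → Bool) (S : Subset N) : Set where
  field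
    length-y : length y ≡ N + suc (N * N + N)
    ones     : ∀ {i} → i < N → bitAt y i ≡ true
    stop-bit : bitAt y N ≡ false
    matrix   : ∀ u v → bitAt y (N + suc (toℕ v + toℕ u * N)) ≡ adjacent u v
    members  : ∀ u → bitAt y (N + suc (N * N + toℕ u)) ≡ Vec.lookup S u

open Encodes public

encodes : ∀ i → Encodes (encodeInput i) (Graph.order (graph i)) (Graph.adjacent (graph i)) (set i)
encodes i = record
  { length-y = trans (length-++ (replicate N true)) (cong₂ _+_ (length-replicate N)
      (cong suc (trans (length-++ rows) (cong₂ _+_ (length-rows row length-row id) (Vec.length-toList (set i))))))
  ; ones = λ i<N → trans (bitAt-++ˡ (replicate N true) _ (subst (_ <_) (sym (length-replicate N)) i<N))
                         (bitAt-replicate N true i<N)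
  ; stop-bit = trans (cong (bitAt y) (sym (+-identityʳ N))) (after 0)
  ; matrix = λ u v → trans (after (suc (toℕ v + toℕ u * N)))
      (trans (bitAt-++ˡ rows _ (subst (toℕ v + toℕ u * N <_) (sym (length-rows row length-row id))
          (radix-< (Fin.toℕ<n v) (Fin.toℕ<n u))))
        (trans (bitAt-rows row length-row id u (Fin.toℕ<n v)) (bitAt-tabulate (adjacent u) id v)))
  ; members = λ u → trans (after (suc (N * N + toℕ u)))
      (trans (cong (λ k → bitAt (rows ++ Vec.toList (set i)) (k + toℕ u)) (sym (length-rows row length-row id)))
        (trans (bitAt-++ʳ rows _ (toℕ u)) (bitAt-toList (set i) u)))
  }
  where
  open Graph (graph i) renaming (order to N)
  row : Fin N → List Bool
  row u = map (adjacent u) (Data.List.allFin N)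
  rows y : List Bool
  rows = concatMap row (Data.List.allFin N)
  y = encodeInput i
  length-row : ∀ u → length (row u) ≡ N
  length-row u = trans (length-map (adjacent u) (Data.List.allFin N)) (length-tabulate id)
  after : ∀ k → bitAt y (N + k) ≡ bitAt (false ∷ rows ++ Vec.toList (set i)) k
  after k = trans (cong (λ l → bitAt y (l + k)) (sym (length-replicate N)))
                  (bitAt-++ʳ (replicate N true) _ k)

data Position (N : ℕ) : ℕ → Set where
  one  : ∀ {i} → i < N → Position N i
  stop : Position N N
  edge : ∀ u v → Position N (N + suc (toℕ {N} v + toℕ {N} u * N))
  elem : ∀ u → Position N (N + suc (N * N + toℕ {N} u))

position : ∀ N i → i < N + suc (N * N + N) → Position N i
position N i i< with i <? N
... | yes i<N = one i<N
... | no i≮N  = subst (Position N) (m+[n∸m]≡n (≮⇒≥ i≮N))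
                  (at (i ∸ N) (+-cancelˡ-< N _ _ (subst (_< _) (sym (m+[n∸m]≡n (≮⇒≥ i≮N))) i<)))
  where
  at : ∀ k → k < suc (N * N + N) → Position N (N + k)
  at zero    _        = subst (Position N) (sym (+-identityʳ N)) stop
  at (suc k) (s≤s k<) with k <? N * N
  ... | yes k<NN = from-radix (radix-exists {k} N N k<NN)
    where
    from-radix : Σ[ v ∈ ℕ ] Σ[ u ∈ ℕ ] v < N × u < N × k ≡ v + u * N → Position N (N + suc k)
    from-radix (v , u , v< , u< , refl) =
      subst₂ (λ v u → Position N (N + suc (v + u * N))) (Fin.toℕ-fromℕ< v<) (Fin.toℕ-fromℕ< u<)
        (edge (fromℕ< u<) (fromℕ< v<))
  ... | no k≮NN = subst (λ k → Position N (N + suc k)) (m+[n∸m]≡n (≮⇒≥ k≮NN))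
      (subst (λ j → Position N (N + suc (N * N + j))) (Fin.toℕ-fromℕ< j<) (elem (fromℕ< j<)))
    where
    j< : k ∸ N * N < N
    j< = +-cancelˡ-< (N * N) _ _ (subst (_< N * N + N) (sym (m+[n∸m]≡n (≮⇒≥ k≮NN))) k<)

encodes-unique : ∀ {y z N adjacent S} → Encodes y N adjacent S → Encodes z N adjacent S → y ≡ z
encodes-unique {y} {z} {N} ey ez =
  bitAt-ext (trans (length-y ey) (sym (length-y ez))) λ i i< → same (position N i (subst (i <_) (length-y ey) i<))
  where
  same : ∀ {i} → Position N i → bitAt y i ≡ bitAt z i
  same (one i<)   = trans (ones ey i<) (sym (ones ez i<))
  same stop       = trans (stop-bit ey) (sym (stop-bit ez))
  same (edge u v) = trans (matrix ey u v) (sym (matrix ez u v))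
  same (elem u)   = trans (members ey u) (sym (members ez u))

-- Certificates for strong geodetic sets

-- D u v k says that v is at distance k from u, and Q u v y that y is on the chosen path from u to v.
Certified : (N : ℕ) (A : ℕ → ℕ → Set) (S : ℕ → Set) (D Q : ℕ → ℕ → ℕ → Set) → Set
Certified N A S D Q =
  All N (λ u → All N λ v → Some N λ k → D u v k) ×
  All N (λ u → All N λ v → D u v 0 → u ≡ v) ×
  All N (λ u → All N λ k → D u u k → k ≡ 0) ×
  All N (λ u → All N λ w → All N λ v → All N λ k → All N λ l → A u w → D u v k → D w v l → k ≤ suc l) ×
  All N (λ u → All N λ v → All N λ k → suc k < N → D u v (suc k) → Some N λ w → A u w × D w v k) ×
  All N (λ u → All N λ v → S u → S v → u < v →
    Q u v u ×
    All N (λ y → All N λ k → suc k < N → Q u v y → D y v (suc k) → Some N λ w → A y w × D w v k × Q u v w) ×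
    All N (λ y → All N λ w → All N λ k → Q u v y → Q u v w → D y v k → D w v k → y ≡ w) ×
    All N (λ y → All N λ k → All N λ l → Q u v y → D y v k → D u v l → k ≤ l)) ×
  All N (λ x → ¬ S x → Some N λ u → Some N λ v → S u × S v × u < v × Q u v x)

BipartiteWithin6 : (N : ℕ) (A : ℕ → ℕ → Set) (D : ℕ → ℕ → ℕ → Set) (side : ℕ → Set) → Set
BipartiteWithin6 N A D side =
  All N (λ u → All N λ v → A u v → side u × ¬ side v ⊎ ¬ side u × side v) ×
  All N (λ u → All N λ v → All N λ k → D u v k → k ≤ 6)

some-fin : ∀ {N} {P : ℕ → Set} → Some N P → Σ[ u ∈ Fin N ] P (toℕ u)
some-fin {P = P} (u , u< , p) = fromℕ< u< , subst P (sym (Fin.toℕ-fromℕ< u<)) p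

module CertifiedGraph (G : Graph) (S : Subset (Graph.order G)) where
  open Graph G renaming (order to N)
  open Walks G

  module Sound (A : ℕ → ℕ → Set) (Sᴺ : ℕ → Set) (D Q : ℕ → ℕ → ℕ → Set)
    (adjacent⇔ : ∀ u v → T (adjacent u v) ⇔ A (toℕ u) (toℕ v)) (member⇔ : ∀ u → u ∈ S ⇔ Sᴺ (toℕ u))
    (certified : Certified N A Sᴺ D Q) where

    total : All N (λ u → All N λ v → Some N λ k → D u v k)
    total = proj₁ certified

    zero-≡ : All N (λ u → All N λ v → D u v 0 → u ≡ v)
    zero-≡ = proj₁ (proj₂ certified)

    self-0 : All N (λ u → All N λ k → D u u k → k ≡ 0)
    self-0 = proj₁ (proj₂ (proj₂ certified))

    lipschitz : All N (λ u → All N λ w → All N λ v → All N λ k → All N λ l → A u w → D u v k → D w v l → k ≤ suc l)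
    lipschitz = proj₁ (proj₂ (proj₂ (proj₂ certified)))

    descent : All N (λ u → All N λ v → All N λ k → suc k < N → D u v (suc k) → Some N λ w → A u w × D w v k)
    descent = proj₁ (proj₂ (proj₂ (proj₂ (proj₂ certified))))

    paths : All N (λ u → All N λ v → Sᴺ u → Sᴺ v → u < v →
      Q u v u ×
      All N (λ y → All N λ k → suc k < N → Q u v y → D y v (suc k) → Some N λ w → A y w × D w v k × Q u v w) ×
      All N (λ y → All N λ w → All N λ k → Q u v y → Q u v w → D y v k → D w v k → y ≡ w) ×
      All N (λ y → All N λ k → All N λ l → Q u v y → D y v k → D u v l → k ≤ l))
    paths = proj₁ (proj₂ (proj₂ (proj₂ (proj₂ (proj₂ certified)))))

    coverage : All N (λ x → ¬ Sᴺ x → Some N λ u → Some N λ v → Sᴺ u × Sᴺ v × u < v × Q u v x)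
    coverage = proj₂ (proj₂ (proj₂ (proj₂ (proj₂ (proj₂ certified)))))

    infix 10 _<N
    _<N : ∀ (u : Fin N) → toℕ u < N
    u <N = Fin.toℕ<n u

    -- Descending one unit at a time realises a table entry by a walk of that length; with the lower
    -- bound `D-lower` the entry is the distance.
    D-walk : ∀ k → k < N → ∀ u v → D (toℕ u) (toℕ v) k → u ⟶[ k ] v
    D-walk zero    k< u v d with Fin.toℕ-injective (zero-≡ _ (u <N) _ (v <N) d)
    ... | refl = stop , refl
    D-walk (suc k) k< u v d with some-fin (descent _ (u <N) _ (v <N) k (<⇒≤ k<) k< d)
    ... | w , a , d′ with D-walk k (<⇒≤ k<) w v d′
    ...   | p , refl = step (Equivalence.from (adjacent⇔ u w) a) p , refl

    -- Along an edge the entry drops by at most one, and at the end of the walk it is 0.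
    D-lower : ∀ {u v} (w : Walk G u v) k → k < N → D (toℕ u) (toℕ v) k → k ≤ edgeCount w
    D-lower {u} stop k k< d = ≤-reflexive (self-0 _ (u <N) k k< d)
    D-lower {u} {v} (step {v = w} e p) k k< d with total _ (w <N) _ (v <N)
    ... | l , l< , d′ = ≤-trans (lipschitz _ (u <N) _ (w <N) _ (v <N) k k< l l<
        (Equivalence.to (adjacent⇔ u w) e) d d′)
                                (s≤s (D-lower p l l< d′))

    some-walk : ∀ u v → Walk G u v
    some-walk u v with total _ (u <N) _ (v <N)
    ... | k , k< , d = proj₁ (D-walk k k< u v d)

    open Distances some-walk public

    module Chosen (u v : Fin N) (u∈ : Sᴺ (toℕ u)) (v∈ : Sᴺ (toℕ v)) (u<v : u Fin.< v) where

      private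
        conditions = paths _ (u <N) _ (v <N) u∈ v∈ u<v

      -- Following `Q` with falling distance to v gives a geodesic. As `Q` has at most one vertex at
      -- each distance and none farther than u, this geodesic meets all of `Q`; the certificate thus
      -- needs sets of vertices only, not sequences.
      Tracks : ∀ {y} → ℕ → Walk G y v → Set
      Tracks k w = edgeCount w ≡ k ×
        (∀ x j → j < N → j ≤ k → Q (toℕ u) (toℕ v) (toℕ x) → D (toℕ x) (toℕ v) j → x ∈ˡ vertices w)

      follow : ∀ k → k < N → ∀ y → Q (toℕ u) (toℕ v) (toℕ y) → D (toℕ y) (toℕ v) k → Σ[ w ∈ Walk G y v ] Tracks k w
      follow zero k< y qy dy with Fin.toℕ-injective (zero-≡ _ (y <N) _ (v <N) dy)
      ... | refl = stop , refl , λ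
        { x zero _ _ _ dx → here (Fin.toℕ-injective (zero-≡ _ (x <N) _ (v <N) dx)) }
      follow (suc k) k< y qy dy with some-fin (proj₁ (proj₂ conditions) _ (y <N) k (<⇒≤ k<) k< qy dy)
      ... | w , a , dw , qw with follow k (<⇒≤ k<) w qw dw
      ...   | p , refl , tracks = step (Equivalence.from (adjacent⇔ y w) a) p , refl , visits
        where
        visits : ∀ x j → j < N → j ≤ suc k → Q (toℕ u) (toℕ v) (toℕ x) → D (toℕ x) (toℕ v) j → x ∈ˡ (y ∷ vertices p)
        visits x j j< j≤ qx dx with j ≟ suc k
        ... | yes refl = here (Fin.toℕ-injective
                (proj₁ (proj₂ (proj₂ conditions)) _ (x <N) _ (y <N) (suc k) k< qx qy dx dy))
        ... | no j≢    = there (tracks x j j< (≤-pred (≤∧≢⇒< j≤ j≢)) qx dx)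

      length-uv : ℕ
      length-uv = proj₁ (total _ (u <N) _ (v <N))

      length-< : length-uv < N
      length-< = proj₁ (proj₂ (total _ (u <N) _ (v <N)))

      length-D : D (toℕ u) (toℕ v) length-uv
      length-D = proj₂ (proj₂ (total _ (u <N) _ (v <N)))

      tracked : Σ[ w ∈ Walk G u v ] Tracks length-uv w
      tracked = follow length-uv length-< u (proj₁ conditions) length-D

      shortestPath : ShortestPath G u v
      shortestPath = minimal⇒shortest (proj₁ tracked)
        (λ w → ≤-trans (≤-reflexive (proj₁ (proj₂ tracked))) (D-lower w length-uv length-< length-D))

      visited : ∀ x → Q (toℕ u) (toℕ v) (toℕ x) → x ∈ˡ vertices (walk (path shortestPath))
      visited x qx with total _ (x <N) _ (v <N)
      ... | j , j< , dx = proj₂ (proj₂ tracked) x j j<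
        (proj₂ (proj₂ (proj₂ conditions)) _ (x <N) j j< length-uv length-< qx dx length-D) qx dx

    geodetic : StrongGeodetic G S
    geodetic = I , cover
      where
      I : ShortestPathAssignment G S
      I {u} {v} u∈ v∈ u<v =
        Chosen.shortestPath u v (Equivalence.to (member⇔ u) u∈) (Equivalence.to (member⇔ v) v∈) u<v
      cover : ∀ x → x ∉ S → ∃[ u ] ∃[ v ] Σ[ u∈ ∈ u ∈ S ] Σ[ v∈ ∈ v ∈ S ] Σ[ u<v ∈ u Fin.< v ]
                x ∈ˡ vertices (walk (path (I u∈ v∈ u<v)))
      cover x x∉ with some-fin (coverage _ (x <N) (x∉ ∘ Equivalence.from (member⇔ x)))
      ... | u , rest with some-fin rest
      ...   | v , u∈ , v∈ , u<v , q =
        u , v , Equivalence.from (member⇔ u) u∈ , Equivalence.from (member⇔ v) v∈ , u<v ,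
        Chosen.visited u v _ _ u<v x q

    module _ (side : ℕ → Set) (side? : ∀ u → Dec (side u)) (within : BipartiteWithin6 N A D side) where

      bipartite : Bipartite G
      bipartite = (λ u → does (side? (toℕ u))) , λ u v e →
        differ (side? (toℕ u)) (side? (toℕ v)) (proj₁ within _ (u <N) _ (v <N) (Equivalence.to (adjacent⇔ u v) e))
        where
        differ : ∀ {P R : Set} (p : Dec P) (r : Dec R) → P × ¬ R ⊎ ¬ P × R → does p ≢ does r
        differ (yes p) (yes r) (inj₁ (_ , ¬r)) _ = ¬r r
        differ (yes p) (yes r) (inj₂ (¬p , _)) _ = ¬p p
        differ (no ¬p) (no ¬r) (inj₁ (p , _))  _ = ¬p p
        differ (no ¬p) (no ¬r) (inj₂ (_ , r))  _ = ¬r r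
        differ (yes p) (no ¬r) _ ()
        differ (no ¬p) (yes r) _ ()

      within-6 : ∃[ k ] Diameter G k × k ≤ 6
      within-6 = diameter λ u v → bound u v (total _ (u <N) _ (v <N))
        where
        bound : ∀ u v → Some N (D (toℕ u) (toℕ v)) → dist u v ≤ 6
        bound u v (k , k< , d) with D-walk k k< u v d
        ... | w , refl = ≤-trans (dist-≤ w) (proj₂ within _ (u <N) _ (v <N) _ k< d)

  module Complete (connected : Connected G) (I : ShortestPathAssignment G S)
    (cover : ∀ x → x ∉ S → ∃[ u ] ∃[ v ] Σ[ u∈ ∈ u ∈ S ] Σ[ v∈ ∈ v ∈ S ] Σ[ u<v ∈ u Fin.< v ]
             x ∈ˡ vertices (walk (path (I u∈ v∈ u<v)))) where

    open Distances (λ u v → walk (connected u v)) public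

    OnPath : Fin N → Fin N → Fin N → Set
    OnPath u v y = Σ[ u∈ ∈ u ∈ S ] Σ[ v∈ ∈ v ∈ S ] Σ[ u<v ∈ u Fin.< v ] y ∈ˡ vertices (walk (path (I u∈ v∈ u<v)))

    -- The assignment takes proofs of membership and order as arguments; as such proofs are unique,
    -- testing one chosen path settles the question.
    onPath? : ∀ u v y → Dec (OnPath u v y)
    onPath? u v y with u ∈? S | v ∈? S | u Fin.<? v
    ... | no ¬p | _     | _     = no (¬p ∘ proj₁)
    ... | _     | no ¬p | _     = no (λ (_ , p , _) → ¬p p)
    ... | _     | _     | no ¬p = no (λ (_ , _ , p , _) → ¬p p)
    ... | yes p | yes q | yes r with Any.any? (y Fin.≟_) (vertices (walk (path (I p q r))))
    ...   | yes y∈ = yes (p , q , r , y∈)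
    ...   | no y∉  = no λ { (p′ , q′ , r′ , y∈) → y∉ (same p p′ q q′ r r′ y∈) }
      where
      same : ∀ p p′ q q′ r r′ → y ∈ˡ vertices (walk (path (I {u} {v} p′ q′ r′))) →
          y ∈ˡ vertices (walk (path (I p q r)))
      same p p′ q q′ r r′ y∈
        with refl ← []=-irrelevant p p′ | refl ← []=-irrelevant q q′ | refl ← <-irrelevant r r′ = y∈

    dist-step : ∀ {u w} v → T (adjacent u w) → dist u v ≤ suc (dist w v)
    dist-step {u} {w} v e = dist-≤ (step e (geodesic w v))

    dist-next : ∀ u v {k} → dist u v ≡ suc k → Σ[ w ∈ Fin N ] T (adjacent u w) × dist w v ≡ k
    dist-next u v {k} eq with geodesic u v | geodesic-minimal u v
    ... | stop | _ = contradiction eq λ ()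
    ... | step {v = w} e p | min = w , e ,
      trans (≤-antisym (dist-≤ p) (≤-pred (min (step e (geodesic w v))))) (suc-injective eq)

    dist-0 : ∀ u v → dist u v ≡ 0 → u ≡ v
    dist-0 u v eq with geodesic u v
    ... | stop = refl

    dist-self : ∀ u → dist u u ≡ 0
    dist-self u = n≤0⇒n≡0 (dist-≤ {u} {u} stop)

    track : ∀ {y v} (w : Walk G y v) → Minimal w → edgeCount w ≡ dist y v
    track {y} {v} w min = ≤-antisym (min (geodesic y v)) (dist-≤ w)

    tail-minimal : ∀ {y z v} (e : T (adjacent y z)) (w : Walk G z v) → Minimal (step e w) → Minimal w
    tail-minimal e w min w′ = ≤-pred (min (step e w′))

    on-below : ∀ {y v x} (w : Walk G y v) → Minimal w → x ∈ˡ vertices w → dist x v ≤ edgeCount w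
    on-below w min x∈ with suffix w x∈
    ... | w′ , ≤ = ≤-trans (dist-≤ w′) ≤

    -- The distance to the end strictly decreases along a geodesic.
    on-unique : ∀ {s v y z} (w : Walk G s v) → Minimal w → y ∈ˡ vertices w → z ∈ˡ vertices w →
        dist y v ≡ dist z v → y ≡ z
    on-unique stop       min (here refl) (here refl) eq = refl
    on-unique (step e w) min (here refl) (here refl) eq = refl
    on-unique (step e w) min (there y∈)  (there z∈)  eq = on-unique w (tail-minimal e w min) y∈ z∈ eq
    on-unique {v = v} (step e w) min (here refl) (there z∈) eq =
      contradiction (on-below w (tail-minimal e w min) z∈)
        (<⇒≱ (≤-reflexive (trans (track (step e w) min) eq)))
    on-unique {v = v} (step e w) min (there y∈) (here refl) eq =
      contradiction (on-below w (tail-minimal e w min) y∈)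
        (<⇒≱ (≤-reflexive (trans (track (step e w) min) (sym eq))))

    on-next : ∀ {s v y k} (w : Walk G s v) → Minimal w → y ∈ˡ vertices w → dist y v ≡ suc k →
              Σ[ z ∈ Fin N ] T (adjacent y z) × dist z v ≡ k × z ∈ˡ vertices w
    on-next {s} stop min (here refl) eq = contradiction (trans (sym (dist-self s)) eq) λ ()
    on-next (step {v = z} e w) min (here refl) eq =
      z , e , trans (sym (track w (tail-minimal e w min)))
          (suc-injective (trans (track (step e w) min) eq)) , there (first w)
      where
      first : ∀ {u v} (w : Walk G u v) → u ∈ˡ vertices w
      first stop       = here refl
      first (step _ _) = here refl
    on-next (step e w) min (there y∈) eq with on-next w (tail-minimal e w min) y∈ eq
    ... | z , a , d , z∈ = z , a , d , there z∈

    module Tables (A : ℕ → ℕ → Set) (Sᴺ : ℕ → Set) (D Q : ℕ → ℕ → ℕ → Set) (fin : ℕ → Fin N)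
      (fin-toℕ : ∀ u → fin (toℕ u) ≡ u) (toℕ-fin : ∀ {u} → u < N → toℕ (fin u) ≡ u)
      (A⇔ : ∀ {u v} → u < N → v < N → A u v ⇔ T (adjacent (fin u) (fin v)))
      (S⇔ : ∀ {u} → u < N → Sᴺ u ⇔ fin u ∈ S)
      (D⇔ : ∀ {u v k} → u < N → v < N → k < N → D u v k ⇔ k ≡ dist (fin u) (fin v))
      (Q⇔ : ∀ {u v y} → u < N → v < N → y < N → Q u v y ⇔ OnPath (fin u) (fin v) (fin y)) where

      open Equivalence

      at-fin : ∀ {P : ℕ → Set} (u : Fin N) → P (toℕ u) → Some N P
      at-fin u p = toℕ u , Fin.toℕ<n u , p

      fin-injective : ∀ {u v} → u < N → v < N → fin u ≡ fin v → u ≡ v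
      fin-injective u< v< eq = trans (sym (toℕ-fin u<)) (trans (cong toℕ eq) (toℕ-fin v<))

      certified : Certified N A Sᴺ D Q
      certified = total , zero-≡ , self-0 , lipschitz , descent , paths , coverage
        where
        <N : (u : Fin N) → toℕ u < N
        <N = Fin.toℕ<n
        total : All N (λ u → All N λ v → Some N λ k → D u v k)
        total u u< v v< = _ , d< , from (D⇔ u< v< d<) refl
          where
          d< : dist (fin u) (fin v) < N
          d< = minimal-< (geodesic (fin u) (fin v)) (geodesic-minimal (fin u) (fin v))
        zero-≡ : All N (λ u → All N λ v → D u v 0 → u ≡ v)
        zero-≡ u u< v v< d =
          fin-injective u< v< (dist-0 _ _ (sym (to (D⇔ u< v< (≤-<-trans z≤n u<)) d)))
        self-0 : All N (λ u → All N λ k → D u u k → k ≡ 0)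
        self-0 u u< k k< d = trans (to (D⇔ u< u< k<) d) (dist-self (fin u))
        lipschitz : All N (λ u → All N λ w → All N λ v → All N λ k → All N λ l → A u w → D u v k → D w v l →
            k ≤ suc l)
        lipschitz u u< w w< v v< k k< l l< a d d′ =
          subst₂ (λ k l → k ≤ suc l) (sym (to (D⇔ u< v< k<) d)) (sym (to (D⇔ w< v< l<) d′))
            (dist-step (fin v) (to (A⇔ u< w<) a))
        descent : All N (λ u → All N λ v → All N λ k → suc k < N → D u v (suc k) → Some N λ w → A u w × D w v k)
        descent u u< v v< k k< k′< d with dist-next (fin u) (fin v) (sym (to (D⇔ u< v< k′<) d))
        ... | w , a , e = at-fin w
          ( from (A⇔ u< (<N w)) (subst (λ z → T (adjacent (fin u) z)) (sym (fin-toℕ w)) a)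
          , from (D⇔ (<N w) v< k<) (trans (sym e) (cong (λ z → dist z (fin v)) (sym (fin-toℕ w)))) )
        coverage : All N (λ x → ¬ Sᴺ x → Some N λ u → Some N λ v → Sᴺ u × Sᴺ v × u < v × Q u v x)
        coverage x x< x∉ with cover (fin x) (x∉ ∘ from (S⇔ x<))
        ... | u , v , u∈ , v∈ , u<v , x∈ = at-fin u (at-fin v
          ( from (S⇔ (<N u)) (subst (_∈ S) (sym (fin-toℕ u)) u∈)
          , from (S⇔ (<N v)) (subst (_∈ S) (sym (fin-toℕ v)) v∈)
          , u<v
          , from (Q⇔ (<N u) (<N v) x<)
              (subst₂ (λ u v → OnPath u v (fin x)) (sym (fin-toℕ u)) (sym (fin-toℕ v)) (u∈ , v∈ , u<v , x∈)) ))
        paths : All N (λ u → All N λ v → Sᴺ u → Sᴺ v → u < v →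
          Q u v u ×
          All N (λ y → All N λ k → suc k < N → Q u v y → D y v (suc k) → Some N λ w → A y w × D w v k × Q u v w) ×
          All N (λ y → All N λ w → All N λ k → Q u v y → Q u v w → D y v k → D w v k → y ≡ w) ×
          All N (λ y → All N λ k → All N λ l → Q u v y → D y v k → D u v l → k ≤ l))
        paths u u< v v< su sv u<v =
          from (Q⇔ u< v< u<) (u∈ , v∈ , u<v′ , first route) , next , unique , below
          where
          u∈ : fin u ∈ S
          u∈ = to (S⇔ u<) su
          v∈ : fin v ∈ S
          v∈ = to (S⇔ v<) sv
          u<v′ : fin u Fin.< fin v
          u<v′ = subst₂ _<_ (sym (toℕ-fin u<)) (sym (toℕ-fin v<)) u<v
          route : Walk G (fin u) (fin v)
          route = walk (path (I u∈ v∈ u<v′))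
          route-minimal : Minimal route
          route-minimal = shortest-≤ (I u∈ v∈ u<v′)
          first : ∀ {u v} (w : Walk G u v) → u ∈ˡ vertices w
          first stop       = here refl
          first (step _ _) = here refl
          on : ∀ {y} → y < N → Q u v y → fin y ∈ˡ vertices route
          on y< q with to (Q⇔ u< v< y<) q
          ... | u∈′ , v∈′ , lt , y∈
            with refl ← []=-irrelevant u∈ u∈′ | refl ← []=-irrelevant v∈ v∈′ | refl ← <-irrelevant u<v′ lt = y∈
          next : All N (λ y → All N λ k → suc k < N → Q u v y → D y v (suc k) → Some N λ w →
              A y w × D w v k × Q u v w)
          next y y< k k< k′< q d with on-next route route-minimal (on y< q) (sym (to (D⇔ y< v< k′<) d))
          ... | w , a , e , w∈ = at-fin w
            ( from (A⇔ y< (<N w)) (subst (λ z → T (adjacent (fin y) z)) (sym (fin-toℕ w)) a)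
            , from (D⇔ (<N w) v< k<) (trans (sym e) (cong (λ z → dist z (fin v)) (sym (fin-toℕ w))))
            , from (Q⇔ u< v< (<N w)) (u∈ , v∈ , u<v′ , subst (_∈ˡ vertices route) (sym (fin-toℕ w)) w∈) )
          unique : All N (λ y → All N λ w → All N λ k → Q u v y → Q u v w → D y v k → D w v k → y ≡ w)
          unique y y< w w< k k< qy qw dy dw = fin-injective y< w<
            (on-unique route route-minimal (on y< qy) (on w< qw)
              (trans (sym (to (D⇔ y< v< k<) dy)) (to (D⇔ w< v< k<) dw)))
          below : All N (λ y → All N λ k → All N λ l → Q u v y → D y v k → D u v l → k ≤ l)
          below y y< k k< l l< qy dy du =
            subst₂ _≤_ (sym (to (D⇔ y< v< k<) dy)) (sym
                (trans (to (D⇔ u< v< l<) du) (sym (track route route-minimal))))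
              (on-below route route-minimal (on y< qy))

      bipartite-within : (side : ℕ → Set) (color : Fin N → Bool) →
                         (∀ {u} → u < N → side u ⇔ T (color (fin u))) →
                         (∀ u v → T (adjacent u v) → color u ≢ color v) → (∀ u v → dist u v ≤ 6) →
                         BipartiteWithin6 N A D side
      bipartite-within side color side⇔ proper short =
        (λ u u< v v< a → differ (side⇔ u<) (side⇔ v<) (proper _ _ (to (A⇔ u< v<) a))) ,
        (λ u u< v v< k k< d → subst (_≤ 6) (sym (to (D⇔ u< v< k<) d)) (short _ _))
        where
        differ : ∀ {P R b c} → P ⇔ T b → R ⇔ T c → b ≢ c → P × ¬ R ⊎ ¬ P × R
        differ {b = true}  {true}  p r b≢c = contradiction refl b≢c
        differ {b = true}  {false} p r b≢c = inj₁ (from p tt , to r)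
        differ {b = false} {true}  p r b≢c = inj₂ (to p , from r tt)
        differ {b = false} {false} p r b≢c = contradiction refl b≢c

-- Membership in NP

bitAt-symbolAt : ∀ z i → bitAt z i ≡ Maybe.fromMaybe false (symbolAt z i)
bitAt-symbolAt []      i       = refl
bitAt-symbolAt (b ∷ z) zero    = refl
bitAt-symbolAt (b ∷ z) (suc i) = bitAt-symbolAt z i

pair-bit : ∀ x c {i} → i < length x → bitAt ⟨ x , c ⟩ (suc (i * 2)) ≡ bitAt x i
pair-bit x c {i} i< = trans (bitAt-symbolAt ⟨ x , c ⟩ (suc (i * 2)))
    (cong (Maybe.fromMaybe false) (pair-odd x c i i<))

pair-certificate-bit : ∀ x c i → bitAt ⟨ x , c ⟩ (length x * 2 + suc i) ≡ bitAt c i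
pair-certificate-bit x c i = trans (bitAt-symbolAt ⟨ x , c ⟩ _)
  (trans (cong (Maybe.fromMaybe false) (pair-certificate x c i)) (sym (bitAt-symbolAt c i)))

pair-continues : ∀ x c {i} → i < length x → T (bitAt ⟨ x , c ⟩ (i * 2))
pair-continues x c {i} i< = subst T (sym (trans (bitAt-symbolAt ⟨ x , c ⟩ (i * 2))
  (cong (Maybe.fromMaybe false) (pair-even x c i i<)))) tt

pair-stops : ∀ x c → ¬ T (bitAt ⟨ x , c ⟩ (length x * 2))
pair-stops x c t = subst T (trans (bitAt-symbolAt ⟨ x , c ⟩ (length x * 2))
  (cong (Maybe.fromMaybe false) (pair-middle x c))) t

-- The verifier sees only the paired word; the flags at even positions tell it where x ends.
WordLength : List Bool → ℕ → Set
WordLength z ℓ = All ℓ (λ i → T (bitAt z (i * 2))) × ¬ T (bitAt z (ℓ * 2))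

wordLength-unique : ∀ x c {ℓ} → WordLength ⟨ x , c ⟩ ℓ → ℓ ≡ length x
wordLength-unique x c {ℓ} (continues , stops) with <-cmp ℓ (length x)
... | tri< lt _ _ = contradiction (pair-continues x c lt) stops
... | tri≈ _ eq _ = eq
... | tri> _ _ gt = contradiction (continues (length x) gt) (pair-stops x c)

module Verifier (z : List Bool) (ℓ N : ℕ) where

  wordBit : ℕ → Set
  wordBit i = T (bitAt z (suc (i * 2)))

  -- The certificate is read as three cubic tables: layer 0 holds the distances, layer 1 the chosen
  -- paths, and layer 2 the bipartition, of which only the entries (u, 0, 0) are read.
  tableBit : ℕ → ℕ → ℕ → ℕ → Set
  tableBit κ u v w = T (bitAt z (ℓ * 2 + suc (w + (v + (u + κ * N) * N) * N)))

  Adjacent : ℕ → ℕ → Set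
  Adjacent u v = wordBit (N + suc (v + u * N))

  Member : ℕ → Set
  Member u = wordBit (N + suc (N * N + u))

  WellFormed : Set
  WellFormed =
    0 < N × ℓ ≡ N + suc (N * N + N) × All N wordBit × ¬ wordBit N ×
    All N (λ u → All N λ v → Adjacent u v → Adjacent v u) × All N (λ u → ¬ Adjacent u u)

  -- One verifier for both problems: `true` adds the restriction, while `0 ≡ 0` is merely a true
  -- statement that has a formula.
  Extra : Bool → Set
  Extra false = 0 ≡ 0
  Extra true  = BipartiteWithin6 N Adjacent (tableBit 0) (λ u → tableBit 2 u 0 0)

  Valid : Bool → Set
  Valid r = WellFormed × Certified N Adjacent Member (tableBit 0) (tableBit 1) × Extra r

Accepts : Bool → List Bool → Set
Accepts r z = Some (length z) λ ℓ → WordLength z ℓ × Some (suc ℓ) λ N → Verifier.Valid z ℓ N r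

module _ {ℓ N : List Bool → Env n → ℕ} (ℓᶜ : Computable ℓ) (Nᶜ : Computable N) where

  wordBitᵈ : {i : List Bool → Env n → ℕ} → Computable i →
      Definable (λ z ρ → Verifier.wordBit z (ℓ z ρ) (N z ρ) (i z ρ))
  wordBitᵈ i = bitᵈ (sucᶜ (i *ᶜ constᶜ 2))

  tableBitᵈ : ∀ κ {u v w : List Bool → Env n → ℕ} → Computable u → Computable v → Computable w →
              Definable (λ z ρ → Verifier.tableBit z (ℓ z ρ) (N z ρ) κ (u z ρ) (v z ρ) (w z ρ))
  tableBitᵈ κ u v w = bitᵈ (ℓᶜ *ᶜ constᶜ 2 +ᶜ sucᶜ (w +ᶜ (v +ᶜ (u +ᶜ constᶜ κ *ᶜ Nᶜ) *ᶜ Nᶜ) *ᶜ Nᶜ))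

  adjacentᵈ : {u v : List Bool → Env n → ℕ} → Computable u → Computable v →
              Definable (λ z ρ → Verifier.Adjacent z (ℓ z ρ) (N z ρ) (u z ρ) (v z ρ))
  adjacentᵈ u v = wordBitᵈ (Nᶜ +ᶜ sucᶜ (v +ᶜ u *ᶜ Nᶜ))

  memberᵈ : {u : List Bool → Env n → ℕ} → Computable u → Definable (λ z ρ → Verifier.Member z (ℓ z ρ) (N z ρ) (u z ρ))
  memberᵈ u = wordBitᵈ (Nᶜ +ᶜ sucᶜ (Nᶜ *ᶜ Nᶜ +ᶜ u))

module _ {ℓ N : List Bool → Env n → ℕ} (ℓᶜ : Computable ℓ) (Nᶜ : Computable N) where

  private
    ℓ¹ = wkᶜ ℓᶜ
    ℓ² = wkᶜ ℓ¹
    ℓ³ = wkᶜ ℓ²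
    ℓ⁴ = wkᶜ ℓ³
    ℓ⁵ = wkᶜ ℓ⁴
    N¹ = wkᶜ Nᶜ
    N² = wkᶜ N¹
    N³ = wkᶜ N²
    N⁴ = wkᶜ N³
    N⁵ = wkᶜ N⁴

  wellFormedᵈ : Definable (λ z ρ → Verifier.WellFormed z (ℓ z ρ) (N z ρ))
  wellFormedᵈ =
    constᶜ 0 <ᵈ Nᶜ ×ᵈ ℓᶜ ≡ᵈ Nᶜ +ᶜ sucᶜ (Nᶜ *ᶜ Nᶜ +ᶜ Nᶜ) ×ᵈ allᵈ Nᶜ (wordBitᵈ ℓ¹ N¹ v₀) ×ᵈ
    (¬ᵈ wordBitᵈ ℓᶜ Nᶜ Nᶜ) ×ᵈ
    allᵈ Nᶜ (allᵈ N¹ (adjacentᵈ ℓ² N² v₁ v₀ →ᵈ adjacentᵈ ℓ² N² v₀ v₁)) ×ᵈ allᵈ Nᶜ (¬ᵈ adjacentᵈ ℓ¹ N¹ v₀ v₀)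

  certifiedᵈ : Definable (λ z ρ → Certified (N z ρ) (Verifier.Adjacent z (ℓ z ρ) (N z ρ))
      (Verifier.Member z (ℓ z ρ) (N z ρ))
                                    (Verifier.tableBit z (ℓ z ρ) (N z ρ) 0) (Verifier.tableBit z (ℓ z ρ) (N z ρ) 1))
  certifiedᵈ =
    allᵈ Nᶜ (allᵈ N¹ (someᵈ N² (tableBitᵈ ℓ³ N³ 0 v₂ v₁ v₀))) ×ᵈ
    allᵈ Nᶜ (allᵈ N¹ (tableBitᵈ ℓ² N² 0 v₁ v₀ (constᶜ 0) →ᵈ v₁ ≡ᵈ v₀)) ×ᵈ
    allᵈ Nᶜ (allᵈ N¹ (tableBitᵈ ℓ² N² 0 v₁ v₁ v₀ →ᵈ v₀ ≡ᵈ constᶜ 0)) ×ᵈ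
    allᵈ Nᶜ (allᵈ N¹ (allᵈ N² (allᵈ N³ (allᵈ N⁴
      (adjacentᵈ ℓ⁵ N⁵ v₄ v₃ →ᵈ tableBitᵈ ℓ⁵ N⁵ 0 v₄ v₂ v₁ →ᵈ tableBitᵈ ℓ⁵ N⁵ 0 v₃ v₂ v₀ →ᵈ v₁ ≤ᵈ sucᶜ v₀))))) ×ᵈ
    allᵈ Nᶜ (allᵈ N¹ (allᵈ N² (sucᶜ v₀ <ᵈ N³ →ᵈ tableBitᵈ ℓ³ N³ 0 v₂ v₁ (sucᶜ v₀) →ᵈ
      someᵈ N³ (adjacentᵈ ℓ⁴ N⁴ v₃ v₀ ×ᵈ tableBitᵈ ℓ⁴ N⁴ 0 v₀ v₂ v₁)))) ×ᵈ
    allᵈ Nᶜ (allᵈ N¹ (memberᵈ ℓ² N² v₁ →ᵈ memberᵈ ℓ² N² v₀ →ᵈ v₁ <ᵈ v₀ →ᵈ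
      (tableBitᵈ ℓ² N² 1 v₁ v₀ v₁ ×ᵈ
       allᵈ N² (allᵈ N³ (sucᶜ v₀ <ᵈ N⁴ →ᵈ tableBitᵈ ℓ⁴ N⁴ 1 v₃ v₂ v₁ →ᵈ tableBitᵈ ℓ⁴ N⁴ 0 v₁ v₂ (sucᶜ v₀) →ᵈ
         someᵈ N⁴ (adjacentᵈ ℓ⁵ N⁵ v₂ v₀ ×ᵈ tableBitᵈ ℓ⁵ N⁵ 0 v₀ v₃ v₁ ×ᵈ tableBitᵈ ℓ⁵ N⁵ 1 v₄ v₃ v₀))) ×ᵈ
       allᵈ N² (allᵈ N³ (allᵈ N⁴ (tableBitᵈ ℓ⁵ N⁵ 1 v₄ v₃ v₂ →ᵈ tableBitᵈ ℓ⁵ N⁵ 1 v₄ v₃ v₁ →ᵈ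
         tableBitᵈ ℓ⁵ N⁵ 0 v₂ v₃ v₀ →ᵈ tableBitᵈ ℓ⁵ N⁵ 0 v₁ v₃ v₀ →ᵈ v₂ ≡ᵈ v₁))) ×ᵈ
       allᵈ N² (allᵈ N³ (allᵈ N⁴ (tableBitᵈ ℓ⁵ N⁵ 1 v₄ v₃ v₂ →ᵈ tableBitᵈ ℓ⁵ N⁵ 0 v₂ v₃ v₁ →ᵈ
         tableBitᵈ ℓ⁵ N⁵ 0 v₄ v₃ v₀ →ᵈ v₁ ≤ᵈ v₀)))))) ×ᵈ
    allᵈ Nᶜ ((¬ᵈ memberᵈ ℓ¹ N¹ v₀) →ᵈ someᵈ N¹ (someᵈ N² (memberᵈ ℓ³ N³ v₁ ×ᵈ memberᵈ ℓ³ N³ v₀ ×ᵈ v₁ <ᵈ v₀ ×ᵈ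
      tableBitᵈ ℓ³ N³ 1 v₁ v₀ v₂)))

  extraᵈ : ∀ r → Definable (λ z ρ → Verifier.Extra z (ℓ z ρ) (N z ρ) r)
  extraᵈ false = constᶜ 0 ≡ᵈ constᶜ 0
  extraᵈ true  =
    allᵈ Nᶜ (allᵈ N¹ (adjacentᵈ ℓ² N² v₁ v₀ →ᵈ
      (tableBitᵈ ℓ² N² 2 v₁ (constᶜ 0) (constᶜ 0) ×ᵈ (¬ᵈ tableBitᵈ ℓ² N² 2 v₀ (constᶜ 0) (constᶜ 0)) ⊎ᵈ
       (¬ᵈ tableBitᵈ ℓ² N² 2 v₁ (constᶜ 0) (constᶜ 0)) ×ᵈ tableBitᵈ ℓ² N² 2 v₀ (constᶜ 0) (constᶜ 0)))) ×ᵈ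
    allᵈ Nᶜ (allᵈ N¹ (allᵈ N² (tableBitᵈ ℓ³ N³ 0 v₂ v₁ v₀ →ᵈ v₀ ≤ᵈ constᶜ 6)))

acceptsᵈ : ∀ r → Definable {1} (λ z ρ → Accepts r z)
acceptsᵈ r = someᵈ lenᶜ ((allᵈ v₀ (bitᵈ (v₀ *ᶜ constᶜ 2)) ×ᵈ (¬ᵈ bitᵈ (v₀ *ᶜ constᶜ 2))) ×ᵈ
  someᵈ (sucᶜ v₀) (wellFormedᵈ v₁ v₀ ×ᵈ certifiedᵈ v₁ v₀ ×ᵈ extraᵈ v₁ v₀ r))

bool-ext : ∀ {a b} → (T a → T b) → (T b → T a) → a ≡ b
bool-ext {true}  {true}  f g = refl
bool-ext {true}  {false} f g = ⊥-elim (f tt)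
bool-ext {false} {true}  f g = ⊥-elim (g tt)
bool-ext {false} {false} f g = refl

-- The gadget graph

-- Agents are pairs of a variable i and a clause j, numbered c = j + i m; the agents of a variable form a
-- ring.  U c and V c are the vertices of the set.  W, X and Y force the geodesics between all of them except
-- U c and V c, whose geodesics are U c, D d, Z j, V c with d = c (variable true) or d before c (variable false).
data Kind : Set where
  U V D Z     : ℕ → Kind
  WU WV X Y   : ℕ → ℕ → Kind

module Gadget (n m : ℕ) (0<n : 0 < n) (2≤m : 2 ≤ m) (Lit : Bool → ℕ → ℕ → Set)
              (unused : ∀ b j → ¬ Lit b 0 j) where

  R : ℕ
  R = n * m

  Valid : Kind → Set
  Valid (U c)    = c < R
  Valid (V c)    = c < R
  Valid (D c)    = c < R
  Valid (Z j)    = j < m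
  Valid (WU a b) = a < b × b < R
  Valid (WV a b) = a < b × b < R
  Valid (X a b)  = a ≢ b × a < R × b < R
  Valid (Y a b)  = a ≢ b × a < R × b < R

  -- The first alternative closes the ring: slot m - 1 comes before slot 0.
  PrevSlot : ℕ → ℕ → Set
  PrevSlot j k = (j ≡ 0 × suc k ≡ m) ⊎ j ≡ suc k

  Prev : ℕ → ℕ → Set
  Prev c d = Some n λ i → Some m λ j → Some m λ k → PrevSlot j k × c ≡ j + i * m × d ≡ k + i * m

  At-lit : Bool → ℕ → ℕ → Set
  At-lit s c j = Some n λ i → c ≡ j + i * m × Lit s i j

  -- `b-lit` ignores the sign of the literal; it is `V c` that tests it. `v-pos` completes the route
  -- through the own vertex `D c`, and `v-neg` the route through the vertex before it. `v-zero` and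
  -- `b-zero` offer `Z 0` to every agent, whichever way it turns. `v-first` puts each `Z j` next to
  -- a vertex of the set.
  data Edge : Kind → Kind → Set where
    u-own   : ∀ {c} → Edge (U c) (D c)
    u-prev  : ∀ {c d} → Prev c d → Edge (U c) (D d)
    v-first : ∀ {j} → Edge (V 0) (Z j)
    v-zero  : ∀ {c} → Edge (V c) (Z 0)
    v-pos   : ∀ {c j} → At-lit true c j → Edge (V c) (Z j)
    v-neg   : ∀ {c d j} → Prev c d → At-lit false d j → Edge (V c) (Z j)
    b-zero  : ∀ {c} → Edge (D c) (Z 0)
    b-lit   : ∀ {c j} s → At-lit s c j → Edge (D c) (Z j)
    u-wˡ    : ∀ {a b} → Edge (U a) (WU a b)
    u-wʳ    : ∀ {a b} → Edge (U b) (WU a b)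
    v-wˡ    : ∀ {a b} → Edge (V a) (WV a b)
    v-wʳ    : ∀ {a b} → Edge (V b) (WV a b)
    u-x     : ∀ {a b} → Edge (U a) (X a b)
    x-y     : ∀ {a b} → Edge (X a b) (Y a b)
    v-y     : ∀ {a b} → Edge (V b) (Y a b)

  Adj : Kind → Kind → Set
  Adj k l = Edge k l ⊎ Edge l k

  adj-sym : ∀ {k l} → Adj k l → Adj l k
  adj-sym (inj₁ e) = inj₂ e
  adj-sym (inj₂ e) = inj₁ e

  side : Kind → Bool
  side (U _)    = false
  side (V _)    = true
  side (D _)    = true
  side (Z _)    = false
  side (WU _ _) = true
  side (WV _ _) = false
  side (X _ _)  = true
  side (Y _ _)  = false

  edge-side : ∀ {k l} → Edge k l → side l ≡ not (side k)
  edge-side u-own       = refl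
  edge-side (u-prev _)  = refl
  edge-side v-first     = refl
  edge-side v-zero      = refl
  edge-side (v-pos _)   = refl
  edge-side (v-neg _ _) = refl
  edge-side b-zero      = refl
  edge-side (b-lit _ _) = refl
  edge-side u-wˡ        = refl
  edge-side u-wʳ        = refl
  edge-side v-wˡ        = refl
  edge-side v-wʳ        = refl
  edge-side u-x         = refl
  edge-side x-y         = refl
  edge-side v-y         = refl

  adj-side : ∀ {k l} → Adj k l → side l ≡ not (side k)
  adj-side (inj₁ e) = edge-side e
  adj-side (inj₂ e) = trans (sym (not-involutive _)) (cong not (sym (edge-side e)))

  data Terminal : Kind → Set where
    U : ∀ c → Terminal (U c)
    V : ∀ c → Terminal (V c)

  terminal-free : ∀ {k l} → Terminal k → Terminal l → ¬ Adj k l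
  terminal-free (U _) (U _) (inj₁ ())
  terminal-free (U _) (U _) (inj₂ ())
  terminal-free (U _) (V _) (inj₁ ())
  terminal-free (U _) (V _) (inj₂ ())
  terminal-free (V _) (U _) (inj₁ ())
  terminal-free (V _) (U _) (inj₂ ())
  terminal-free (V _) (V _) (inj₁ ())
  terminal-free (V _) (V _) (inj₂ ())

  -- Numbering of the vertices

  data Place : Set where
    slot : ℕ → ℕ → ℕ → Place
    end  : ℕ → Place

  place : Kind → Place
  place (U c)    = slot 0 c c
  place (V c)    = slot 1 c c
  place (D c)    = slot 2 c c
  place (Z j)    = end j
  place (WU a b) = slot 0 a b
  place (WV a b) = slot 0 b a
  place (X a b)  = slot 1 a b
  place (Y a b)  = slot 2 a b

  -- The vertices fill three R × R squares and a row of m places without a gap. The diagonals hold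
  -- U, V and D; off the diagonal, the first square has WU above and WV below it, the second has X,
  -- the third Y.
  kindAt : Place → Kind
  kindAt (slot 0 a b) with <-cmp a b
  ... | tri< _ _ _ = WU a b
  ... | tri≈ _ _ _ = U a
  ... | tri> _ _ _ = WV b a
  kindAt (slot 1 a b) = choose (a ≟ b) (V a) (X a b)
  kindAt (slot _ a b) = choose (a ≟ b) (D a) (Y a b)
  kindAt (end j)      = Z j

  kindAt-place : ∀ {k} → Valid k → kindAt (place k) ≡ k
  kindAt-place {U c} v with <-cmp c c
  ... | tri< _ c≢c _ = contradiction refl c≢c
  ... | tri≈ _ _ _   = refl
  ... | tri> _ c≢c _ = contradiction refl c≢c
  kindAt-place {V c} v with c ≟ c
  ... | yes _  = refl
  ... | no c≢c = contradiction refl c≢c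
  kindAt-place {D c} v with c ≟ c
  ... | yes _  = refl
  ... | no c≢c = contradiction refl c≢c
  kindAt-place {Z j} v = refl
  kindAt-place {WU a b} (a<b , _) with <-cmp a b
  ... | tri< _ _ _   = refl
  ... | tri≈ a≮b _ _ = contradiction a<b a≮b
  ... | tri> a≮b _ _ = contradiction a<b a≮b
  kindAt-place {WV a b} (a<b , _) with <-cmp b a
  ... | tri< _ _ a≮b = contradiction a<b a≮b
  ... | tri≈ _ _ a≮b = contradiction a<b a≮b
  ... | tri> _ _ _   = refl
  kindAt-place {X a b} (a≢b , _) with a ≟ b
  ... | yes a≡b = contradiction a≡b a≢b
  ... | no _    = refl
  kindAt-place {Y a b} (a≢b , _) with a ≟ b
  ... | yes a≡b = contradiction a≡b a≢b
  ... | no _    = refl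

  number-at : Place → ℕ
  number-at (slot τ a b) = b + (a + τ * R) * R
  number-at (end j)      = j + 3 * R * R

  codeOf : Kind → ℕ
  codeOf k = number-at (place k)

  N : ℕ
  N = m + 3 * R * R

  data In-range : Place → Set where
    slot : ∀ {τ a b} → τ < 3 → a < R → b < R → In-range (slot τ a b)
    end  : ∀ {j} → j < m → In-range (end j)

  in-range : ∀ {k} → Valid k → In-range (place k)
  in-range {U c}    v             = slot (s≤s z≤n) v v
  in-range {V c}    v             = slot (s≤s (s≤s z≤n)) v v
  in-range {D c}    v             = slot (s≤s (s≤s (s≤s z≤n))) v v
  in-range {Z j}    v             = end v
  in-range {WU a b} (a<b , b<)    = slot (s≤s z≤n) (<-trans a<b b<) b<
  in-range {WV a b} (a<b , b<)    = slot (s≤s z≤n) b< (<-trans a<b b<)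
  in-range {X a b}  (_ , a< , b<) = slot (s≤s (s≤s z≤n)) a< b<
  in-range {Y a b}  (_ , a< , b<) = slot (s≤s (s≤s (s≤s z≤n))) a< b<

  valid-at : ∀ {π} → In-range π → Valid (kindAt π) × place (kindAt π) ≡ π
  valid-at {slot 0 a b} (slot _ a< b<) with <-cmp a b
  ... | tri< a<b _ _ = (a<b , b<) , refl
  ... | tri≈ _ refl _ = a< , refl
  ... | tri> _ _ b<a = (b<a , a<) , refl
  valid-at {slot 1 a b} (slot _ a< b<) with a ≟ b
  ... | yes refl = a< , refl
  ... | no a≢b   = (a≢b , a< , b<) , refl
  valid-at {slot 2 a b} (slot _ a< b<) with a ≟ b
  ... | yes refl = a< , refl
  ... | no a≢b   = (a≢b , a< , b<) , refl
  valid-at {slot (suc (suc (suc _))) a b} (slot (s≤s (s≤s (s≤s ()))) _ _)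
  valid-at {end j} (end j<) = j< , refl

  place-< : ∀ {π} → In-range π → number-at π < N
  place-< (slot τ< a< b<) = <-≤-trans (radix-< b< (radix-< a< τ<)) (m≤n+m _ m)
  place-< (end j<)        = +-monoˡ-< (3 * R * R) j<

  number-injective′ : ∀ {π ρ} → In-range π → In-range ρ → number-at π ≡ number-at ρ → π ≡ ρ
  number-injective′ {slot τ a b} {slot τ′ a′ b′} (slot τ< a< b<) (slot τ′< a′< b′<) eq
    with radix-unique (a + τ * R) (a′ + τ′ * R) b< b′< eq
  ... | refl , eq′ with radix-unique τ τ′ a< a′< eq′
  ... | refl , refl = refl
  number-injective′ (slot τ< a< b<) (end {j} j<) eq =
    contradiction (<-≤-trans (radix-< b< (radix-< a< τ<)) (m≤n+m _ j)) (<-irrefl eq)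
  number-injective′ (end {j} j<) (slot τ< a< b<) eq =
    contradiction (<-≤-trans (radix-< b< (radix-< a< τ<)) (m≤n+m _ j)) (<-irrefl (sym eq))
  number-injective′ {end j} {end j′} (end j<) (end j′<) eq = cong end (+-cancelʳ-≡ (3 * R * R) j j′ eq)

  number-surjective : ∀ u → u < N → Σ[ π ∈ Place ] In-range π × number-at π ≡ u
  number-surjective u u<N with u <? 3 * R * R
  ... | no u≮ = end (u ∸ 3 * R * R) ,
    end (+-cancelʳ-< (3 * R * R) _ m (subst (_< N) (sym (m∸n+n≡m (≮⇒≥ u≮))) u<N)) , m∸n+n≡m (≮⇒≥ u≮)
  ... | yes u< with radix-exists {u} (3 * R) R u<
  ...   | b , h , b< , h< , refl with radix-exists {h} 3 R h<
  ...     | a , τ , a< , τ< , refl = slot τ a b , slot τ< a< b< , refl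

  code-injective : ∀ {k l} → Valid k → Valid l → codeOf k ≡ codeOf l → k ≡ l
  code-injective vk vl eq = trans (sym (kindAt-place vk))
    (trans (cong kindAt (number-injective′ (in-range vk) (in-range vl) eq)) (kindAt-place vl))

  code-surjective : ∀ u → u < N → Σ[ k ∈ Kind ] Valid k × codeOf k ≡ u
  code-surjective u u<N with number-surjective u u<N
  ... | π , r , eq with valid-at r
  ...   | v , eq′ = kindAt π , v , trans (cong number-at eq′) eq

  N>0 : 0 < N
  N>0 = ≤-trans (≤-trans (s≤s z≤n) 2≤m) (m≤m+n m _)

  R>0 : 0 < R
  R>0 = *-mono-≤ 0<n (≤-trans (s≤s z≤n) 2≤m)

  diagonal-mono : ∀ τ {a b} → a < b → number-at (slot τ a a) < number-at (slot τ b b)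
  diagonal-mono τ a<b = +-mono-<-≤ a<b (*-monoˡ-≤ R (+-monoˡ-≤ (τ * R) (<⇒≤ a<b)))

  diagonal-< : ∀ τ {a b} → number-at (slot τ a a) < number-at (slot τ b b) → a < b
  diagonal-< τ {a} {b} lt with <-cmp a b
  ... | tri< a<b _ _  = a<b
  ... | tri≈ _ refl _ = contradiction lt (<-irrefl refl)
  ... | tri> _ _ b<a  = contradiction (<-trans lt (diagonal-mono τ b<a)) (<-irrefl refl)

  -- The square with the U comes before the square with the V. So in an assignment, which is indexed
  -- by increasing pairs, every mixed pair starts at its U.
  U<V : ∀ {a b} → a < R → codeOf (U a) < codeOf (V b)
  U<V {a} {b} a< = <-≤-trans
    (radix-< {a} {a + 0} {R} {R} a< (subst (_< R) (sym (+-identityʳ a)) a<))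
    (≤-trans (*-monoˡ-≤ R (≤-trans (≤-reflexive (sym (+-identityʳ R))) (m≤n+m (1 * R) b))) (m≤n+m _ b))

  -- adjᵇ and setᵇ are read off the word that the reduction computes.
  module Construction
    (adjᵇ : ℕ → ℕ → Bool) (setᵇ : ℕ → Bool)
    (adj-correct : ∀ {k l} → Valid k → Valid l → T (adjᵇ (codeOf k) (codeOf l)) ⇔ Adj k l)
    (set-correct : ∀ {k} → Valid k → T (setᵇ (codeOf k)) ⇔ Terminal k) where

    abstract
      kind : Fin N → Kind
      kind u = proj₁ (code-surjective (toℕ u) (Fin.toℕ<n u))

      kind-valid : ∀ u → Valid (kind u)
      kind-valid u = proj₁ (proj₂ (code-surjective (toℕ u) (Fin.toℕ<n u)))

      code-kind : ∀ u → codeOf (kind u) ≡ toℕ u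
      code-kind u = proj₂ (proj₂ (code-surjective (toℕ u) (Fin.toℕ<n u)))

      vertex : ∀ k → Valid k → Fin N
      vertex k v = fromℕ< (place-< (in-range v))

      toℕ-vertex : ∀ {k} (v : Valid k) → toℕ (vertex k v) ≡ codeOf k
      toℕ-vertex v = Fin.toℕ-fromℕ< _

    kind-vertex : ∀ {k} (v : Valid k) → kind (vertex k v) ≡ k
    kind-vertex {k} v = code-injective (kind-valid _) v (trans (code-kind (vertex k v)) (toℕ-vertex v))

    kind-injective : ∀ {u v} → kind u ≡ kind v → u ≡ v
    kind-injective {u} {v} eq =
      Fin.toℕ-injective (trans (sym (code-kind u)) (trans (cong codeOf eq) (code-kind v)))

    edge⇒ : ∀ {u v} → T (adjᵇ (toℕ u) (toℕ v)) → Adj (kind u) (kind v)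
    edge⇒ {u} {v} e = Equivalence.to (adj-correct (kind-valid u) (kind-valid v))
      (subst₂ (λ a b → T (adjᵇ a b)) (sym (code-kind u)) (sym (code-kind v)) e)

    edge⇐ : ∀ {u v} → Adj (kind u) (kind v) → T (adjᵇ (toℕ u) (toℕ v))
    edge⇐ {u} {v} a = subst₂ (λ a b → T (adjᵇ a b)) (code-kind u) (code-kind v)
      (Equivalence.from (adj-correct (kind-valid u) (kind-valid v)) a)

    not-≢ : ∀ {a b} → b ≡ not a → a ≢ b
    not-≢ {true}  refl ()
    not-≢ {false} refl ()

    abstract
      adjᵇ-symmetric : ∀ u v → adjᵇ (toℕ {N} u) (toℕ {N} v) ≡ adjᵇ (toℕ v) (toℕ u)
      adjᵇ-symmetric u v = bool-ext (λ e → edge⇐ {v} {u} (adj-sym (edge⇒ {u} {v} e)))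
                               (λ e → edge⇐ {u} {v} (adj-sym (edge⇒ {v} {u} e)))

      adjᵇ-irreflexive : ∀ u → adjᵇ (toℕ {N} u) (toℕ {N} u) ≡ false
      adjᵇ-irreflexive u = bool-ext (λ e → not-≢ (adj-side (edge⇒ {u} {u} e)) refl) (λ ())

    gadgetGraph : Graph
    gadgetGraph = record
      { order       = N
      ; nonEmpty    = >-nonZero N>0
      ; adjacent    = λ u v → adjᵇ (toℕ u) (toℕ v)
      ; symmetric   = adjᵇ-symmetric
      ; irreflexive = adjᵇ-irreflexive
      }

    bipartite : Bipartite gadgetGraph
    bipartite = side ∘ kind , λ u v e → not-≢ (adj-side (edge⇒ {u} {v} e))

    terminals : Subset N
    terminals = Vec.tabulate (setᵇ ∘ toℕ)

    ∈⇒terminal : ∀ {u} → u ∈ terminals → Terminal (kind u)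
    ∈⇒terminal {u} u∈ = Equivalence.to (set-correct (kind-valid u)) (subst (T ∘ setᵇ) (sym (code-kind u))
      (subst T (sym (trans (sym (Vec.lookup∘tabulate (setᵇ ∘ toℕ) u)) (Vec.[]=⇒lookup u∈))) tt))

    terminal⇒∈ : ∀ {u} → Terminal (kind u) → u ∈ terminals
    terminal⇒∈ {u} t = Vec.lookup⇒[]= u terminals (trans (Vec.lookup∘tabulate (setᵇ ∘ toℕ) u)
      (bool-ext (λ _ → tt) (λ _ → subst (T ∘ setᵇ) (code-kind u) (Equivalence.from (set-correct (kind-valid u)) t))))

    open Walks gadgetGraph public

    -- Walks are first laid out on kinds, where adjacency is given by constructors, and only then
    -- transferred to numbered vertices.
    data Route : Kind → Kind → ℕ → Set where
      done : ∀ {k} → Route k k 0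
      hop  : ∀ {k l l′ i} → Adj k l → Valid l → Route l l′ i → Route k l′ (suc i)

    walk-of : ∀ {k l i} → Route k l i → ∀ u v → kind u ≡ k → kind v ≡ l → u ⟶[ i ] v
    walk-of done u v eu ev with kind-injective {u} {v} (trans eu (sym ev))
    ... | refl = stop , refl
    walk-of (hop a vl r) u v refl ev with walk-of r (vertex _ vl) v (kind-vertex vl) ev
    ... | w , refl = step (edge⇐ {u} {vertex _ vl} (subst (Adj _) (sym (kind-vertex vl)) a)) w , refl

    Within : ℕ → Kind → Kind → Set
    Within b k l = ∃[ i ] i ≤ b × Route k l i

    within-hop : ∀ {b k l l′} → Adj k l → Valid l → Within b l l′ → Within (suc b) k l′
    within-hop a v (i , i≤ , r) = suc i , s≤s i≤ , hop a v r

    within-snoc : ∀ {b k l l′} → Within b k l → Adj l l′ → Valid l′ → Within (suc b) k l′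
    within-snoc (i , i≤ , r) a v = suc i , s≤s i≤ , snoc r
      where
      snoc : ∀ {k i} → Route k _ i → Route k _ (suc i)
      snoc done         = hop a v done
      snoc (hop b u r′) = hop b u (snoc r′)

    via-zero : ∀ {c} → c < R → Within 3 (U c) (V c)
    via-zero c< = 3 , ≤-refl , hop (inj₁ u-own) c< (hop (inj₁ b-zero) (≤-trans (s≤s z≤n) 2≤m)
                    (hop (inj₂ v-zero) c< done))

    between : ∀ {k l} → Terminal k → Terminal l → Valid k → Valid l → Within 3 k l
    between (U a) (U b) va vb with <-cmp a b
    ... | tri< a<b _ _  = 2 , n≤1+n 2 , hop (inj₁ u-wˡ) (a<b , vb) (hop (inj₂ u-wʳ) vb done)
    ... | tri≈ _ refl _ = 0 , z≤n , done
    ... | tri> _ _ b<a  = 2 , n≤1+n 2 , hop (inj₁ u-wʳ) (b<a , va) (hop (inj₂ u-wˡ) vb done)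
    between (V a) (V b) va vb with <-cmp a b
    ... | tri< a<b _ _  = 2 , n≤1+n 2 , hop (inj₁ v-wˡ) (a<b , vb) (hop (inj₂ v-wʳ) vb done)
    ... | tri≈ _ refl _ = 0 , z≤n , done
    ... | tri> _ _ b<a  = 2 , n≤1+n 2 , hop (inj₁ v-wʳ) (b<a , va) (hop (inj₂ v-wˡ) vb done)
    between (U a) (V b) va vb with a ≟ b
    ... | yes refl = via-zero va
    ... | no a≢b   = 3 , ≤-refl , hop (inj₁ u-x) (a≢b , va , vb) (hop (inj₁ x-y) (a≢b , va , vb)
                       (hop (inj₂ v-y) vb done))
    between (V b) (U a) vb va with a ≟ b
    ... | yes refl = 3 , ≤-refl , hop (inj₁ v-zero) (≤-trans (s≤s z≤n) 2≤m) (hop (inj₂ b-zero) va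
                       (hop (inj₂ u-own) va done))
    ... | no a≢b   = 3 , ≤-refl , hop (inj₁ v-y) (a≢b , va , vb) (hop (inj₂ x-y) (a≢b , va , vb)
                       (hop (inj₂ u-x) va done))

    Beside : Kind → Set
    Beside k = Σ[ t ∈ Kind ] Terminal t × Valid t × (k ≡ t ⊎ Adj k t)

    beside : ∀ {k} → Valid k → Beside k
    beside {U c}    v             = U c , U c , v , inj₁ refl
    beside {V c}    v             = V c , V c , v , inj₁ refl
    beside {D c}    v             = U c , U c , v , inj₂ (inj₂ u-own)
    -- The other edges at `Z j` with j > 0 depend on the literals of the clause; `v-first` is always
    -- there.
    beside {Z j}    v             = V 0 , V 0 , R>0 , inj₂ (inj₂ v-first)
    beside {WU a b} (a<b , b<)    = U b , U b , b< , inj₂ (inj₂ u-wʳ)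
    beside {WV a b} (a<b , b<)    = V b , V b , b< , inj₂ (inj₂ v-wʳ)
    beside {X a b}  (_ , a< , b<) = U a , U a , a< , inj₂ (inj₂ u-x)
    beside {Y a b}  (_ , a< , b<) = V b , V b , b< , inj₂ (inj₂ v-y)

    everywhere : ∀ {k l} → Valid k → Valid l → Within 5 k l
    everywhere {k} {l} vk vl with beside {k} vk | beside {l} vl
    ... | s , ts , vs , ks | t , tt′ , vt , lt = outer ks (inner lt (between ts tt′ vs vt))
      where
      inner : (l ≡ t ⊎ Adj l t) → Within 3 s t → Within 4 s l
      inner (inj₁ refl) (i , i≤ , r) = i , ≤-trans i≤ (n≤1+n 3) , r
      inner (inj₂ a)    w            = within-snoc w (adj-sym a) vl
      outer : (k ≡ s ⊎ Adj k s) → Within 4 s l → Within 5 k l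
      outer (inj₁ refl) (i , i≤ , r) = i , ≤-trans i≤ (n≤1+n 4) , r
      outer (inj₂ a)    w            = within-hop a vs w

    short-walk : ∀ u v → Σ[ w ∈ Walk gadgetGraph u v ] edgeCount w ≤ 5
    short-walk u v with everywhere (kind-valid u) (kind-valid v)
    ... | i , i≤ , r with walk-of r u v refl refl
    ...   | w , refl = w , i≤

    open Distances (λ u v → proj₁ (short-walk u v)) public

    diameter≤6 : ∃[ k ] Diameter gadgetGraph k × k ≤ 6
    diameter≤6 = diameter λ u v →
      ≤-trans (dist-≤ (proj₁ (short-walk u v))) (≤-trans (proj₂ (short-walk u v)) (n≤1+n 5))

-- Geodesics from a satisfying assignment

module SatToGeodetic (n m : ℕ) (0<n : 0 < n) (2≤m : 2 ≤ m) (Lit : Bool → ℕ → ℕ → Set)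
                     (unused : ∀ b j → ¬ Lit b 0 j) (Lit? : ∀ b i j → Dec (Lit b i j)) where
  open Gadget n m 0<n 2≤m Lit unused

  module Forward
    (adjᵇ : ℕ → ℕ → Bool) (setᵇ : ℕ → Bool)
    (adj-correct : ∀ {k l} → Valid k → Valid l → T (adjᵇ (codeOf k) (codeOf l)) ⇔ Adj k l)
    (set-correct : ∀ {k} → Valid k → T (setᵇ (codeOf k)) ⇔ Terminal k)
    (σ : ℕ → Bool) (sat : ∀ j → 0 < j → j < m → Some n (λ i → Lit (σ i) i j)) where

    open Construction adjᵇ setᵇ adj-correct set-correct

    instance
      nonZero-m : NonZero m
      nonZero-m = >-nonZero (≤-trans (s≤s z≤n) 2≤m)

    data Mid : Set where
      one : Kind → Mid
      two : Kind → Kind → Mid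

    prevSlot nextSlot : ℕ → ℕ
    prevSlot zero    = pred m
    prevSlot (suc j) = j
    nextSlot j = choose (suc j ≟ m) 0 (suc j)

    prevSlot-< : ∀ {j} → j < m → prevSlot j < m
    prevSlot-< {zero}  _  = ≤-reflexive (suc-pred m)
    prevSlot-< {suc j} j< = <⇒≤ j<

    prevSlot-prev : ∀ j → PrevSlot j (prevSlot j)
    prevSlot-prev zero    = inj₁ (refl , suc-pred m)
    prevSlot-prev (suc j) = inj₂ refl

    nextSlot-< : ∀ {j} → j < m → nextSlot j < m
    nextSlot-< {j} j< with suc j ≟ m
    ... | yes _ = ≤-trans (s≤s z≤n) 2≤m
    ... | no ne = ≤∧≢⇒< j< ne

    prevSlot-nextSlot : ∀ j → prevSlot (nextSlot j) ≡ j
    prevSlot-nextSlot j with suc j ≟ m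
    ... | yes refl = refl
    ... | no _     = refl

    -- An agent whose literal does not occur in the clause of its slot still needs a geodesic and
    -- takes the dummy `Z 0`.
    target : Bool → ℕ → ℕ → ℕ
    target b i j = choose (Lit? b i j) j 0

    choice : Bool → ℕ → ℕ → Mid
    choice true  i j = two (D (j + i * m)) (Z (target true i j))
    choice false i j = two (D (prevSlot j + i * m)) (Z (target false i (prevSlot j)))

    gadget : ℕ → Mid
    gadget c = choice (σ (c / m)) (c / m) (c % m)

    gadget-≡ : ∀ i {j} → j < m → gadget (j + i * m) ≡ choice (σ i) i j
    gadget-≡ i {j} j<m rewrite radix-/ {m} {j} i j<m | radix-% {m} {j} i j<m = refl

    mid : Kind → Kind → Mid
    mid (U a) (U b) = one (WU a b)
    mid (V a) (V b) = one (WV a b)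
    mid (U a) (V b) = choose (a ≟ b) (gadget a) (two (X a b) (Y a b))
    mid _     _     = one (U 0)

    data Good (k l : Kind) : Mid → Set where
      one : ∀ {x} → Valid x → Adj k x → Adj x l → Good k l (one x)
      two : ∀ {x y} → Valid x → Valid y → Adj k x → Adj x y → Adj y l → Good k l (two x y)

    target-< : ∀ b i {j} → j < m → target b i j < m
    target-< b i {j} j< with Lit? b i j
    ... | yes _ = j<
    ... | no _  = ≤-trans (s≤s z≤n) 2≤m

    choice-good : ∀ b {i j} → i < n → j < m → Good (U (j + i * m)) (V (j + i * m)) (choice b i j)
    choice-good true {i} {j} i< j< =
      two (radix-< j< i<) (target-< true i j<) (inj₁ u-own) (inj₁ d-z) (inj₂ v-z)
      where
      d-z : Edge (D (j + i * m)) (Z (target true i j))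
      d-z with Lit? true i j
      ... | yes l = b-lit true (i , i< , refl , l)
      ... | no _  = b-zero
      v-z : Edge (V (j + i * m)) (Z (target true i j))
      v-z with Lit? true i j
      ... | yes l = v-pos (i , i< , refl , l)
      ... | no _  = v-zero
    choice-good false {i} {j} i< j< =
      two (radix-< (prevSlot-< j<) i<) (target-< false i (prevSlot-< j<)) (inj₁ (u-prev previous)) (inj₁ d-z)
          (inj₂ v-z)
      where
      previous : Prev (j + i * m) (prevSlot j + i * m)
      previous = i , i< , j , j< , prevSlot j , prevSlot-< j< , prevSlot-prev j , refl , refl
      d-z : Edge (D (prevSlot j + i * m)) (Z (target false i (prevSlot j)))
      d-z with Lit? false i (prevSlot j)
      ... | yes l = b-lit false (i , i< , refl , l)
      ... | no _  = b-zero
      v-z : Edge (V (j + i * m)) (Z (target false i (prevSlot j)))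
      v-z with Lit? false i (prevSlot j)
      ... | yes l = v-neg previous (i , i< , refl , l)
      ... | no _  = v-zero

    gadget-good : ∀ {c} → c < R → Good (U c) (V c) (gadget c)
    gadget-good {c} c<R with radix-exists {c} n m c<R
    ... | j , i , j< , i< , refl rewrite gadget-≡ i j< = choice-good (σ i) i< j<

    mid-good : ∀ {k l} → Terminal k → Terminal l → Valid k → Valid l → codeOf k < codeOf l → Good k l (mid k l)
    mid-good (U a) (U b) va vb lt = one (diagonal-< 0 lt , vb) (inj₁ u-wˡ) (inj₂ u-wʳ)
    mid-good (V a) (V b) va vb lt = one (diagonal-< 1 lt , vb) (inj₁ v-wˡ) (inj₂ v-wʳ)
    mid-good (V a) (U b) va vb lt = contradiction (<-trans lt (U<V {b} {a} vb)) (<-irrefl refl)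
    mid-good (U a) (V b) va vb lt with a ≟ b
    ... | yes refl = gadget-good va
    ... | no a≢b   = two (a≢b , va , vb) (a≢b , va , vb) (inj₁ u-x) (inj₁ x-y) (inj₂ v-y)

    edge-to : ∀ {u k} (v : Valid k) → Adj (kind u) k → T (adjᵇ (toℕ u) (toℕ (vertex k v)))
    edge-to {u} v a = edge⇐ {u} {vertex _ v} (subst (Adj (kind u)) (sym (kind-vertex v)) a)

    edge-from : ∀ {u k} (v : Valid k) → Adj k (kind u) → T (adjᵇ (toℕ (vertex k v)) (toℕ u))
    edge-from {u} v a = edge⇐ {vertex _ v} {u} (subst (λ k → Adj k (kind u)) (sym (kind-vertex v)) a)

    build : ∀ {u v M} → Good (kind u) (kind v) M → Walk gadgetGraph u v
    build {u} {v} (one vx a b) = step (edge-to {u} vx a) (step (edge-from {v} vx b) stop)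
    build {u} {v} (two {x} {y} vx vy a b c) = step (edge-to {u} vx a)
      (step (edge-from {vertex y vy} vx (subst (Adj x) (sym (kind-vertex vy)) b))
        (step (edge-from {v} vy c) stop))

    -- Vertices of the set are pairwise non-adjacent, so two edges are always needed; the
    -- bipartition excludes a walk of length 2 wherever one of length 3 exists.
    build-minimal : ∀ {u v M} → Terminal (kind u) → Terminal (kind v) → u ≢ v →
                    (g : Good (kind u) (kind v) M) → Minimal (build {u} {v} g)
    build-minimal tu tv u≢v g stop = contradiction refl u≢v
    build-minimal {u} {v} tu tv u≢v g (step e stop) = ⊥-elim (terminal-free tu tv (edge⇒ {u} {v} e))
    build-minimal tu tv u≢v (one _ _ _) (step e (step e′ w)) = s≤s (s≤s z≤n)
    build-minimal {u} {v} tu tv u≢v (two _ _ a b c) (step {v = x} e (step e′ stop)) =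
      ⊥-elim (not-≢ same refl)
      where
      same : side (kind v) ≡ not (side (kind v))
      same = trans (trans (adj-side c) (cong not (trans (adj-side b)
          (trans (cong not (adj-side a)) (not-involutive _)))))
                   (cong not (sym (trans (adj-side (edge⇒ {x} {v} e′))
                       (trans (cong not (adj-side (edge⇒ {u} {x} e))) (not-involutive _)))))
    build-minimal tu tv u≢v (two _ _ _ _ _) (step e (step e′ (step e″ w))) = s≤s (s≤s (s≤s z≤n))

    code-order : ∀ {u v} → u Fin.< v → codeOf (kind u) < codeOf (kind v)
    code-order {u} {v} = subst₂ _<_ (sym (code-kind u)) (sym (code-kind v))

    good : ∀ {u v} → u ∈ terminals → v ∈ terminals → u Fin.< v → Good (kind u) (kind v) (mid (kind u) (kind v))
    good {u} {v} u∈ v∈ u<v =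
      mid-good (∈⇒terminal u∈) (∈⇒terminal v∈) (kind-valid u) (kind-valid v) (code-order {u} {v} u<v)

    assignment : ShortestPathAssignment gadgetGraph terminals
    assignment {u} {v} u∈ v∈ u<v = minimal⇒shortest (build {u} {v} (good u∈ v∈ u<v))
      (build-minimal {u} {v} (∈⇒terminal u∈) (∈⇒terminal v∈) (λ { refl → <-irrefl refl u<v }) (good u∈ v∈ u<v))

    data Has : Mid → Kind → Set where
      one  : ∀ {x} → Has (one x) x
      two₁ : ∀ {x y} → Has (two x y) x
      two₂ : ∀ {x y} → Has (two x y) y

    on-path : ∀ {u v x M} (g : Good (kind u) (kind v) M) → Has M (kind x) → x ∈ˡ vertices (build {u} {v} g)
    on-path (one vx _ _)      one  = there (here (sym (kind-injective (kind-vertex vx))))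
    on-path (two vx _ _ _ _)  two₁ = there (here (sym (kind-injective (kind-vertex vx))))
    on-path (two _ vy _ _ _)  two₂ = there (there (here (sym (kind-injective (kind-vertex vy)))))

    Covered : Fin N → Set
    Covered x = ∃[ u ] ∃[ v ] Σ[ u∈ ∈ u ∈ terminals ] Σ[ v∈ ∈ v ∈ terminals ] Σ[ u<v ∈ u Fin.< v ]
                  x ∈ˡ vertices (walk (path (assignment u∈ v∈ u<v)))

    covered-by : ∀ {x k l} → Terminal k → Terminal l → (vk : Valid k) (vl : Valid l) → codeOf k < codeOf l →
                 Has (mid k l) (kind x) → Covered x
    covered-by {x} {k} {l} tk tl vk vl lt has =
      u , v , u∈ , v∈ , u<v ,
      on-path {u} {v} (good u∈ v∈ u<v)
        (subst (λ M → Has M (kind x)) (sym (cong₂ mid (kind-vertex vk) (kind-vertex vl))) has)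
      where
      u v : Fin N
      u = vertex k vk
      v = vertex l vl
      u∈ : u ∈ terminals
      u∈ = terminal⇒∈ (subst Terminal (sym (kind-vertex vk)) tk)
      v∈ : v ∈ terminals
      v∈ = terminal⇒∈ (subst Terminal (sym (kind-vertex vl)) tl)
      u<v : u Fin.< v
      u<v = subst₂ _<_ (sym (toℕ-vertex vk)) (sym (toℕ-vertex vl)) lt

    by-gadget : ∀ {x i j} → i < n → j < m → Has (choice (σ i) i j) (kind x) → Covered x
    by-gadget {x} {i} {j} i< j< has = covered-by {x} (U c) (V c) c< c< (U<V {c} {c} c<) has′
      where
      c : ℕ
      c = j + i * m
      c< : c < R
      c< = radix-< j< i<
      has′ : Has (mid (U c) (V c)) (kind x)
      has′ with c ≟ c
      ... | yes _  = subst (λ M → Has M (kind x)) (sym (gadget-≡ i j<)) has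
      ... | no c≢c = contradiction refl c≢c

    by-pair : ∀ {x a b} → a ≢ b → a < R → b < R → Has (two (X a b) (Y a b)) (kind x) → Covered x
    by-pair {x} {a} {b} a≢b a< b< has = covered-by {x} (U a) (V b) a< b< (U<V {a} {b} a<) has′
      where
      has′ : Has (mid (U a) (V b)) (kind x)
      has′ with a ≟ b
      ... | yes a≡b = contradiction a≡b a≢b
      ... | no _    = has

    choice-own : ∀ {i j b} → b ≡ true → Has (choice b i j) (D (j + i * m))
    choice-own refl = two₁

    choice-next : ∀ {i j b} → b ≡ false → Has (choice b i (nextSlot j)) (D (j + i * m))
    choice-next {i} {j} refl = subst (λ k → Has (choice false i (nextSlot j)) (D (k + i * m)))
        (prevSlot-nextSlot j) two₁

    target-lit : ∀ b {i j} → Lit b i j → target b i j ≡ j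
    target-lit b {i} {j} l with Lit? b i j
    ... | yes _ = refl
    ... | no ¬l = contradiction l ¬l

    target-unused : ∀ b j → target b 0 j ≡ 0
    target-unused b j with Lit? b 0 j
    ... | yes l = contradiction l (unused b j)
    ... | no _  = refl

    covers : ∀ x → ¬ Terminal (kind x) → Covered x
    covers x ¬t = by-kind (kind x) refl
      where
      has-as : ∀ {M k} → kind x ≡ k → Has M k → Has M (kind x)
      has-as eq = subst (Has _) (sym eq)
      valid-as : ∀ {k} → kind x ≡ k → Valid k
      valid-as eq = subst Valid eq (kind-valid x)
      clause : ∀ j → kind x ≡ Z j → Covered x
      clause zero eq = by-gadget {x} 0<n (≤-trans (s≤s z≤n) 2≤m) (has-as eq (zero-target (σ 0)))
        where
        zero-target : ∀ b → Has (choice b 0 0) (Z 0)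
        zero-target true  = subst (λ k → Has (choice true 0 0) (Z k)) (target-unused true 0) two₂
        zero-target false = subst (λ k → Has (choice false 0 0) (Z k)) (target-unused false (pred m)) two₂
      clause (suc j) eq with sat (suc j) (s≤s z≤n) (valid-as eq)
      ... | i , i< , l with σ i in e
      ...   | true  = by-gadget {x} i< (valid-as eq) (has-as eq
          (subst (λ b → Has (choice b i (suc j)) (Z (suc j))) (sym e)
                        (subst (λ k → Has (choice true i (suc j)) (Z k)) (target-lit true l) two₂)))
      -- Agents of a false variable turn to the D before their own, so it is the agent of the
      -- following slot that passes through this clause.
      ...   | false = by-gadget {x} i< (nextSlot-< (valid-as eq))
                        (has-as eq (subst (λ b → Has (choice b i (nextSlot (suc j))) (Z (suc j))) (sym e)
                          (subst (λ k → Has (choice false i (nextSlot (suc j))) (Z k))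
                            (trans (cong (target false i) (prevSlot-nextSlot (suc j))) (target-lit false l)) two₂)))
      by-kind : ∀ k → kind x ≡ k → Covered x
      by-kind (U c) eq = contradiction (subst Terminal (sym eq) (U c)) ¬t
      by-kind (V c) eq = contradiction (subst Terminal (sym eq) (V c)) ¬t
      by-kind (Z j) eq = clause j eq
      by-kind (D c) eq with radix-exists {c} n m (valid-as eq)
      ... | j , i , j< , i< , refl with σ i in e
      ...   | true  = by-gadget {x} i< j< (has-as eq (choice-own e))
      ...   | false = by-gadget {x} i< (nextSlot-< j<) (has-as eq (choice-next e))
      by-kind (WU a b) eq with valid-as eq
      ... | a<b , b< = covered-by {x} (U a) (U b) (<-trans a<b b<) b< (diagonal-mono 0 a<b) (has-as eq one)
      by-kind (WV a b) eq with valid-as eq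
      ... | a<b , b< = covered-by {x} (V a) (V b) (<-trans a<b b<) b< (diagonal-mono 1 a<b) (has-as eq one)
      by-kind (X a b) eq with valid-as eq
      ... | a≢b , a< , b< = by-pair {x} a≢b a< b< (has-as eq two₁)
      by-kind (Y a b) eq with valid-as eq
      ... | a≢b , a< , b< = by-pair {x} a≢b a< b< (has-as eq two₂)

    geodetic : StrongGeodetic gadgetGraph terminals
    geodetic = assignment , λ x x∉ → covers x (λ t → x∉ (terminal⇒∈ t))

  toGeodetic : (adjᵇ : ℕ → ℕ → Bool) (setᵇ : ℕ → Bool)
    (adj-correct : ∀ {k l} → Valid k → Valid l → T (adjᵇ (codeOf k) (codeOf l)) ⇔ Adj k l)
    (set-correct : ∀ {k} → Valid k → T (setᵇ (codeOf k)) ⇔ Terminal k) →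
    Satisfiable n m Lit →
    StrongGeodetic (Construction.gadgetGraph adjᵇ setᵇ adj-correct set-correct)
                   (Construction.terminals adjᵇ setᵇ adj-correct set-correct)
  toGeodetic adjᵇ setᵇ adj-correct set-correct (σ , sat) =
    Forward.geodetic adjᵇ setᵇ adj-correct set-correct σ sat

-- A satisfying assignment from geodesics

module GeodeticToSat (n m : ℕ) (0<n : 0 < n) (2≤m : 2 ≤ m) (Lit : Bool → ℕ → ℕ → Set)
                     (unused : ∀ b j → ¬ Lit b 0 j) where
  open Gadget n m 0<n 2≤m Lit unused

  prevSlot-irrefl : ∀ {j} → ¬ PrevSlot j j
  prevSlot-irrefl (inj₁ (refl , 1≡m)) = <-irrefl 1≡m 2≤m
  prevSlot-irrefl (inj₂ eq)           = contradiction eq (<⇒≢ ≤-refl)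

  prevSlot-injective : ∀ {i j k} → i < m → j < m → PrevSlot i k → PrevSlot j k → i ≡ j
  prevSlot-injective i< j< (inj₁ (refl , _)) (inj₁ (refl , _)) = refl
  prevSlot-injective i< j< (inj₁ (refl , e)) (inj₂ refl)       = contradiction e (<⇒≢ j<)
  prevSlot-injective i< j< (inj₂ refl)       (inj₁ (refl , e)) = contradiction e (<⇒≢ i<)
  prevSlot-injective i< j< (inj₂ refl)       (inj₂ refl)       = refl

  prev-irrefl : ∀ {c} → ¬ Prev c c
  prev-irrefl (i , _ , j , j< , k , k< , pr , refl , e)
    with refl ← proj₁ (radix-unique i i j< k< e) = prevSlot-irrefl pr

  prev-inverse : ∀ {i j k e} → j < m → k < m → PrevSlot j k → Prev e (k + i * m) → e ≡ j + i * m
  prev-inverse {i} j< k< pr (i′ , _ , j′ , j′< , k′ , k′< , pr′ , refl , e)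
    with refl , refl ← radix-unique i i′ k< k′< e
    with refl ← prevSlot-injective j< j′< pr pr′ = refl

  -- Here c sits at slot j itself. A `v-neg` edge would put the vertex before c at slot j too, and
  -- `v-first` would make c = 0, which is at slot 0. Only a positive literal remains.
  own-literal : ∀ {c j s} → 0 < j → j < m → At-lit s c j → Edge (V c) (Z j) →
      Some n (λ i → c ≡ j + i * m × Lit true i j)
  own-literal {j = suc _} _ j<m (i , i< , () , l) v-first
  own-literal 0<j j<m at v-zero = contradiction 0<j λ ()
  own-literal 0<j j<m at (v-pos at′) = at′
  own-literal 0<j j<m (i , i< , e , l) (v-neg (i′ , _ , j′ , j′< , k′ , k′< , pr , e′ , e″) (i″ , _ , e‴ , _))
    with refl ← proj₁ (radix-unique i i′ j<m j′< (trans (sym e) e′))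
       | refl ← proj₁ (radix-unique i′ i″ k′< j<m (trans (sym e″) e‴)) = ⊥-elim (prevSlot-irrefl pr)

  -- Here the vertex before c sits at slot j, which excludes `v-pos`. An edge `v-first` would place
  -- the literal in variable 0, which occurs in no clause.
  prev-literal : ∀ {c e j s} → 0 < j → j < m → Prev c e → At-lit s e j → Edge (V c) (Z j) →
                 Some n (λ i → Some m (λ k → c ≡ k + i * m) × Lit false i j)
  prev-literal 0<j j<m (i , i< , j₁ , j₁< , k , k< , pr , ce , ee) (i₁ , i₁< , e₁ , l) v-first
    with refl ← proj₂ (radix-unique {m} 0 i (≤-trans (s≤s z≤n) 2≤m) j₁< ce)
    with refl ← proj₂ (radix-unique i₁ 0 j<m k< (trans (sym e₁) ee)) = contradiction l (unused _ _)
  prev-literal 0<j j<m pr at v-zero = contradiction 0<j λ ()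
  prev-literal 0<j j<m (i , i< , j₁ , j₁< , k , k< , pr , ce , ee) (i₁ , i₁< , e₁ , l) (v-pos (i₂ , _ , e₂ , _))
    with refl ← proj₁ (radix-unique i i₂ j₁< j<m (trans (sym ce) e₂))
       | refl ← proj₁ (radix-unique i i₁ k< j<m (trans (sym ee) e₁)) = ⊥-elim (prevSlot-irrefl pr)
  prev-literal 0<j j<m pr at (v-neg (i₂ , i₂< , j₂ , j₂< , k₂ , k₂< , pr₂ , ce₂ , ee₂) (i₃ , _ , e₃ , l))
    with refl ← proj₂ (radix-unique i₂ i₃ k₂< j<m (trans (sym ee₂) e₃)) = i₂ , i₂< , (j₂ , j₂< , ce₂) , l

  module Backward
    (adjᵇ : ℕ → ℕ → Bool) (setᵇ : ℕ → Bool)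
    (adj-correct : ∀ {k l} → Valid k → Valid l → T (adjᵇ (codeOf k) (codeOf l)) ⇔ Adj k l)
    (set-correct : ∀ {k} → Valid k → T (setᵇ (codeOf k)) ⇔ Terminal k)
    (I : ShortestPathAssignment
        (Gadget.Construction.gadgetGraph n m 0<n 2≤m Lit unused adjᵇ setᵇ adj-correct set-correct)
                                (Gadget.Construction.terminals n m 0<n 2≤m Lit unused adjᵇ setᵇ adj-correct set-correct))
    (cover : ∀ x → x ∉ Gadget.Construction.terminals n m 0<n 2≤m Lit unused adjᵇ setᵇ adj-correct set-correct →
             ∃[ u ] ∃[ v ] Σ[ u∈ ∈ u ∈ _ ] Σ[ v∈ ∈ v ∈ _ ] Σ[ u<v ∈ u Fin.< v ] x ∈ˡ vertices
                 (walk (path (I u∈ v∈ u<v))))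
    where

    open Construction adjᵇ setᵇ adj-correct set-correct

    adj : ∀ {u v} → T (adjᵇ (toℕ u) (toℕ v)) → Adj (kind u) (kind v)
    adj {u} {v} = edge⇒ {u} {v}

    module Pair {s t} (s∈ : s ∈ terminals) (t∈ : t ∈ terminals) (s<t : s Fin.< t) where

      route : Walk gadgetGraph s t
      route = walk (path (I s∈ t∈ s<t))

      route-≤ : edgeCount route ≤ 3
      route-≤ with between (∈⇒terminal s∈) (∈⇒terminal t∈) (kind-valid s) (kind-valid t)
      ... | i , i≤ , r with walk-of r s t refl refl
      ...   | w , refl = ≤-trans (shortest-≤ (I s∈ t∈ s<t) w) i≤

    data Interior (s t : Fin N) : List (Fin N) → Set where
      one : ∀ {x} → Adj (kind s) (kind x) → Adj (kind x) (kind t) → Interior s t (x ∷ [])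
      two : ∀ {x y} → Adj (kind s) (kind x) → Adj (kind x) (kind y) → Adj (kind y) (kind t) →
            Interior s t (x ∷ y ∷ [])

    interior : ∀ {s t} → Terminal (kind s) → Terminal (kind t) → s ≢ t → (w : Walk gadgetGraph s t) →
        edgeCount w ≤ 3 →
               Σ[ xs ∈ List (Fin N) ] Interior s t xs × (∀ {x} → x ∈ˡ vertices w → ¬ Terminal (kind x) → x ∈ˡ xs)
    interior ts tt′ s≢t stop _ = contradiction refl s≢t
    interior {s} {t} ts tt′ s≢t (step e stop) _ = ⊥-elim (terminal-free ts tt′ (adj {s} {t} e))
    interior {s} {t} ts tt′ s≢t (step {v = x} e (step e′ stop)) _ =
      x ∷ [] , one (adj {s} {x} e) (adj {x} {t} e′) , λ
        { (here refl) ¬t → contradiction ts ¬t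
        ; (there (here refl)) _ → here refl
        ; (there (there (here refl))) ¬t → contradiction tt′ ¬t }
    interior {s} {t} ts tt′ s≢t (step {v = x} e (step {v = y} e′ (step e″ stop))) _ =
      x ∷ y ∷ [] , two (adj {s} {x} e) (adj {x} {y} e′) (adj {y} {t} e″) , λ
        { (here refl) ¬t → contradiction ts ¬t
        ; (there (here refl)) _ → here refl
        ; (there (there (here refl))) _ → there (here refl)
        ; (there (there (there (here refl)))) ¬t → contradiction tt′ ¬t }
    interior ts tt′ s≢t (step _ (step _ (step _ (step _ _)))) (s≤s (s≤s (s≤s ())))

    record Chosen (s t : Fin N) : Set where
      field
        s∈ : s ∈ terminals
        t∈ : t ∈ terminals
        s<t : s Fin.< t

    open Chosen

    order : ∀ {s t} → Chosen s t → codeOf (kind s) < codeOf (kind t)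
    order {s} {t} p = subst₂ _<_ (sym (code-kind s)) (sym (code-kind t)) (s<t p)

    abstract
      through : ∀ {s t} (p : Chosen s t) → Σ[ xs ∈ List (Fin N) ] Interior s t xs ×
                (∀ {x} → x ∈ˡ vertices (Pair.route (s∈ p) (t∈ p) (s<t p)) → ¬ Terminal (kind x) → x ∈ˡ xs)
      through p = interior (∈⇒terminal (s∈ p)) (∈⇒terminal (t∈ p)) (λ { refl → <-irrefl refl (s<t p) })
                    (Pair.route (s∈ p) (t∈ p) (s<t p)) (Pair.route-≤ (s∈ p) (t∈ p) (s<t p))

    walk-through : ∀ {s t} → Chosen s t → List (Fin N)
    walk-through p = proj₁ (through p)

    is-interior : ∀ {s t} (p : Chosen s t) → Interior s t (walk-through p)
    is-interior p = proj₁ (proj₂ (through p))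

    same-chosen : ∀ {s t} (p q : Chosen s t) → walk-through p ≡ walk-through q
    same-chosen record { s∈ = a ; t∈ = b ; s<t = c } record { s∈ = a′ ; t∈ = b′ ; s<t = c′ }
      with refl ← []=-irrelevant a a′ | refl ← []=-irrelevant b b′ | refl ← <-irrelevant c c′ = refl

    covered : ∀ {x} → ¬ Terminal (kind x) → ∃[ s ] ∃[ t ] Σ[ p ∈ Chosen s t ] x ∈ˡ walk-through p
    covered {x} ¬t = from (cover x (λ x∈ → ¬t (∈⇒terminal x∈)))
      where
      from : ∃[ u ] ∃[ v ] Σ[ u∈ ∈ u ∈ terminals ] Σ[ v∈ ∈ v ∈ terminals ] Σ[ u<v ∈ u Fin.< v ]
               x ∈ˡ vertices (walk (path (I u∈ v∈ u<v))) →
             ∃[ s ] ∃[ t ] Σ[ p ∈ Chosen s t ] x ∈ˡ walk-through p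
      from (s , t , s∈ , t∈ , s<t , x∈) =
        s , t , record { s∈ = s∈ ; t∈ = t∈ ; s<t = s<t } ,
        proj₂ (proj₂ (through (record { s∈ = s∈ ; t∈ = t∈ ; s<t = s<t }))) x∈ ¬t

    -- Geodesics through private vertices

    wu-neighbour : ∀ {k a b} → Adj k (WU a b) → k ≡ U a ⊎ k ≡ U b
    wu-neighbour (inj₁ u-wˡ) = inj₁ refl
    wu-neighbour (inj₁ u-wʳ) = inj₂ refl
    wu-neighbour (inj₂ ())

    wv-neighbour : ∀ {k a b} → Adj k (WV a b) → k ≡ V a ⊎ k ≡ V b
    wv-neighbour (inj₁ v-wˡ) = inj₁ refl
    wv-neighbour (inj₁ v-wʳ) = inj₂ refl
    wv-neighbour (inj₂ ())

    x-neighbour : ∀ {k a b} → Adj k (X a b) → k ≡ U a ⊎ k ≡ Y a b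
    x-neighbour (inj₁ u-x) = inj₁ refl
    x-neighbour (inj₂ x-y) = inj₂ refl

    y-neighbour : ∀ {k a b} → Adj k (Y a b) → Terminal k → k ≡ V b
    y-neighbour (inj₁ v-y) _ = refl
    y-neighbour (inj₂ ())  _

    terminal-U : ∀ {k a} → k ≡ U a → Terminal k
    terminal-U refl = U _

    -- All neighbours of the private vertex are `k` and `l`, both in the set. With a second interior
    -- vertex, one of these would be interior and adjacent to an end, but vertices of the set are
    -- never adjacent.
    forced-w : ∀ {s t x xs k l} → Terminal (kind s) → Terminal (kind t) → codeOf (kind s) < codeOf (kind t) →
               Terminal k → Terminal l → codeOf k < codeOf l →
               (∀ {i} → Adj i (kind x) → i ≡ k ⊎ i ≡ l) →
               Interior s t xs → x ∈ˡ xs → kind s ≡ k × kind t ≡ l × xs ≡ x ∷ []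
    forced-w {s} {t} ts tt′ s<t tk tl k<l nb (one a b) (here refl) with nb a | nb (adj-sym b)
    ... | inj₁ es | inj₁ et = contradiction s<t (<-irrefl (cong codeOf (trans es (sym et))))
    ... | inj₁ es | inj₂ et = es , et , refl
    ... | inj₂ es | inj₁ et =
      contradiction (<-trans s<t (subst₂ _<_ (cong codeOf (sym et)) (cong codeOf (sym es)) k<l)) (<-irrefl refl)
    ... | inj₂ es | inj₂ et = contradiction s<t (<-irrefl (cong codeOf (trans es (sym et))))
    forced-w ts tt′ s<t tk tl k<l nb (two a b c) (here refl) with nb (adj-sym b)
    ... | inj₁ e = ⊥-elim (terminal-free (subst Terminal (sym e) tk) tt′ c)
    ... | inj₂ e = ⊥-elim (terminal-free (subst Terminal (sym e) tl) tt′ c)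
    forced-w ts tt′ s<t tk tl k<l nb (two a b c) (there (here refl)) with nb b
    ... | inj₁ e = ⊥-elim (terminal-free ts (subst Terminal (sym e) tk) a)
    ... | inj₂ e = ⊥-elim (terminal-free ts (subst Terminal (sym e) tl) a)

    V≮U : ∀ {a b} → Valid (U a) → ¬ (codeOf (V b) < codeOf (U a))
    V≮U {a} {b} a< lt = <-irrefl refl (<-trans lt (U<V {a} {b} a<))

    -- The neighbours of `X a b` are `U a` and `Y a b` only, so the path continues to `Y a b` and
    -- from there to `V b`; the reverse direction contradicts the order of the codes.
    forced-x : ∀ {s t x xs a b} → Terminal (kind s) → Terminal (kind t) → codeOf (kind s) < codeOf (kind t) →
               kind x ≡ X a b → Interior s t xs → x ∈ˡ xs →
               kind s ≡ U a × kind t ≡ V b × Σ[ y ∈ Fin N ] kind y ≡ Y a b × xs ≡ x ∷ y ∷ []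
    forced-x ts tt′ s<t ex (one a b) (here refl)
      with x-neighbour (subst (Adj _) ex a) | x-neighbour (subst (Adj _) ex (adj-sym b))
    ... | inj₁ es | inj₁ et = contradiction s<t (<-irrefl (cong codeOf (trans es (sym et))))
    ... | inj₂ es | _       = contradiction (subst Terminal es ts) λ ()
    ... | _       | inj₂ et = contradiction (subst Terminal et tt′) λ ()
    forced-x {s} {t} ts tt′ s<t ex (two {y = y} a b c) (here refl)
      with x-neighbour (subst (Adj _) ex a) | x-neighbour (subst (Adj _) ex (adj-sym b))
    ... | inj₁ es | inj₂ ey = es , y-neighbour (subst (Adj _) ey (adj-sym c)) tt′ , y , ey , refl
    ... | inj₂ es | _       = contradiction (subst Terminal es ts) λ ()
    ... | _       | inj₁ ey = ⊥-elim (terminal-free (terminal-U ey) tt′ c)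
    forced-x {s} {t} {a = i} {j} ts tt′ s<t ex (two a b c) (there (here refl))
      with x-neighbour (subst (Adj _) ex (adj-sym c)) | x-neighbour (subst (Adj _) ex b)
    ... | inj₂ et | _       = contradiction (subst Terminal et tt′) λ ()
    ... | _       | inj₁ ep = ⊥-elim (terminal-free ts (terminal-U ep) a)
    ... | inj₁ et | inj₂ ep =
      contradiction (subst₂ (λ k l → codeOf k < codeOf l) (y-neighbour (subst (Adj _) ep a) ts) et s<t)
        (V≮U {i} {j} (subst Valid et (kind-valid t)))

    -- The vertices without a pair of their own, for which the pairs `U c`, `V c` compete.
    data Public : Kind → Set where
      public-d : ∀ d → Public (D d)
      public-z : ∀ j → Public (Z j)

    public-interior : ∀ {k} → Public k → ¬ Terminal k
    public-interior (public-d _) ()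
    public-interior (public-z _) ()

    transport : ∀ {s t s′ t′} → kind s ≡ kind s′ → kind t ≡ kind t′ → (p : Chosen s t) (q : Chosen s′ t′) →
                walk-through p ≡ walk-through q
    transport {s} {t} {s′} {t′} es et p q with kind-injective {s} {s′} es | kind-injective {t} {t′} et
    ... | refl | refl = same-chosen p q

    -- The private vertex `w` has to be covered, which is possible only by the pair k, l. Since a
    -- pair has just one chosen path, this path consists of `w` and covers nothing public.
    forced-by-w : ∀ {s t k l w} → (v : Valid w) → ¬ Terminal w → ¬ Public w → Terminal k → Terminal l →
                  codeOf k < codeOf l → (∀ {i} → Adj i w → i ≡ k ⊎ i ≡ l) → kind s ≡ k → kind t ≡ l →
                  (p : Chosen s t) → ∀ {x} → Public (kind x) → ¬ (x ∈ˡ walk-through p)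
    forced-by-w {s} {t} {k} {l} {w} v ¬tw ¬pw tk tl k<l nb es et p {x} px x∈
      with covered {vertex w v} (λ t → ¬tw (subst Terminal (kind-vertex v) t))
    ... | s′ , t′ , q , w∈
      with forced-w (∈⇒terminal (s∈ q)) (∈⇒terminal (t∈ q)) (order q) tk tl k<l
             (λ a → nb (subst (Adj _) (kind-vertex v) a)) (is-interior q) w∈
    ... | es′ , et′ , eq
      with subst (x ∈ˡ_) (trans (transport (trans es (sym es′)) (trans et (sym et′)) p q) eq) x∈
    ... | here refl = ¬pw (subst Public (kind-vertex v) px)

    forced-by-x : ∀ {s t a b} → Valid (X a b) → kind s ≡ U a → kind t ≡ V b →
                  (p : Chosen s t) → ∀ {x} → Public (kind x) → ¬ (x ∈ˡ walk-through p)
    forced-by-x {s} {t} {a} {b} v es et p {x} px x∈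
      with covered {vertex (X a b) v} (λ t → contradiction (subst Terminal (kind-vertex v) t) λ ())
    ... | s′ , t′ , q , w∈
      with forced-x (∈⇒terminal (s∈ q)) (∈⇒terminal (t∈ q)) (order q) (kind-vertex v) (is-interior q) w∈
    ... | es′ , et′ , y , ey , eq
      with subst (x ∈ˡ_) (trans (transport (trans es (sym es′)) (trans et (sym et′)) p q) eq) x∈
    ... | here refl = contradiction (subst Public (kind-vertex v) px) λ ()
    ... | there (here refl) = contradiction (subst Public ey px) λ ()

    only-gadgets : ∀ {s t} (p : Chosen s t) {x} → Public (kind x) → x ∈ˡ walk-through p →
                   ∃[ c ] kind s ≡ U c × kind t ≡ V c
    only-gadgets {s} {t} p {x} px x∈ =
      by-kinds (∈⇒terminal (s∈ p)) (∈⇒terminal (t∈ p)) refl refl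
      where
      by-kinds : ∀ {k l} → Terminal k → Terminal l → kind s ≡ k → kind t ≡ l → ∃[ c ] kind s ≡ U c × kind t ≡ V c
      by-kinds (V a) (U b) es et =
        contradiction (subst₂ (λ k l → codeOf k < codeOf l) es et (order p))
            (V≮U {b} {a} (subst Valid et (kind-valid t)))
      by-kinds (U a) (V b) es et with a ≟ b
      ... | yes refl = a , es , et
      ... | no a≢b   = ⊥-elim (forced-by-x (a≢b , subst Valid es (kind-valid s) , subst Valid et (kind-valid t))
                         es et p {x} px x∈)
      by-kinds (U a) (U b) es et = ⊥-elim (forced-by-w {w = WU a b} (diagonal-< 0 lt , subst Valid et (kind-valid t))
        (λ ()) (λ ()) (U a) (U b) lt wu-neighbour es et p {x} px x∈)
        where
        lt : codeOf (U a) < codeOf (U b)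
        lt = subst₂ (λ k l → codeOf k < codeOf l) es et (order p)
      by-kinds (V a) (V b) es et = ⊥-elim (forced-by-w {w = WV a b} (diagonal-< 1 lt , subst Valid et (kind-valid t))
        (λ ()) (λ ()) (V a) (V b) lt wv-neighbour es et p {x} px x∈)
        where
        lt : codeOf (V a) < codeOf (V b)
        lt = subst₂ (λ k l → codeOf k < codeOf l) es et (order p)

    -- The choices of the agents

    record Pick (c : ℕ) (xs : List (Fin N)) : Set where
      field
        d j    : ℕ
        {x z}  : Fin N
        path-≡ : xs ≡ x ∷ z ∷ []
        kind-x : kind x ≡ D d
        kind-z : kind z ≡ Z j
        moved  : d ≡ c ⊎ Prev c d
        v-z    : Edge (V c) (Z j)
        d-z    : Edge (D d) (Z j)

    data Inner (c : ℕ) : Kind → Kind → Set where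
      inner : ∀ {d j} → d ≡ c ⊎ Prev c d → Edge (V c) (Z j) → Edge (D d) (Z j) → Inner c (D d) (Z j)

    inner-kinds : ∀ {c k l} → Valid k → Adj (U c) k → Adj k l → Adj l (V c) → Inner c k l
    inner-kinds v (inj₁ u-own)      (inj₁ e)          (inj₂ e′) = last (inj₁ refl) e e′
      where
      last : ∀ {c d l} → d ≡ c ⊎ Prev c d → Edge (D d) l → Edge (V c) l → Inner c (D d) l
      last mv b-zero      e′ = inner mv e′ b-zero
      last mv (b-lit s l) e′ = inner mv e′ (b-lit s l)
    inner-kinds v (inj₁ (u-prev p)) (inj₁ e)          (inj₂ e′) = last (inj₂ p) e e′
      where
      last : ∀ {c d l} → d ≡ c ⊎ Prev c d → Edge (D d) l → Edge (V c) l → Inner c (D d) l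
      last mv b-zero      e′ = inner mv e′ b-zero
      last mv (b-lit s l) e′ = inner mv e′ (b-lit s l)
    inner-kinds v (inj₁ u-own)      (inj₁ b-zero)      (inj₁ ())
    inner-kinds v (inj₁ u-own)      (inj₁ (b-lit _ _)) (inj₁ ())
    inner-kinds v (inj₁ (u-prev _)) (inj₁ b-zero)      (inj₁ ())
    inner-kinds v (inj₁ (u-prev _)) (inj₁ (b-lit _ _)) (inj₁ ())
    inner-kinds v (inj₁ u-own)      (inj₂ u-own)       (inj₁ ())
    inner-kinds v (inj₁ u-own)      (inj₂ u-own)       (inj₂ ())
    inner-kinds v (inj₁ u-own)      (inj₂ (u-prev _))  (inj₁ ())
    inner-kinds v (inj₁ u-own)      (inj₂ (u-prev _))  (inj₂ ())
    inner-kinds v (inj₁ (u-prev _)) (inj₂ u-own)       (inj₁ ())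
    inner-kinds v (inj₁ (u-prev _)) (inj₂ u-own)       (inj₂ ())
    inner-kinds v (inj₁ (u-prev _)) (inj₂ (u-prev _))  (inj₁ ())
    inner-kinds v (inj₁ (u-prev _)) (inj₂ (u-prev _))  (inj₂ ())
    inner-kinds v (inj₁ u-wˡ)       (inj₂ u-wˡ)        (inj₁ ())
    inner-kinds v (inj₁ u-wˡ)       (inj₂ u-wˡ)        (inj₂ ())
    inner-kinds v (inj₁ u-wˡ)       (inj₂ u-wʳ)        (inj₁ ())
    inner-kinds v (inj₁ u-wˡ)       (inj₂ u-wʳ)        (inj₂ ())
    inner-kinds v (inj₁ u-wʳ)       (inj₂ u-wˡ)        (inj₁ ())
    inner-kinds v (inj₁ u-wʳ)       (inj₂ u-wˡ)        (inj₂ ())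
    inner-kinds v (inj₁ u-wʳ)       (inj₂ u-wʳ)        (inj₁ ())
    inner-kinds v (inj₁ u-wʳ)       (inj₂ u-wʳ)        (inj₂ ())
    -- The only route that avoids D would use `X c c`, which is not a vertex.
    inner-kinds v (inj₁ u-x)        (inj₁ x-y)         (inj₂ v-y) = contradiction refl (proj₁ v)
    inner-kinds v (inj₁ u-x)        (inj₁ x-y)         (inj₁ ())
    inner-kinds v (inj₁ u-x)        (inj₂ u-x)         (inj₁ ())
    inner-kinds v (inj₁ u-x)        (inj₂ u-x)         (inj₂ ())
    inner-kinds v (inj₂ ())

    pick-of : ∀ {c s t xs} → kind s ≡ U c → kind t ≡ V c → Interior s t xs → Pick c xs
    -- `U c` and `V c` lie on different sides, so a path between them has odd length.
    pick-of {c} es et (one {x} a b) = contradiction (cong side et) (not-≢ sides)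
      where
      sides : true ≡ not (side (kind _))
      sides = cong not (sym (trans (adj-side b) (cong not (trans (adj-side a) (cong (not ∘ side) es)))))
    pick-of {c} es et (two {x} {y} a b e) =
      from (inner-kinds (kind-valid x) (subst (λ k → Adj k (kind x)) es a) b (subst (Adj (kind y)) et e)) refl refl
      where
      from : ∀ {k l} → Inner c k l → kind x ≡ k → kind y ≡ l → Pick c (x ∷ y ∷ [])
      from (inner mv v-z d-z) ex ey = record
        { path-≡ = refl ; kind-x = ex ; kind-z = ey ; moved = mv ; v-z = v-z ; d-z = d-z }

    canonical : ∀ {c} (c< : c < R) → Chosen (vertex (U c) c<) (vertex (V c) c<)
    canonical {c} c< = record
      { s∈  = terminal⇒∈ (subst Terminal (sym (kind-vertex {U c} c<)) (U c))
      ; t∈  = terminal⇒∈ (subst Terminal (sym (kind-vertex {V c} c<)) (V c))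
      ; s<t = subst₂ _<_ (sym (toℕ-vertex {U c} c<)) (sym (toℕ-vertex {V c} c<)) (U<V {c} {c} c<)
      }

    abstract
      pick : ∀ {c} (c< : c < R) → Pick c (walk-through (canonical c<))
      pick {c} c< = pick-of (kind-vertex {U c} c<) (kind-vertex {V c} c<) (is-interior (canonical c<))

    open Pick

    member-kind : ∀ {c xs x} (p : Pick c xs) → x ∈ˡ xs → kind x ≡ D (d p) ⊎ kind x ≡ Z (j p)
    member-kind record { path-≡ = refl ; kind-x = kx } (here eq)         = inj₁ (trans (cong kind eq) kx)
    member-kind record { path-≡ = refl ; kind-z = kz } (there (here eq)) = inj₂ (trans (cong kind eq) kz)

    on-gadget : ∀ {s t x} (p : Chosen s t) → x ∈ˡ walk-through p → ∃[ c ] kind s ≡ U c × kind t ≡ V c →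
                ∃[ c ] Σ[ c< ∈ c < R ] x ∈ˡ walk-through (canonical {c} c<)
    on-gadget {s} {t} {x} p x∈ (c , es , et) =
      c , c< , subst (x ∈ˡ_) (transport (trans es (sym (kind-vertex {U c} c<)))
          (trans et (sym (kind-vertex {V c} c<)))
                               p (canonical c<)) x∈
      where
      c< : c < R
      c< = subst Valid es (kind-valid s)

    public-covered : ∀ {x} → Public (kind x) →
                     ∃[ c ] Σ[ c< ∈ c < R ] (kind x ≡ D (d (pick {c} c<)) ⊎ kind x ≡ Z (j (pick {c} c<)))
    public-covered {x} px = from (covered (public-interior px))
      where
      from′ : ∃[ c ] Σ[ c< ∈ c < R ] x ∈ˡ walk-through (canonical {c} c<) → _
      from′ (c , c< , x∈) = c , c< , member-kind (pick {c} c<) x∈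
      from : ∃[ s ] ∃[ t ] Σ[ p ∈ Chosen s t ] x ∈ˡ walk-through p → _
      from (s , t , p , x∈) = from′ (on-gadget p x∈ (only-gadgets p {x} px x∈))

    D-injective : ∀ {a b} → D a ≡ D b → a ≡ b
    D-injective refl = refl

    Z-injective : ∀ {a b} → Z a ≡ Z b → a ≡ b
    Z-injective refl = refl

    cover-d : ∀ {e} → e < R → ∃[ c ] Σ[ c< ∈ c < R ] d (pick {c} c<) ≡ e
    cover-d {e} e< = from (public-covered {vertex (D e) e<} (subst Public (sym (kind-vertex {D e} e<)) (public-d e)))
      where
      from : ∃[ c ] Σ[ c< ∈ c < R ] (kind (vertex (D e) e<) ≡ D (d (pick {c} c<)) ⊎
                                      kind (vertex (D e) e<) ≡ Z (j (pick {c} c<))) →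
             ∃[ c ] Σ[ c< ∈ c < R ] d (pick {c} c<) ≡ e
      from (c , c< , inj₁ eq) = c , c< , D-injective (trans (sym eq) (kind-vertex {D e} e<))
      from (c , c< , inj₂ eq) = contradiction (trans (sym eq) (kind-vertex {D e} e<)) λ ()

    cover-z : ∀ {i} → i < m → ∃[ c ] Σ[ c< ∈ c < R ] j (pick {c} c<) ≡ i
    cover-z {i} i< = from (public-covered {vertex (Z i) i<} (subst Public (sym (kind-vertex {Z i} i<)) (public-z i)))
      where
      from : ∃[ c ] Σ[ c< ∈ c < R ] (kind (vertex (Z i) i<) ≡ D (d (pick {c} c<)) ⊎
                                      kind (vertex (Z i) i<) ≡ Z (j (pick {c} c<))) →
             ∃[ c ] Σ[ c< ∈ c < R ] j (pick {c} c<) ≡ i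
      from (c , c< , inj₁ eq) = contradiction (trans (sym eq) (kind-vertex {Z i} i<)) λ ()
      from (c , c< , inj₂ eq) = c , c< , Z-injective (trans (sym eq) (kind-vertex {Z i} i<))

    -- The agent turns to its own D. This is to agree on a whole ring and become the value of the
    -- variable.
    Own : ℕ → Set
    Own c = Σ[ c< ∈ c < R ] d (pick {c} c<) ≡ c

    own-≡ : ∀ {c} (c< : c < R) → Own c → d (pick {c} c<) ≡ c
    own-≡ {c} c< (c<′ , eq) = subst (λ c< → d (pick {c} c<) ≡ c) (<-irrelevant c<′ c<) eq

    own? : ∀ c → Dec (Own c)
    own? c with c <? R
    ... | no c≮ = no (c≮ ∘ proj₁)
    ... | yes c< with d (pick {c} c<) ≟ c
    ...   | yes e = yes (c< , e)
    ...   | no ne = no λ (c<′ , e) → ne (subst (λ c< → d (pick {c} c<) ≡ c) (<-irrelevant c<′ c<) e)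

    -- Only the agents at k and at j can cover the D of slot k. If the agent at j spends its path on
    -- its own D, the agent at k has to take its own as well.
    own-prev : ∀ {i j k} → i < n → j < m → k < m → PrevSlot j k → Own (j + i * m) → Own (k + i * m)
    own-prev {i} {j} {k} i< j< k< pr own = from (cover-d {k + i * m} (radix-< k< i<))
      where
      case : ∀ {e} (e< : e < R) → d (pick {e} e<) ≡ k + i * m → (k + i * m ≡ e ⊎ Prev e (k + i * m)) → Own (k + i * m)
      case e< eq (inj₁ refl) = e< , eq
      case e< eq (inj₂ p)    = ⊥-elim (prev-irrefl (subst (Prev _)
          (trans (sym eq) (own-≡ e< (subst Own (sym (prev-inverse {i} j< k< pr p)) own))) p))
      from : ∃[ c ] Σ[ c< ∈ c < R ] d (pick {c} c<) ≡ k + i * m → Own (k + i * m)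
      from (e , e< , eq) = case e< eq (subst (λ x → x ≡ e ⊎ Prev e x) eq (moved (pick {e} e<)))

    own-first : ∀ {i} → i < n → ∀ j → j < m → Own (j + i * m) → Own (i * m)
    own-first i< zero    j< own = own
    own-first i< (suc j) j< own = own-first i< j (<⇒≤ j<) (own-prev i< j< (<⇒≤ j<) (inj₂ refl) own)

    -- Propagation runs backwards only, so from slot 0 it first wraps around to slot m - 1 and then
    -- descends to j.
    own-all : ∀ {i} → i < n → Own (i * m) → ∀ j → j < m → Own (j + i * m)
    own-all {i} i< own j j< = descend (m ∸ suc j) j (m+[n∸m]≡n j<)
      where
      descend : ∀ t j → suc j + t ≡ m → Own (j + i * m)
      descend zero    j eq = own-prev i< (≤-trans (s≤s z≤n) 2≤m) (≤-reflexive last)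
        (inj₁ (refl , last)) own
        where
        last : suc j ≡ m
        last = trans (sym (+-identityʳ (suc j))) eq
      descend (suc t) j eq = own-prev i< next< (<⇒≤ next<) (inj₂ refl) (descend t (suc j) eq′)
        where
        eq′ : suc (suc j) + t ≡ m
        eq′ = trans (cong suc (sym (+-suc j t))) eq
        next< : suc j < m
        next< = subst (suc j <_) eq′ (s≤s (m≤m+n (suc j) t))

    σ : ℕ → Bool
    σ i = does (own? (i * m))

    lit-σ : ∀ {b i j} → (b ≡ true → Own (i * m)) → (b ≡ false → ¬ Own (i * m)) → Lit b i j → Lit (σ i) i j
    lit-σ {true}  {i} own ¬own l with own? (i * m)
    ... | yes _ = l
    ... | no ¬o = contradiction (own refl) ¬o
    lit-σ {false} {i} own ¬own l with own? (i * m)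
    ... | yes o = contradiction o (¬own refl)
    ... | no _  = l

    -- An agent on its own D serves a positive literal and makes its ring own, so the variable is
    -- true. An agent on the D before serves a negative literal; were the variable true, the whole
    -- ring would be own, this agent included.
    chosen-literal : ∀ {c e i} (c< : c < R) → d (pick {c} c<) ≡ e → 0 < i → i < m → e ≡ c ⊎ Prev c e →
                     Edge (V c) (Z i) → Edge (D e) (Z i) → Some n (λ v → Lit (σ v) v i)
    chosen-literal c< de 0<i i<m _ _ b-zero = contradiction 0<i λ ()
    chosen-literal {i = i} c< de 0<i i<m (inj₁ refl) vz (b-lit s at) = from (own-literal 0<i i<m at vz)
      where
      from : Some n (λ v → _ ≡ i + v * m × Lit true v i) → Some n (λ v → Lit (σ v) v i)
      from (v , v< , e , l) = v , v< , lit-σ (λ _ → own-first {v} v< i i<m (subst Own e (c< , de))) (λ ()) l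
    chosen-literal {c} {i = i} c< de 0<i i<m (inj₂ pr) vz (b-lit s at) = from (prev-literal 0<i i<m pr at vz)
      where
      from : Some n (λ v → Some m (λ k → c ≡ k + v * m) × Lit false v i) → Some n (λ v → Lit (σ v) v i)
      from (v , v< , (k , k< , e) , l) = v , v< , lit-σ (λ ()) (λ _ first →
        prev-irrefl (subst (Prev c) (trans (sym de) (own-≡ c< (subst Own (sym e) (own-all {v} v< first k k<)))) pr)) l

    satisfying : ∀ i → 0 < i → i < m → Some n (λ v → Lit (σ v) v i)
    satisfying i 0<i i<m = from (cover-z i<m)
      where
      from : ∃[ c ] Σ[ c< ∈ c < R ] j (pick {c} c<) ≡ i → Some n (λ v → Lit (σ v) v i)
      from (c , c< , e) = chosen-literal c< refl 0<i i<m (moved (pick c<))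
        (subst (λ i → Edge (V c) (Z i)) e (v-z (pick c<))) (subst (λ i → Edge (D _) (Z i)) e (d-z (pick c<)))

  fromGeodetic : (adjᵇ : ℕ → ℕ → Bool) (setᵇ : ℕ → Bool)
    (adj-correct : ∀ {k l} → Valid k → Valid l → T (adjᵇ (codeOf k) (codeOf l)) ⇔ Adj k l)
    (set-correct : ∀ {k} → Valid k → T (setᵇ (codeOf k)) ⇔ Terminal k) →
    StrongGeodetic (Construction.gadgetGraph adjᵇ setᵇ adj-correct set-correct)
                   (Construction.terminals adjᵇ setᵇ adj-correct set-correct) →
    Satisfiable n m Lit
  fromGeodetic adjᵇ setᵇ adj-correct set-correct (I , cover) = B.σ , B.satisfying
    where module B = Backward adjᵇ setᵇ adj-correct set-correct I cover

-- The reduction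

module NumericEdges (n m : ℕ) (0<n : 0 < n) (2≤m : 2 ≤ m) (Lit : Bool → ℕ → ℕ → Set)
                    (unused : ∀ b j → ¬ Lit b 0 j) where
  open Gadget n m 0<n 2≤m Lit unused

  -- The edges restated on vertex numbers with bounded quantifiers, in the shape for which formulas
  -- exist.
  UD VZ DZ W-edges XY-edges EdgeCode : ℕ → ℕ → Set
  UD u v =
    Some R (λ c → u ≡ codeOf (U c) × v ≡ codeOf (D c)) ⊎
    Some R (λ c → Some R λ d → Prev c d × u ≡ codeOf (U c) × v ≡ codeOf (D d))
  VZ u v =
    Some m (λ j → u ≡ codeOf (V 0) × v ≡ codeOf (Z j)) ⊎
    Some R (λ c → u ≡ codeOf (V c) × v ≡ codeOf (Z 0)) ⊎
    Some R (λ c → Some m λ j → At-lit true c j × u ≡ codeOf (V c) × v ≡ codeOf (Z j)) ⊎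
    Some R (λ c → Some R λ d → Some m λ j → Prev c d × At-lit false d j × u ≡ codeOf (V c) × v ≡ codeOf (Z j))
  DZ u v =
    Some R (λ c → u ≡ codeOf (D c) × v ≡ codeOf (Z 0)) ⊎
    Some R (λ c → Some m λ j → (At-lit true c j ⊎ At-lit false c j) × u ≡ codeOf (D c) × v ≡ codeOf (Z j))
  W-edges u v =
    Some R (λ b → Some b λ a → (u ≡ codeOf (U a) ⊎ u ≡ codeOf (U b)) × v ≡ codeOf (WU a b)) ⊎
    Some R (λ b → Some b λ a → (u ≡ codeOf (V a) ⊎ u ≡ codeOf (V b)) × v ≡ codeOf (WV a b))
  XY-edges u v =
    Some R (λ a → Some R λ b → ¬ a ≡ b × (u ≡ codeOf (U a) × v ≡ codeOf (X a b) ⊎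
                                          u ≡ codeOf (X a b) × v ≡ codeOf (Y a b) ⊎
                                          u ≡ codeOf (V b) × v ≡ codeOf (Y a b)))
  EdgeCode u v = UD u v ⊎ VZ u v ⊎ DZ u v ⊎ W-edges u v ⊎ XY-edges u v

  pattern u-owns e = inj₁ (inj₁ e)
  pattern u-precedes e = inj₁ (inj₂ e)
  pattern v-firsts e = inj₂ (inj₁ (inj₁ e))
  pattern v-zeros e = inj₂ (inj₁ (inj₂ (inj₁ e)))
  pattern v-positive e = inj₂ (inj₁ (inj₂ (inj₂ (inj₁ e))))
  pattern v-negative e = inj₂ (inj₁ (inj₂ (inj₂ (inj₂ e))))
  pattern d-zeros e = inj₂ (inj₂ (inj₁ (inj₁ e)))
  pattern d-literal e = inj₂ (inj₂ (inj₁ (inj₂ e)))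
  pattern wu-ends e = inj₂ (inj₂ (inj₂ (inj₁ (inj₁ e))))
  pattern wv-ends e = inj₂ (inj₂ (inj₂ (inj₁ (inj₂ e))))
  pattern xy-edges e = inj₂ (inj₂ (inj₂ (inj₂ e)))

  TerminalCode : ℕ → Set
  TerminalCode u = Some R (λ c → u ≡ codeOf (U c) ⊎ u ≡ codeOf (V c))

  AdjCode : ℕ → ℕ → Set
  AdjCode u v = EdgeCode u v ⊎ EdgeCode v u

  BitAt : ℕ → Set
  BitAt i =
    i < N ⊎
    Some N (λ u → Some N λ v → i ≡ N + suc (v + u * N) × AdjCode u v) ⊎
    Some N (λ u → i ≡ N + suc (N * N + u) × TerminalCode u)

  edge⇒code : ∀ {k l} → Valid k → Valid l → Edge k l → EdgeCode (codeOf k) (codeOf l)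
  edge⇒code {U c} vk vl u-own = u-owns (c , vk , refl , refl)
  edge⇒code {U c} {D d} vk vl (u-prev p) = u-precedes (c , vk , d , vl , p , refl , refl)
  edge⇒code {l = Z j} vk vl v-first = v-firsts (j , vl , refl , refl)
  edge⇒code {V c} vk vl v-zero = v-zeros (c , vk , refl , refl)
  edge⇒code {V c} {Z j} vk vl (v-pos a) = v-positive (c , vk , j , vl , a , refl , refl)
  edge⇒code {V c} {Z j} vk vl (v-neg {d = d} p@(i , i< , _ , _ , k , k< , _ , _ , d≡) a) =
    v-negative (c , vk , d , subst (_< R) (sym d≡) (radix-< k< i<) , j , vl , p , a , refl , refl)
  edge⇒code {D c} vk vl b-zero = d-zeros (c , vk , refl , refl)
  edge⇒code {D c} {Z j} vk vl (b-lit true a) =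
    d-literal (c , vk , j , vl , inj₁ a , refl , refl)
  edge⇒code {D c} {Z j} vk vl (b-lit false a) =
    d-literal (c , vk , j , vl , inj₂ a , refl , refl)
  edge⇒code {l = WU a b} vk (a<b , b<) u-wˡ =
    wu-ends (b , b< , a , a<b , inj₁ refl , refl)
  edge⇒code {l = WU a b} vk (a<b , b<) u-wʳ =
    wu-ends (b , b< , a , a<b , inj₂ refl , refl)
  edge⇒code {l = WV a b} vk (a<b , b<) v-wˡ =
    wv-ends (b , b< , a , a<b , inj₁ refl , refl)
  edge⇒code {l = WV a b} vk (a<b , b<) v-wʳ =
    wv-ends (b , b< , a , a<b , inj₂ refl , refl)
  edge⇒code {l = X a b} vk (a≢b , a< , b<) u-x =
    xy-edges (a , a< , b , b< , a≢b , inj₁ (refl , refl))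
  edge⇒code {l = Y a b} vk (a≢b , a< , b<) x-y =
    xy-edges (a , a< , b , b< , a≢b , inj₂ (inj₁ (refl , refl)))
  edge⇒code {l = Y a b} vk (a≢b , a< , b<) v-y =
    xy-edges (a , a< , b , b< , a≢b , inj₂ (inj₂ (refl , refl)))

  code⇒edge : ∀ {k l} → Valid k → Valid l → EdgeCode (codeOf k) (codeOf l) → Edge k l
  code⇒edge {k} {l} vk vl = from
    where
    as : ∀ {k′ l′} → Valid k′ → Valid l′ → codeOf k ≡ codeOf k′ → codeOf l ≡ codeOf l′ → Edge k′ l′ → Edge k l
    as vk′ vl′ ek el e = subst₂ Edge (sym (code-injective vk vk′ ek)) (sym (code-injective vl vl′ el)) e
    0<m : 0 < m
    0<m = ≤-trans (s≤s z≤n) 2≤m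
    from : EdgeCode (codeOf k) (codeOf l) → Edge k l
    from (u-owns (c , c< , ek , el)) = as {U c} {D c} c< c< ek el u-own
    from (u-precedes (c , c< , d , d< , p , ek , el)) = as {U c} {D d} c< d< ek el (u-prev p)
    from (v-firsts (j , j< , ek , el)) = as {V 0} {Z j} R>0 j< ek el v-first
    from (v-zeros (c , c< , ek , el)) = as {V c} {Z 0} c< 0<m ek el v-zero
    from (v-positive (c , c< , j , j< , a , ek , el)) = as {V c} {Z j} c< j< ek el (v-pos a)
    from (v-negative (c , c< , d , d< , j , j< , p , a , ek , el)) =
      as {V c} {Z j} c< j< ek el (v-neg p a)
    from (d-zeros (c , c< , ek , el)) = as {D c} {Z 0} c< 0<m ek el b-zero
    from (d-literal (c , c< , j , j< , inj₁ a , ek , el)) =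
      as {D c} {Z j} c< j< ek el (b-lit true a)
    from (d-literal (c , c< , j , j< , inj₂ a , ek , el)) =
      as {D c} {Z j} c< j< ek el (b-lit false a)
    from (wu-ends (b , b< , a , a<b , inj₁ ek , el)) =
      as {U a} {WU a b} (<-trans a<b b<) (a<b , b<) ek el u-wˡ
    from (wu-ends (b , b< , a , a<b , inj₂ ek , el)) =
      as {U b} {WU a b} b< (a<b , b<) ek el u-wʳ
    from (wv-ends (b , b< , a , a<b , inj₁ ek , el)) =
      as {V a} {WV a b} (<-trans a<b b<) (a<b , b<) ek el v-wˡ
    from (wv-ends (b , b< , a , a<b , inj₂ ek , el)) =
      as {V b} {WV a b} b< (a<b , b<) ek el v-wʳ
    from (xy-edges (a , a< , b , b< , a≢b , e)) = xy e
      where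
      xy : (codeOf k ≡ codeOf (U a) × codeOf l ≡ codeOf (X a b) ⊎
            codeOf k ≡ codeOf (X a b) × codeOf l ≡ codeOf (Y a b) ⊎
            codeOf k ≡ codeOf (V b) × codeOf l ≡ codeOf (Y a b)) → Edge k l
      xy (inj₁ (ek , el))        = as {U a} {X a b} a< (a≢b , a< , b<) ek el u-x
      xy (inj₂ (inj₁ (ek , el))) = as {X a b} {Y a b} (a≢b , a< , b<) (a≢b , a< , b<) ek el x-y
      xy (inj₂ (inj₂ (ek , el))) = as {V b} {Y a b} b< (a≢b , a< , b<) ek el v-y

  adj-code : ∀ {k l} → Valid k → Valid l → AdjCode (codeOf k) (codeOf l) ⇔ Adj k l
  adj-code vk vl = mk⇔
    (λ { (inj₁ e) → inj₁ (code⇒edge vk vl e) ; (inj₂ e) → inj₂ (code⇒edge vl vk e) })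
    (λ { (inj₁ e) → inj₁ (edge⇒code vk vl e) ; (inj₂ e) → inj₂ (edge⇒code vl vk e) })

  terminal-code : ∀ {k} → Valid k → TerminalCode (codeOf k) ⇔ Terminal k
  terminal-code {k} vk = mk⇔
    (λ { (c , c< , inj₁ e) → subst Terminal (sym (code-injective {k} {U c} vk c< e)) (U c)
       ; (c , c< , inj₂ e) → subst Terminal (sym (code-injective {k} {V c} vk c< e)) (V c) })
    (λ { (U c) → c , vk , inj₁ refl ; (V c) → c , vk , inj₂ refl })

  size′ : ℕ
  size′ = N + suc (N * N + N)

  bit-stop : ¬ BitAt N
  bit-stop (inj₁ N<N) = <-irrefl refl N<N
  bit-stop (inj₂ (inj₁ (u , _ , v , _ , e , _))) = m≢1+m+n N (trans e (+-suc N _))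
  bit-stop (inj₂ (inj₂ (u , _ , e , _)))         = m≢1+m+n N (trans e (+-suc N _))

  N≤ : ∀ k → N ≤ N + suc k
  N≤ k = m≤m+n N (suc k)

  bit-matrix : ∀ {u v} → u < N → v < N → BitAt (N + suc (v + u * N)) ⇔ AdjCode u v
  bit-matrix {u} {v} u< v< = mk⇔ to (λ a → inj₂ (inj₁ (u , u< , v , v< , refl , a)))
    where
    to : BitAt (N + suc (v + u * N)) → AdjCode u v
    to (inj₁ lt) = contradiction lt (≤⇒≯ (N≤ (v + u * N)))
    to (inj₂ (inj₁ (u′ , _ , v′ , v′< , e , a)))
      with radix-unique u u′ v< v′< (suc-injective (+-cancelˡ-≡ N _ _ e))
    ... | refl , refl = a
    to (inj₂ (inj₂ (u′ , _ , e , _))) = contradiction (radix-< v< u<)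
      (≤⇒≯ (≤-trans (m≤m+n (N * N) u′) (≤-reflexive (sym (suc-injective (+-cancelˡ-≡ N _ _ e))))))

  bit-member : ∀ {u} → u < N → BitAt (N + suc (N * N + u)) ⇔ TerminalCode u
  bit-member {u} u< = mk⇔ to (λ t → inj₂ (inj₂ (u , u< , refl , t)))
    where
    to : BitAt (N + suc (N * N + u)) → TerminalCode u
    to (inj₁ lt) = contradiction lt (≤⇒≯ (N≤ (N * N + u)))
    to (inj₂ (inj₁ (u′ , u′< , v′ , v′< , e , _))) = contradiction (radix-< v′< u′<)
      (≤⇒≯ (≤-trans (m≤m+n (N * N) u) (≤-reflexive (suc-injective (+-cancelˡ-≡ N _ _ e)))))
    to (inj₂ (inj₂ (u′ , _ , e , t))) with +-cancelˡ-≡ (N * N) _ _ (suc-injective (+-cancelˡ-≡ N _ _ e))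
    ... | refl = t

-- The literals come as one fixed formula in two variables; renaming puts it to use under further
-- quantifiers.
atᵈ : {P : List Bool → Env 2 → Set} → Definable P → (i j : Fin n) →
      Definable (λ x ρ → P x (valueAt ρ i , valueAt ρ j , tt))
atᵈ {n} {P} (defines e t) i j = defines (rename θ e) λ x ρ →
  subst (Truth (P x (valueAt ρ i , valueAt ρ j , tt)))
        (sym (rename-⟦⟧ θ e x {valueAt ρ i , valueAt ρ j , tt} {ρ} λ { zero → refl ; (suc zero) → refl }))
        (t x (valueAt ρ i , valueAt ρ j , tt))
  where
  θ : Fin 2 → Fin n
  θ zero       = i
  θ (suc zero) = j

module Reduction {L : Language} (problem : SatProblem L) where
  open SatProblem problem

  module _ (x : List Bool) where
    open Gadget (variables x) (clauses x) (variables-nonZero x) (clauses-≥2 x) (Lit x) (unused x) public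
    open NumericEdges (variables x) (clauses x) (variables-nonZero x) (clauses-≥2 x) (Lit x) (unused x) public

  mᶜ : Computable {n} (λ x ρ → clauses x)
  mᶜ = clausesᶜ

  Rᶜ : Computable {n} (λ x ρ → R x)
  Rᶜ = variablesᶜ *ᶜ mᶜ

  Nᶜ : Computable {n} (λ x ρ → N x)
  Nᶜ = mᶜ +ᶜ constᶜ 3 *ᶜ Rᶜ *ᶜ Rᶜ

  slotᶜ : ∀ τ {a b : List Bool → Env n → ℕ} → Computable a → Computable b →
          Computable (λ x ρ → number-at x (slot τ (a x ρ) (b x ρ)))
  slotᶜ τ a b = b +ᶜ (a +ᶜ constᶜ τ *ᶜ Rᶜ) *ᶜ Rᶜ

  endᶜ : {j : List Bool → Env n → ℕ} → Computable j → Computable (λ x ρ → number-at x (end (j x ρ)))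
  endᶜ j = j +ᶜ constᶜ 3 *ᶜ Rᶜ *ᶜ Rᶜ

  Prevᵈ : {c d : List Bool → Env n → ℕ} → Computable c → Computable d → Definable (λ x ρ → Prev x (c x ρ) (d x ρ))
  Prevᵈ c d = someᵈ variablesᶜ (someᵈ mᶜ (someᵈ mᶜ
    ((v₁ ≡ᵈ constᶜ 0 ×ᵈ sucᶜ v₀ ≡ᵈ mᶜ ⊎ᵈ v₁ ≡ᵈ sucᶜ v₀) ×ᵈ
     wkᶜ (wkᶜ (wkᶜ c)) ≡ᵈ v₁ +ᶜ v₂ *ᶜ mᶜ ×ᵈ wkᶜ (wkᶜ (wkᶜ d)) ≡ᵈ v₀ +ᶜ v₂ *ᶜ mᶜ)))

  At-litᵈ : ∀ s {c : List Bool → Env n → ℕ} → Computable c → (j : Fin n) →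
            Definable (λ x ρ → At-lit x s (c x ρ) (valueAt ρ j))
  At-litᵈ s c j = someᵈ variablesᶜ (wkᶜ c ≡ᵈ varᶜ (suc j) +ᶜ v₀ *ᶜ mᶜ ×ᵈ atᵈ (Litᵈ s) zero (suc j))

  EdgeCodeᵈ : {u v : List Bool → Env n → ℕ} → Computable u → Computable v →
              Definable (λ x ρ → EdgeCode x (u x ρ) (v x ρ))
  EdgeCodeᵈ u v =
    (someᵈ Rᶜ (u¹ ≡ᵈ slotᶜ 0 v₀ v₀ ×ᵈ v¹ ≡ᵈ slotᶜ 2 v₀ v₀) ⊎ᵈ
    someᵈ Rᶜ (someᵈ Rᶜ (Prevᵈ v₁ v₀ ×ᵈ u² ≡ᵈ slotᶜ 0 v₁ v₁ ×ᵈ v² ≡ᵈ slotᶜ 2 v₀ v₀))) ⊎ᵈ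
    (someᵈ mᶜ (u¹ ≡ᵈ slotᶜ 1 (constᶜ 0) (constᶜ 0) ×ᵈ v¹ ≡ᵈ endᶜ v₀) ⊎ᵈ
    someᵈ Rᶜ (u¹ ≡ᵈ slotᶜ 1 v₀ v₀ ×ᵈ v¹ ≡ᵈ endᶜ (constᶜ 0)) ⊎ᵈ
    someᵈ Rᶜ (someᵈ mᶜ (At-litᵈ true v₁ zero ×ᵈ u² ≡ᵈ slotᶜ 1 v₁ v₁ ×ᵈ v² ≡ᵈ endᶜ v₀)) ⊎ᵈ
    someᵈ Rᶜ (someᵈ Rᶜ (someᵈ mᶜ (Prevᵈ v₂ v₁ ×ᵈ At-litᵈ false v₁ zero ×ᵈ
      wkᶜ u² ≡ᵈ slotᶜ 1 v₂ v₂ ×ᵈ wkᶜ v² ≡ᵈ endᶜ v₀)))) ⊎ᵈ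
    (someᵈ Rᶜ (u¹ ≡ᵈ slotᶜ 2 v₀ v₀ ×ᵈ v¹ ≡ᵈ endᶜ (constᶜ 0)) ⊎ᵈ
    someᵈ Rᶜ (someᵈ mᶜ ((At-litᵈ true v₁ zero ⊎ᵈ At-litᵈ false v₁ zero) ×ᵈ
      u² ≡ᵈ slotᶜ 2 v₁ v₁ ×ᵈ v² ≡ᵈ endᶜ v₀))) ⊎ᵈ
    (someᵈ Rᶜ (someᵈ v₀ ((u² ≡ᵈ slotᶜ 0 v₀ v₀ ⊎ᵈ u² ≡ᵈ slotᶜ 0 v₁ v₁) ×ᵈ v² ≡ᵈ slotᶜ 0 v₀ v₁)) ⊎ᵈ
    someᵈ Rᶜ (someᵈ v₀ ((u² ≡ᵈ slotᶜ 1 v₀ v₀ ⊎ᵈ u² ≡ᵈ slotᶜ 1 v₁ v₁) ×ᵈ v² ≡ᵈ slotᶜ 0 v₁ v₀))) ⊎ᵈ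
    someᵈ Rᶜ (someᵈ Rᶜ ((¬ᵈ (v₁ ≡ᵈ v₀)) ×ᵈ
      (u² ≡ᵈ slotᶜ 0 v₁ v₁ ×ᵈ v² ≡ᵈ slotᶜ 1 v₁ v₀ ⊎ᵈ
       u² ≡ᵈ slotᶜ 1 v₁ v₀ ×ᵈ v² ≡ᵈ slotᶜ 2 v₁ v₀ ⊎ᵈ
       u² ≡ᵈ slotᶜ 1 v₀ v₀ ×ᵈ v² ≡ᵈ slotᶜ 2 v₁ v₀)))
    where
    u¹ = wkᶜ u
    v¹ = wkᶜ v
    u² = wkᶜ u¹
    v² = wkᶜ v¹

  TerminalCodeᵈ : {u : List Bool → Env n → ℕ} → Computable u → Definable (λ x ρ → TerminalCode x (u x ρ))
  TerminalCodeᵈ u = someᵈ Rᶜ (wkᶜ u ≡ᵈ slotᶜ 0 v₀ v₀ ⊎ᵈ wkᶜ u ≡ᵈ slotᶜ 1 v₀ v₀)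

  BitAtᵈ : Definable {1} (λ x ρ → BitAt x (proj₁ ρ))
  BitAtᵈ =
    v₀ <ᵈ Nᶜ ⊎ᵈ
    someᵈ Nᶜ (someᵈ Nᶜ (v₂ ≡ᵈ Nᶜ +ᶜ sucᶜ (v₀ +ᶜ v₁ *ᶜ Nᶜ) ×ᵈ (EdgeCodeᵈ v₁ v₀ ⊎ᵈ EdgeCodeᵈ v₀ v₁))) ⊎ᵈ
    someᵈ Nᶜ (v₁ ≡ᵈ Nᶜ +ᶜ sucᶜ (Nᶜ *ᶜ Nᶜ +ᶜ v₀) ×ᵈ TerminalCodeᵈ v₀)

  abstract
    words : Tabulation size′ BitAt
    words = tabulation (Nᶜ +ᶜ sucᶜ (Nᶜ *ᶜ Nᶜ +ᶜ Nᶜ)) BitAtᵈ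

  open Tabulation words

  module Instance (x : List Bool) where

    Lit? : ∀ b i j → Dec (Lit x b i j)
    Lit? b i j = from (truth (Litᵈ b) x (i , j , tt))
      where
      from : ∀ {P v} → Truth P v → Dec P
      from (holds-true p)   = yes p
      from (holds-false ¬p) = no ¬p

    adjᵇ : ℕ → ℕ → Bool
    adjᵇ u v = bitAt (output x) (N x + suc (v + u * N x))

    setᵇ : ℕ → Bool
    setᵇ u = bitAt (output x) (N x + suc (N x * N x + u))

    adj-correct : ∀ {k l} → Valid x k → Valid x l → T (adjᵇ (codeOf x k) (codeOf x l)) ⇔ Adj x k l
    adj-correct {k} {l} vk vl =
      (adj-code x vk vl ⇔-∘ bit-matrix x k< l<) ⇔-∘
      bits x _ (+-monoʳ-< (N x) (s≤s (<-≤-trans (radix-< l< k<) (m≤m+n (N x * N x) (N x)))))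
      where
      k< : codeOf x k < N x
      k< = place-< x (in-range x vk)
      l< : codeOf x l < N x
      l< = place-< x (in-range x vl)

    set-correct : ∀ {k} → Valid x k → T (setᵇ (codeOf x k)) ⇔ Terminal x k
    set-correct {k} vk =
      (terminal-code x vk ⇔-∘ bit-member x k<) ⇔-∘
      bits x _ (+-monoʳ-< (N x) (s≤s (+-monoʳ-< (N x * N x) k<)))
      where
      k< : codeOf x k < N x
      k< = place-< x (in-range x vk)

    open Construction x adjᵇ setᵇ adj-correct set-correct

    instanceInput : Input
    instanceInput = record { graph = gadgetGraph ; connected = isConnected ; set = terminals }

    restricted : (BipartiteOfDiameter≤ 6) instanceInput
    restricted = bipartite , diameter≤6

    output-encodes : Encodes (output x) (N x) (λ u v → adjᵇ (toℕ u) (toℕ v)) terminals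
    output-encodes = record
      { length-y = length-≡ x
      ; ones     = λ i< → Equivalence.to T-≡ (Equivalence.from (bits x _ (<-≤-trans i< (m≤m+n (N x) _))) (inj₁ i<))
      ; stop-bit = bool-ext (⊥-elim ∘ bit-stop x ∘ Equivalence.to (bits x _ (m<m+n (N x) (s≤s z≤n)))) (λ ())
      ; matrix   = λ u v → refl
      ; members  = λ u → sym (Vec.lookup∘tabulate (setᵇ ∘ toℕ) u)
      }

    output-≡ : output x ≡ encodeInput instanceInput
    output-≡ = encodes-unique output-encodes (encodes instanceInput)

    to-geodetic : Satisfiable (variables x) (clauses x) (Lit x) → StrongGeodetic gadgetGraph terminals
    to-geodetic = SatToGeodetic.toGeodetic (variables x) (clauses x) (variables-nonZero x) (clauses-≥2 x)
      (Lit x) (unused x) Lit? adjᵇ setᵇ adj-correct set-correct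

    from-geodetic : StrongGeodetic gadgetGraph terminals → Satisfiable (variables x) (clauses x) (Lit x)
    from-geodetic = GeodeticToSat.fromGeodetic (variables x) (clauses x) (variables-nonZero x) (clauses-≥2 x)
      (Lit x) (unused x) adjᵇ setᵇ adj-correct set-correct

    yes⇔ : L x ⇔ StrongGeodetic gadgetGraph terminals
    yes⇔ = mk⇔ to-geodetic from-geodetic ⇔-∘ satisfiable x

hard : NPHard StrongGeodeticRecognition
hard L np = output , poly-time , λ x → Instance.instanceInput x , Instance.output-≡ x , Instance.yes⇔ x
  where
  open Reduction (np⇒sat np)
  open Tabulation words

restricted-hard : NPHard (restrict StrongGeodeticRecognition (BipartiteOfDiameter≤ 6))
restricted-hard L np =
  output , poly-time , λ x →
    (Instance.instanceInput x , Instance.restricted x) , Instance.output-≡ x , Instance.yes⇔ x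
  where
  open Reduction (np⇒sat np)
  open Tabulation words

-- Soundness and completeness of the verifier

Restriction : Bool → Input → Set
Restriction false i = ⊤
Restriction true  i = (BipartiteOfDiameter≤ 6) i

Accepted : Bool → Language
Accepted r x = Σ[ i ∈ Input ] encodeInput i ≡ x × StrongGeodetic (graph i) (set i) × Restriction r i

≡⇒T⇔ : ∀ {a b} → a ≡ b → T a ⇔ T b
≡⇒T⇔ refl = mk⇔ id id

module VerifierSound (x c : List Bool) (N : ℕ) (r : Bool)
                     (valid : Verifier.Valid ⟨ x , c ⟩ (length x) N r) where
  open Verifier ⟨ x , c ⟩ (length x) N

  0<N : 0 < N
  0<N = proj₁ (proj₁ valid)

  length-x : length x ≡ N + suc (N * N + N)
  length-x = proj₁ (proj₂ (proj₁ valid))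

  word : ∀ {i} → i < N + suc (N * N + N) → T (bitAt x i) ⇔ wordBit i
  word i< = ≡⇒T⇔ (sym (pair-bit x c (subst (_ <_) (sym length-x) i<)))

  edge-< : ∀ (u v : Fin N) → N + suc (toℕ v + toℕ u * N) < N + suc (N * N + N)
  edge-< u v = +-monoʳ-< N (s≤s (<-≤-trans (radix-< (Fin.toℕ<n v) (Fin.toℕ<n u)) (m≤m+n (N * N) N)))

  member-< : ∀ (u : Fin N) → N + suc (N * N + toℕ u) < N + suc (N * N + N)
  member-< u = +-monoʳ-< N (s≤s (+-monoʳ-< (N * N) (Fin.toℕ<n u)))

  -- Read from x rather than from the paired word, so that the matrix of `word-encodes` agrees by
  -- definition.
  adjacent : Fin N → Fin N → Bool
  adjacent u v = bitAt x (N + suc (toℕ v + toℕ u * N))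

  adjacent⇔ : ∀ u v → T (adjacent u v) ⇔ Adjacent (toℕ u) (toℕ v)
  adjacent⇔ u v = word (edge-< u v)

  symmetry : ∀ u v → T (adjacent u v) → T (adjacent v u)
  symmetry u v e = Equivalence.from (adjacent⇔ v u)
    (proj₁ (proj₂ (proj₂ (proj₂ (proj₂ (proj₁ valid))))) _ (Fin.toℕ<n u) _ (Fin.toℕ<n v)
        (Equivalence.to (adjacent⇔ u v) e))

  decoded : Graph
  decoded = record
    { order       = N
    ; nonEmpty    = >-nonZero 0<N
    ; adjacent    = adjacent
    ; symmetric   = λ u v → bool-ext (symmetry u v) (symmetry v u)
    ; irreflexive = λ u → bool-ext (λ e → proj₂ (proj₂ (proj₂ (proj₂ (proj₂ (proj₁ valid))))) _ (Fin.toℕ<n u)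
                                        (Equivalence.to (adjacent⇔ u u) e)) (λ ())
    }

  members-of : Subset N
  members-of = Vec.tabulate (λ u → bitAt x (N + suc (N * N + toℕ u)))

  member⇔ : ∀ u → u ∈ members-of ⇔ Member (toℕ u)
  member⇔ u = mk⇔
    (λ u∈ → Equivalence.to (word (member-< u)) (Equivalence.from T-≡
      (trans (sym (Vec.lookup∘tabulate _ u)) (Vec.[]=⇒lookup u∈))))
    (λ m → Vec.lookup⇒[]= u members-of (trans (Vec.lookup∘tabulate _ u)
      (Equivalence.to T-≡ (Equivalence.from (word (member-< u)) m))))

  open CertifiedGraph decoded members-of
  open Sound Adjacent Member (tableBit 0) (tableBit 1) adjacent⇔ member⇔ (proj₁ (proj₂ valid))

  input : Input
  input = record { graph = decoded ; connected = isConnected ; set = members-of }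

  word-encodes : Encodes x N adjacent members-of
  word-encodes = record
    { length-y = length-x
    ; ones     = λ {i} i< → Equivalence.to T-≡ (Equivalence.from (word (<-≤-trans i< (m≤m+n N _)))
        (proj₁ (proj₂ (proj₂ (proj₁ valid))) i i<))
    ; stop-bit = bool-ext (λ t → ⊥-elim (proj₁ (proj₂ (proj₂ (proj₂ (proj₁ valid))))
        (Equivalence.to (word (m<m+n N (s≤s z≤n))) t))) (λ ())
    ; matrix   = λ u v → refl
    ; members  = λ u → sym (Vec.lookup∘tabulate _ u)
    }

  restriction : ∀ r → Extra r → Restriction r input
  restriction false _ = tt
  restriction true  w =
    bipartite (λ u → tableBit 2 u 0 0) (λ u → T? _) w , within-6 (λ u → tableBit 2 u 0 0) (λ u → T? _) w

  accepted : Accepted r x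
  accepted = input , encodes-unique (encodes input) word-encodes , geodetic , restriction r (proj₂ (proj₂ valid))

module VerifierComplete (i : Input) (geo : StrongGeodetic (graph i) (set i)) (r : Bool) (res : Restriction r i) where
  open Graph (graph i) renaming (order to N)
  open CertifiedGraph (graph i) (set i)
  open Complete (connected i) (proj₁ geo) (proj₂ geo)
  private module E = Encodes (encodes i)

  x : List Bool
  x = encodeInput i

  -- The remainder makes the map total, as the certificate is a function of arbitrary numbers; below
  -- N it inverts `toℕ`.
  fin : ℕ → Fin N
  fin u = fromℕ< (m%n<n u N)

  toℕ-fin : ∀ {u} → u < N → toℕ (fin u) ≡ u
  toℕ-fin u< = trans (Fin.toℕ-fromℕ< _) (m<n⇒m%n≡m u<)

  fin-toℕ : ∀ u → fin (toℕ u) ≡ u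
  fin-toℕ u = Fin.toℕ-injective (toℕ-fin (Fin.toℕ<n u))

  color : ∀ r → Restriction r i → Fin N → Bool
  color false _             u = false
  color true  ((side , _) , _) u = side u

  entry-at : ℕ → ℕ → ℕ → ℕ → Bool
  entry-at 0 u v k = does (k ≟ dist (fin u) (fin v))
  entry-at 1 u v y = does (onPath? (fin u) (fin v) (fin y))
  entry-at _ u v y = color r res (fin u)

  total : ℕ
  total = 3 * N * N * N

  entry-bit : ℕ → Bool
  entry-bit j = entry-at (((j / N) / N) / N) (((j / N) / N) % N) ((j / N) % N) (j % N)

  certificate : List Bool
  certificate = applyUpTo entry-bit total

  z : List Bool
  z = ⟨ x , certificate ⟩

  open Verifier z (length x) N

  entry-read : ∀ {κ u v w} → κ < 3 → u < N → v < N → w < N →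
               bitAt certificate (w + (v + (u + κ * N) * N) * N) ≡ entry-at κ u v w
  entry-read {κ} {u} {v} {w} κ< u< v< w< =
    trans (bitAt-applyUpTo entry-bit total (radix-< w< (radix-< v< (radix-< u< κ<)))) decode-digits
    where
    decode-digits : entry-bit (w + (v + (u + κ * N) * N) * N) ≡ entry-at κ u v w
    decode-digits
      rewrite radix-/ (v + (u + κ * N) * N) w< | radix-% (v + (u + κ * N) * N) w<
            | radix-/ (u + κ * N) v< | radix-% (u + κ * N) v< | radix-/ κ u< | radix-% κ u< = refl

  table⇔ : ∀ {κ u v w} → κ < 3 → u < N → v < N → w < N → tableBit κ u v w ⇔ T (entry-at κ u v w)
  table⇔ κ< u< v< w< = ≡⇒T⇔ (trans (pair-certificate-bit x certificate _) (entry-read κ< u< v< w<))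

  does⇔ : ∀ {P : Set} (d : Dec P) → T (does d) ⇔ P
  does⇔ (yes p) = mk⇔ (λ _ → p) (λ _ → tt)
  does⇔ (no ¬p) = mk⇔ (λ ()) (λ p → ¬p p)

  word : ∀ {j} → j < N + suc (N * N + N) → bitAt z (suc (j * 2)) ≡ bitAt x j
  word j< = pair-bit x certificate (subst (_ <_) (sym E.length-y) j<)

  A⇔ : ∀ {u v} → u < N → v < N → Adjacent u v ⇔ T (adjacent (fin u) (fin v))
  A⇔ {u} {v} u< v< = ≡⇒T⇔ (trans
    (word (+-monoʳ-< N (s≤s (<-≤-trans (radix-< v< u<) (m≤m+n (N * N) N)))))
    (trans (cong₂ (λ u v → bitAt x (N + suc (v + u * N))) (sym (toℕ-fin u<)) (sym (toℕ-fin v<)))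
        (E.matrix (fin u) (fin v))))

  S⇔ : ∀ {u} → u < N → Member u ⇔ fin u ∈ set i
  S⇔ {u} u< =
    mk⇔ (λ t → Vec.lookup⇒[]= (fin u) (set i) (Equivalence.to T-≡ t))
        (λ m → Equivalence.from T-≡ (Vec.[]=⇒lookup m)) ⇔-∘
    ≡⇒T⇔ (trans (word (+-monoʳ-< N (s≤s (+-monoʳ-< (N * N) u<))))
      (trans (cong (λ u → bitAt x (N + suc (N * N + u))) (sym (toℕ-fin u<))) (E.members (fin u))))

  D⇔ : ∀ {u v k} → u < N → v < N → k < N → tableBit 0 u v k ⇔ k ≡ dist (fin u) (fin v)
  D⇔ {u} {v} {k} u< v< k< = does⇔ (k ≟ dist (fin u) (fin v)) ⇔-∘ table⇔ (s≤s z≤n) u< v< k<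

  Q⇔ : ∀ {u v y} → u < N → v < N → y < N → tableBit 1 u v y ⇔ OnPath (fin u) (fin v) (fin y)
  Q⇔ {u} {v} {y} u< v< y< = does⇔ (onPath? (fin u) (fin v) (fin y)) ⇔-∘ table⇔ (s≤s (s≤s z≤n)) u< v< y<

  0<N : 0 < N
  0<N = >-nonZero⁻¹ N

  side⇔ : ∀ {u} → u < N → tableBit 2 u 0 0 ⇔ T (color r res (fin u))
  side⇔ u< = table⇔ (s≤s (s≤s (s≤s z≤n))) u< 0<N 0<N

  open Tables Adjacent Member (tableBit 0) (tableBit 1) fin fin-toℕ toℕ-fin A⇔ S⇔ D⇔ Q⇔

  wellFormed : WellFormed
  wellFormed = 0<N , E.length-y ,
    (λ j j< → subst T (sym (trans (word (<-≤-trans j< (m≤m+n N _))) (E.ones j<))) tt) ,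
    (λ t → subst T (trans (word (m<m+n N (s≤s z≤n))) E.stop-bit) t) ,
    (λ u u< v v< a → Equivalence.from (A⇔ v< u<) (subst T (symmetric (fin u) (fin v))
        (Equivalence.to (A⇔ u< v<) a))) ,
    (λ u u< a → subst T (irreflexive (fin u)) (Equivalence.to (A⇔ u< u<) a))

  extra : ∀ r (res : Restriction r i) → (∀ {u} → u < N → tableBit 2 u 0 0 ⇔ T (color r res (fin u))) → Extra r
  extra false _ _ = refl
  extra true ((side , proper) , k , (_ , max) , k≤6) side⇔ =
    bipartite-within (λ u → tableBit 2 u 0 0) side side⇔ proper
      (λ u v → ≤-trans (max u v _ (distance u v)) k≤6)

  accepts : Accepts r z
  accepts = length x , length-< , ((λ j j< → pair-continues x certificate j<) , pair-stops x certificate) ,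
    N , s≤s (≤-trans (m≤m+n N _) (≤-reflexive (sym E.length-y))) , wellFormed , certified , extra r res side⇔
    where
    -- The verifier looks for the length of x below that of the paired word, which is larger because
    -- every bit is doubled and an end flag follows.
    length-< : length x < length z
    length-< = subst (length x <_) (sym (length-pair x certificate))
      (s≤s (≤-trans (m≤m*n (length x) 2) (m≤m+n (length x * 2) _)))

  certificate-≤ : length certificate ≤ 3 * length x * length x * length x
  certificate-≤ = ≤-trans (≤-reflexive (length-applyUpTo entry-bit total))
    (*-mono-≤ (*-mono-≤ (*-monoʳ-≤ 3 N≤) N≤) N≤)
    where
    N≤ : N ≤ length x
    N≤ = ≤-trans (m≤m+n N _) (≤-reflexive (sym E.length-y))

accepted-NP : ∀ r → NP (Accepted r)
accepted-NP r = decide , coefficients bound , decidable , λ x → mk⇔ (to x) (from x)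
  where
  open Decision (decision (acceptsᵈ r))
  bound : IsPolynomial (λ ℓ → 3 * ℓ * ℓ * ℓ)
  bound = poly-* (poly-* (poly-* (poly-const 3) poly-id) poly-id) poly-id
  to : ∀ x → Accepted r x → ∃[ c ] length c ≤ eval (coefficients bound) (length x) × decide ⟨ x , c ⟩ ≡ true
  to _ (i , refl , geo , res) =
    certificate , ≤-trans certificate-≤ (≤-reflexive (sym (evaluates bound (length x)))) ,
    Equivalence.from (correct z) accepts
    where open VerifierComplete i geo r res
  from : ∀ x → ∃[ c ] length c ≤ eval (coefficients bound) (length x) × decide ⟨ x , c ⟩ ≡ true → Accepted r x
  from x (c , _ , accept) = read (Equivalence.to (correct ⟨ x , c ⟩) accept)
    where
    read : Accepts r ⟨ x , c ⟩ → Accepted r x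
    read (ℓ , _ , ends , N , _ , valid) with refl ← wordLength-unique x c {ℓ} ends =
      VerifierSound.accepted x c N r valid

NP-⇔ : ∀ {L L′} → (∀ x → L x ⇔ L′ x) → NP L → NP L′
NP-⇔ eq (verify , q , poly , spec) = verify , q , poly , λ x → mk⇔
  (Equivalence.to (spec x) ∘ Equivalence.from (eq x)) (Equivalence.to (eq x) ∘ Equivalence.from (spec x))

corollary3 : NPComplete StrongGeodeticRecognition × NPComplete (restrict StrongGeodeticRecognition (BipartiteOfDiameter≤ 6))
corollary3 =
  (NP-⇔ (λ x → mk⇔ (λ (i , e , y , _) → i , e , y) (λ (i , e , y) → i , e , y , tt)) (accepted-NP false) , hard) ,
  (NP-⇔ (λ x → mk⇔ (λ (i , e , y , r) → (i , r) , e , y) (λ ((i , r) , e , y) → i , e , y , r)) (accepted-NP true) ,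
   restricted-hard)
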